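{- Let $k\ge 1$, let $p_1,\dots,p_k$ be distinct primes, let $m_1,\dots,m_k\ge 2$ be integers with $p_i\nmid m_i$ for $i=1,\dots,k$, and let $a_1,\dots,a_k$ be integers with $0\le a_i\le m_i-1$. Put $m:=\max\{m_i: 1\le i\le k\}$, $p:=\max\{p_i:1\le i\le k\}$ and $\delta:=1/(120k^2p^{3m}m^2)$. Then, as $N\to\infty$, $$\bigl|\{0\le n<N:\ e_{p_i}(n)\equiv a_i \pmod{m_i}\ \text{for all } 1\le i\le k\}\bigr| = \frac{N}{m_1\cdots m_k}+O(N^{1-\delta}),$$ where the implied constant depends only on $p_1,\dots,p_k$ and $m_1,\dots,m_k$ (and not on $a_1,\dots,a_k$ or $N$). In particular, for any distinct odd primes $p_1,\dots,p_k$ and any $\varepsilon_1,\dots,\varepsilon_k\in\{0,1\}$, the number of $0\le n<N$ with $e_{p_i}(n)\equiv\varepsilon_i\pmod 2$ for all $i$ is asymptotic to $N/2^k$.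
   Context: For a prime $p$ and a non-negative integer $n$, $e_p(n)$ denotes the exponent of $p$ in the prime factorization of $n!$ (with $e_p(0)=0$). -}

module Defs where

open import Algebra.Definitions.RawSemiring using () renaming (_^_ to pow)
open import Data.Fin.Properties using (all?)
open import Data.Integer.Base using (+_; -[1+_])
open import Data.List.Base using (filter; length; upTo)
open import Data.Nat.Base as ℕ using (ℕ; zero; suc; _!)
open import Data.Nat.Divisibility using (_∣_; _∣?_)
open import Data.Nat.Primality.Factorisation using (factors; factorise)
import Data.Nat.Properties as ℕ
open import Data.Product.Base using (∃-syntax)
open import Data.Rational.Base using (ℚ; 0ℚ; _/_; _≤_; _<_; _-_; _*_; ∣_∣; ↥_; ↧ₙ_; +-*-rawSemiring)
open import Data.Vec.Functional using (Vector; foldr)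
open import Relation.Binary.Definitions using (Decidable)

e : ℕ → ℕ → ℕ
e p n = length (filter (p ℕ.≟_) (factors (factorise (n !) {{n ℕ.!≢0}})))

_≡_[mod_] : ℕ → ℕ → ℕ → Set
a ≡ b [mod m ] = m ∣ ℕ.∣ a - b ∣

≡mod? : ∀ m → Decidable (_≡_[mod m ])
≡mod? m a b = m ∣? ℕ.∣ a - b ∣

count : ∀ {k} (p m a : Vector ℕ k) → ℕ → ℕ
count p m a N =
  length (filter (λ n → all? (λ i → ≡mod? (m i) (e (p i) n) (a i))) (upTo N))

-- The value on the empty vector is a convention; for nonempty vectors this is
-- the usual maximum, 0 being the least natural number.
maximum : ∀ {k} → Vector ℕ k → ℕ
maximum = foldr ℕ._⊔_ 0

∏ : ∀ {k} → Vector ℕ k → ℕ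
∏ = foldr ℕ._*_ 1

fromℕ : ℕ → ℚ
fromℕ n = + n / 1

-- Total division, with n ÷ 0 = 0 by convention.
infixl 7 _÷_
_÷_ : ℕ → ℕ → ℚ
n ÷ zero      = 0ℚ
n ÷ d@(suc _) = + n / d

infixr 8 _^_
_^_ : ℚ → ℕ → ℚ
_^_ = pow +-*-rawSemiring

-- For x ≥ 0, N ≥ 1 and a rational exponent q = u/v in lowest terms, v ≥ 1:
-- the inequality x ≤ C · N^q between real numbers, both sides raised to the
-- v-th power (and multiplied by N^(-u) when u < 0).
infix 4 _≤[_·_^_]
_≤[_·_^_] : ℚ → ℕ → ℕ → ℚ → Set
x ≤[ C · N ^ q ] with ↥ q
... | + u      = x ^ ↧ₙ q ≤ fromℕ C ^ ↧ₙ q * fromℕ N ^ u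
... | -[1+ w ] = x ^ ↧ₙ q * fromℕ N ^ suc w ≤ fromℕ C ^ ↧ₙ q

δ : ∀ {k} (p m : Vector ℕ k) → ℚ
δ {k} p m = 1 ÷ (120 ℕ.* k ℕ.^ 2 ℕ.* maximum p ℕ.^ (3 ℕ.* maximum m) ℕ.* maximum m ℕ.^ 2)

-- Asymptotic equivalence: f - g = o(g) as N → ∞.
infix 4 _∼_
_∼_ : (ℕ → ℚ) → (ℕ → ℚ) → Set
f ∼ g = ∀ ε → 0ℚ < ε → ∃[ N₀ ] (∀ N → N₀ ℕ.≤ N → ∣ f N - g N ∣ ≤ ε * ∣ g N ∣)

{-# OPTIONS --safe #-}
module Submission where

open import Defs
open import Data.Fin.Base using (Fin; toℕ)
open import Data.Nat.Base using (ℕ; _≤_; _<_) renaming (_^_ to _^ℕ_)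
open import Data.Nat.Divisibility using (_∤_)
open import Data.Nat.Primality using (Prime)
open import Data.Product.Base using (_×_; ∃-syntax)
open import Data.Rational.Base using (1ℚ; _-_; ∣_∣)
open import Function.Definitions using (Injective)
open import Relation.Binary.PropositionalEquality.Core using (_≡_)

open import Algebra.Bundles using (CommutativeRing)
open import Data.Fin.Base using (zero; suc; fromℕ<)
open import Data.Fin.Properties using (all?; suc-injective; toℕ<n)
open import Data.List.Base using (List; []; _∷_; _++_; length; filter; applyUpTo)
open import Data.List.Membership.Propositional using (_∈_)
open import Data.List.Properties using (length-++; filter-++; filter-accept; filter-none)
open import Data.List.Relation.Binary.Permutation.Propositional.Properties using (↭-length; filter-↭)
open import Data.List.Relation.Unary.All as All using ([]; _∷_)
open import Data.List.Relation.Unary.All.Properties using (++⁺)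
open import Data.Nat.Base using (zero; suc; z≤n; s≤s; z<s; s<s; _%_; _/_; NonZero; _!)
open import Data.Nat.Coprimality using (Coprime; coprime-Bézout; coprime-divisor) renaming (sym to Coprime-sym)
open import Data.Nat.Divisibility using (_∣_; _∣?_; divides; m∣m*n; n∣m*n; ∣m+n∣m⇒∣n; ∣m∣n⇒∣m+n; >⇒∤; ∣⇒≤; ∣-refl; ∣-trans; ∣1⇒≡1)
open import Data.Nat.GCD using (module Bézout)
open import Data.Nat.ListAction.Properties using (product-++; ∈⇒∣product)
open import Data.Nat.Primality using (prime⇒nonZero; prime⇒nonTrivial; prime⇒irreducible)
open import Data.Nat.Primality.Factorisation using (PrimeFactorisation; factorise; factorisationUnique; factors)
open import Data.Nat.Tactic.RingSolver using () renaming (solve-∀ to ℕ-solve-∀)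
open import Data.Product.Base using (_,_; proj₁; proj₂)
open import Data.Rational.Base using (ℚ; 0ℚ; _+_; _*_; -_; toℚᵘ)
open import Data.Sum.Base using (_⊎_; inj₁; inj₂)
open import Data.Vec.Functional using (Vector; foldr)
open import Function.Base using (id)
open import Level using (0ℓ)
open import Relation.Binary.PropositionalEquality using (_≢_; refl; sym; trans; cong; cong₂; subst; subst₂; module ≡-Reasoning)
open import Relation.Nullary.Decidable using (Dec; yes; no; _⊎-dec_; dec⇒maybe)
open import Relation.Nullary.Negation using (¬_; contradiction)
open import Tactic.RingSolver using (solve-∀)
open import Tactic.RingSolver.Core.AlmostCommutativeRing using (AlmostCommutativeRing; fromCommutativeRing)
import Algebra.Properties.CommutativeSemiring.Exp as Exp
import Data.Integer.Base as ℤ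
import Data.Integer.Properties as ℤ
import Data.Nat.Base as ℕ
import Data.Nat.DivMod as ℕ
import Data.Nat.Properties as ℕ
import Data.Rational.Base as ℚ
import Data.Rational.Properties as ℚ
import Data.Rational.Unnormalised.Base as ℚᵘ
import Data.Rational.Unnormalised.Properties as ℚᵘ
open PrimeFactorisation using (isFactorisation; factorsPrime)
open Exp (CommutativeRing.commutativeSemiring ℚ.+-*-commutativeRing) using (^-homo-*; ^-assocʳ; ^-distrib-*)

-- Since e_p(pn + d) = n + e_p(n) for d < p, the functions f_w(n) = e_p(n) + wn satisfy
-- f_w(qn + d) = f_w′(n) + f_w(d) for q = p², d < q and w′ = p + 1 + wq.  Hence the law of f_w(n + h) − f_w(n)
-- modulo m, for n uniform below a power of q, is an average of translates of the laws belonging to the quotient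
-- of h by q; among these averages the one for the last digit 1 contains two translates that differ by 1.  By the
-- Poincaré inequality on ℤ/m the squared ℓ²-distance to the uniform law, averaged over h, thus shrinks by a factor
-- 1 − 1/(q²m²) per base-q digit.  For several primes, a shift by h affects only the low digits of most n, and the
-- low digits in the coprime bases p_i² are independent by the Chinese remainder theorem, so that
-- e_{p_i}(n + h) ≡ e_{p_i}(n) for all i has density close to 1/(m₁⋯m_k) for most h.  Van der Corput's inequality
-- for the indicators of all residue tuples turns this into equidistribution with a power saving.

-- Why base p² and not p: `e p d` vanishes for all d < p, so in base p a shift by 1 without carry
-- always contributes w and no two translates differ. In base p² the digits 0 and p - 1 contribute w
-- and w + 1. The weight w changes with every digit, so all estimates are uniform in it.
--
-- The proof stays in ℚ and takes no roots. An entry x of the centred law is bounded by x ≤ τ/2 +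
-- x²/(2τ). The energy term must then be of size τ², so the contraction rate is taken to be a square
-- σ², with σ = 1 - 1/n₀, n₀ = 2p⁴m² and τ = σ^r.
--
-- With P the product of the p_i², shifts run below H = P^r, low digits have moduli between P^(2r)
-- and P^(3r), and B^r ≤ N < B^(r+1) for B = P^(5k). The squared discrepancy is then at most a
-- constant times N²σ^r. Since σ^n₀ ≤ 1/2 and B ≤ 2^(10k²p), already 20k²p⁵m² factors σ outweigh B;
-- as 3m ≥ 6, E = 60k²p^(3m)m² factors do so too. The discrepancy enters squared, hence δ = 1/(2E).

ℚ-ring : AlmostCommutativeRing 0ℓ 0ℓ
ℚ-ring = fromCommutativeRing ℚ.+-*-commutativeRing (λ x → dec⇒maybe (0ℚ ℚ.≟ x))

-- Ordered-field arithmetic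

≤-by : ∀ {a b} c → 0ℚ ℚ.≤ c → b ≡ a + c → a ℚ.≤ b
≤-by {a} {b} c 0≤c b≡a+c = subst₂ ℚ._≤_ (ℚ.+-identityʳ a) (sym b≡a+c) (ℚ.+-monoʳ-≤ a 0≤c)

≤⇒0≤- : ∀ {a b} → a ℚ.≤ b → 0ℚ ℚ.≤ b - a
≤⇒0≤- {a} {b} a≤b = subst (ℚ._≤ b - a) (ℚ.+-inverseʳ a) (ℚ.+-monoˡ-≤ (- a) a≤b)

+-nonneg : ∀ {a b} → 0ℚ ℚ.≤ a → 0ℚ ℚ.≤ b → 0ℚ ℚ.≤ a + b
+-nonneg 0≤a 0≤b = ℚ.+-mono-≤ 0≤a 0≤b

*-monoˡ : ∀ {a b} c → 0ℚ ℚ.≤ c → a ℚ.≤ b → c * a ℚ.≤ c * b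
*-monoˡ c 0≤c a≤b = ℚ.*-monoˡ-≤-nonNeg c {{ℚ.nonNegative 0≤c}} a≤b

*-monoʳ : ∀ {a b} c → 0ℚ ℚ.≤ c → a ℚ.≤ b → a * c ℚ.≤ b * c
*-monoʳ c 0≤c a≤b = ℚ.*-monoʳ-≤-nonNeg c {{ℚ.nonNegative 0≤c}} a≤b

*-nonneg : ∀ {a b} → 0ℚ ℚ.≤ a → 0ℚ ℚ.≤ b → 0ℚ ℚ.≤ a * b
*-nonneg {a} {b} 0≤a 0≤b = subst (ℚ._≤ a * b) (ℚ.*-zeroʳ a) (*-monoˡ a 0≤a 0≤b)

*-mono : ∀ {a b c d} → 0ℚ ℚ.≤ b → 0ℚ ℚ.≤ c → a ℚ.≤ b → c ℚ.≤ d → a * c ℚ.≤ b * d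
*-mono {a} {b} {c} {d} 0≤b 0≤c a≤b c≤d = ℚ.≤-trans (*-monoʳ c 0≤c a≤b) (*-monoˡ b 0≤b c≤d)

0≤1 : 0ℚ ℚ.≤ 1ℚ
0≤1 = ℚ.nonNegative⁻¹ 1ℚ

0≤½ : 0ℚ ℚ.≤ ℚ.½
0≤½ = ℚ.nonNegative⁻¹ ℚ.½

²-nonneg : ∀ a → 0ℚ ℚ.≤ a * a
²-nonneg a with ℚ.≤-total 0ℚ a
... | inj₁ 0≤a = *-nonneg 0≤a 0≤a
... | inj₂ a≤0 = subst (0ℚ ℚ.≤_) (neg² a) (*-nonneg (ℚ.neg-antimono-≤ a≤0) (ℚ.neg-antimono-≤ a≤0))
  where
  neg² : ∀ a → (- a) * (- a) ≡ a * a
  neg² = solve-∀ ℚ-ring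

∣x∣²≡x² : ∀ x → ∣ x ∣ * ∣ x ∣ ≡ x * x
∣x∣²≡x² x = trans (sym (ℚ.∣p*q∣≡∣p∣*∣q∣ x x)) (ℚ.0≤p⇒∣p∣≡p (²-nonneg x))

≤∣∣ : ∀ x → x ℚ.≤ ∣ x ∣
≤∣∣ x with ℚ.≤-total 0ℚ x
... | inj₁ 0≤x = ℚ.≤-reflexive (sym (ℚ.0≤p⇒∣p∣≡p 0≤x))
... | inj₂ x≤0 = ℚ.≤-trans x≤0 (ℚ.0≤∣p∣ x)

*-cancelˡ : ∀ {a b} c → 0ℚ ℚ.< c → c * a ℚ.≤ c * b → a ℚ.≤ b
*-cancelˡ c 0<c = ℚ.*-cancelˡ-≤-pos c {{ℚ.positive 0<c}}

fromℕ-+ : ∀ a b → fromℕ (a ℕ.+ b) ≡ fromℕ a + fromℕ b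
fromℕ-+ a b = ℚ.toℚᵘ-injective (begin
  toℚᵘ (fromℕ (a ℕ.+ b))              ≈⟨ ℚ.toℚᵘ-fromℚᵘ (ℚᵘ.mkℚᵘ (ℤ.+ (a ℕ.+ b)) 0) ⟩
  ℚᵘ.mkℚᵘ (ℤ.+ (a ℕ.+ b)) 0             ≈⟨ ℚᵘ.*≡* (cong (ℤ._* ℤ.+ 1) (sym (cong₂ ℤ._+_ (ℤ.*-identityʳ (ℤ.+ a)) (ℤ.*-identityʳ (ℤ.+ b))))) ⟩
  ℚᵘ.mkℚᵘ (ℤ.+ a) 0 ℚᵘ.+ ℚᵘ.mkℚᵘ (ℤ.+ b) 0 ≈⟨ ℚᵘ.+-cong (ℚ.toℚᵘ-fromℚᵘ (ℚᵘ.mkℚᵘ (ℤ.+ a) 0)) (ℚ.toℚᵘ-fromℚᵘ (ℚᵘ.mkℚᵘ (ℤ.+ b) 0)) ⟨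
  toℚᵘ (fromℕ a) ℚᵘ.+ toℚᵘ (fromℕ b)  ≈⟨ ℚ.toℚᵘ-homo-+ (fromℕ a) (fromℕ b) ⟨
  toℚᵘ (fromℕ a + fromℕ b)            ∎)
  where open ℚᵘ.≃-Reasoning

fromℕ-* : ∀ a b → fromℕ (a ℕ.* b) ≡ fromℕ a * fromℕ b
fromℕ-* a b = ℚ.toℚᵘ-injective (begin
  toℚᵘ (fromℕ (a ℕ.* b))              ≈⟨ ℚ.toℚᵘ-fromℚᵘ (ℚᵘ.mkℚᵘ (ℤ.+ (a ℕ.* b)) 0) ⟩
  ℚᵘ.mkℚᵘ (ℤ.+ (a ℕ.* b)) 0             ≈⟨ ℚᵘ.*≡* (cong (ℤ._* ℤ.+ 1) (ℤ.pos-* a b)) ⟩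
  ℚᵘ.mkℚᵘ (ℤ.+ a) 0 ℚᵘ.* ℚᵘ.mkℚᵘ (ℤ.+ b) 0 ≈⟨ ℚᵘ.*-cong (ℚ.toℚᵘ-fromℚᵘ (ℚᵘ.mkℚᵘ (ℤ.+ a) 0)) (ℚ.toℚᵘ-fromℚᵘ (ℚᵘ.mkℚᵘ (ℤ.+ b) 0)) ⟨
  toℚᵘ (fromℕ a) ℚᵘ.* toℚᵘ (fromℕ b)  ≈⟨ ℚ.toℚᵘ-homo-* (fromℕ a) (fromℕ b) ⟨
  toℚᵘ (fromℕ a * fromℕ b)            ∎)
  where
  open ℚᵘ.≃-Reasoning

fromℕ-nonneg : ∀ n → 0ℚ ℚ.≤ fromℕ n
fromℕ-nonneg n = ℚ.nonNegative⁻¹ (fromℕ n) {{ℚ.normalize-nonNeg n 1}}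

fromℕ-mono : ∀ {a b} → a ≤ b → fromℕ a ℚ.≤ fromℕ b
fromℕ-mono {a} {b} a≤b = ≤-by (fromℕ (b ℕ.∸ a)) (fromℕ-nonneg (b ℕ.∸ a))
  (trans (cong fromℕ (sym (ℕ.m+[n∸m]≡n a≤b))) (fromℕ-+ a (b ℕ.∸ a)))

fromℕ-pos : ∀ {n} → 1 ≤ n → 0ℚ ℚ.< fromℕ n
fromℕ-pos 1≤n = ℚ.<-≤-trans (ℚ.positive⁻¹ 1ℚ) (fromℕ-mono 1≤n)

fromℕ-^ : ∀ a n → fromℕ (a ^ℕ n) ≡ fromℕ a ^ n
fromℕ-^ a zero    = refl
fromℕ-^ a (suc n) = trans (fromℕ-* a (a ^ℕ n)) (cong (fromℕ a *_) (fromℕ-^ a n))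

≤fromℕ : ∀ x → ∃[ n ] (x ℚ.≤ fromℕ n)
≤fromℕ x = ℤ.∣ ℚ.↥ x ∣ , ℚ.≤-trans (≤∣∣ x) (bound x)
  where
  bound : ∀ x → ∣ x ∣ ℚ.≤ fromℕ ℤ.∣ ℚ.↥ x ∣
  bound (ℚ.mkℚ i d c) = ℚ.toℚᵘ-cancel-≤ (ℚᵘ.≤-respʳ-≃
      (ℚᵘ.≃-sym (ℚ.toℚᵘ-fromℚᵘ (ℚᵘ.mkℚᵘ (ℤ.+ ℤ.∣ i ∣) 0)))
      (ℚᵘ.≤-respˡ-≃ (ℚᵘ.≃-sym (ℚ.toℚᵘ-homo-∣-∣ (ℚ.mkℚ i d c))) (ℚᵘ.*≤* (ℤ.*-monoˡ-≤-nonNeg (ℤ.+ ℤ.∣ i ∣) (ℤ.+≤+ (s≤s z≤n))))))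

fromℕ*1÷ : ∀ {n} → 1 ≤ n → fromℕ n * (1 ÷ n) ≡ 1ℚ
fromℕ*1÷ {suc n} _ = ℚ.toℚᵘ-injective (begin
  toℚᵘ (fromℕ (suc n) * (1 ÷ suc n))             ≈⟨ ℚ.toℚᵘ-homo-* (fromℕ (suc n)) (1 ÷ suc n) ⟩
  toℚᵘ (fromℕ (suc n)) ℚᵘ.* toℚᵘ (1 ÷ suc n)     ≈⟨ ℚᵘ.*-cong (ℚ.toℚᵘ-fromℚᵘ (ℚᵘ.mkℚᵘ (ℤ.+ suc n) 0)) (ℚ.toℚᵘ-fromℚᵘ (ℚᵘ.mkℚᵘ (ℤ.+ 1) n)) ⟩
  ℚᵘ.mkℚᵘ (ℤ.+ suc n) 0 ℚᵘ.* ℚᵘ.mkℚᵘ (ℤ.+ 1) n       ≈⟨ ℚᵘ.*≡* (trans (ℤ.*-identityʳ _) (trans (ℤ.*-identityʳ _) (sym (trans (ℤ.*-identityˡ _) (cong ℤ.+_ (ℕ.*-identityˡ (suc n))))))) ⟩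
  toℚᵘ 1ℚ                                        ∎)
  where open ℚᵘ.≃-Reasoning

1÷-unique : ∀ {n} x → 1 ≤ n → fromℕ n * x ≡ 1ℚ → x ≡ 1 ÷ n
1÷-unique {n} x 1≤n n*x≡1 = begin
  x                           ≡⟨ ℚ.*-identityˡ x ⟨
  1ℚ * x                      ≡⟨ cong (_* x) (fromℕ*1÷ 1≤n) ⟨
  (fromℕ n * (1 ÷ n)) * x     ≡⟨ swap (fromℕ n) (1 ÷ n) x ⟩
  (fromℕ n * x) * (1 ÷ n)     ≡⟨ cong (_* (1 ÷ n)) n*x≡1 ⟩
  1ℚ * (1 ÷ n)                ≡⟨ ℚ.*-identityˡ (1 ÷ n) ⟩
  1 ÷ n                       ∎
  where
  open ≡-Reasoning
  swap : ∀ a b c → (a * b) * c ≡ (a * c) * b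
  swap = solve-∀ ℚ-ring

1÷-nonneg : ∀ n → 0ℚ ℚ.≤ 1 ÷ n
1÷-nonneg zero    = ℚ.≤-refl
1÷-nonneg (suc n) = ℚ.nonNegative⁻¹ (1 ÷ suc n) {{ℚ.normalize-nonNeg 1 (suc n)}}

1÷-≤1 : ∀ n → 1 ÷ n ℚ.≤ 1ℚ
1÷-≤1 zero    = 0≤1
1÷-≤1 (suc n) = begin
  1 ÷ suc n                   ≡⟨ ℚ.*-identityˡ (1 ÷ suc n) ⟨
  1ℚ * (1 ÷ suc n)            ≤⟨ *-monoʳ (1 ÷ suc n) (1÷-nonneg (suc n)) (fromℕ-mono {1} {suc n} (s≤s z≤n)) ⟩
  fromℕ (suc n) * (1 ÷ suc n) ≡⟨ fromℕ*1÷ {suc n} (s≤s z≤n) ⟩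
  1ℚ                          ∎
  where open ℚ.≤-Reasoning

÷-as-* : ∀ a {n} → 1 ≤ n → a ÷ n ≡ fromℕ a * (1 ÷ n)
÷-as-* a {suc n} _ = ℚ.toℚᵘ-injective (begin
  toℚᵘ (a ÷ suc n)                        ≈⟨ ℚ.toℚᵘ-fromℚᵘ (ℚᵘ.mkℚᵘ (ℤ.+ a) n) ⟩
  ℚᵘ.mkℚᵘ (ℤ.+ a) n                         ≈⟨ ℚᵘ.*≡* (cong₂ ℤ._*_ (sym (ℤ.*-identityʳ (ℤ.+ a))) (cong ℤ.+_ (ℕ.*-identityˡ (suc n)))) ⟩
  ℚᵘ.mkℚᵘ (ℤ.+ a) 0 ℚᵘ.* ℚᵘ.mkℚᵘ (ℤ.+ 1) n    ≈⟨ ℚᵘ.*-cong (ℚ.toℚᵘ-fromℚᵘ (ℚᵘ.mkℚᵘ (ℤ.+ a) 0)) (ℚ.toℚᵘ-fromℚᵘ (ℚᵘ.mkℚᵘ (ℤ.+ 1) n)) ⟨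
  toℚᵘ (fromℕ a) ℚᵘ.* toℚᵘ (1 ÷ suc n)    ≈⟨ ℚ.toℚᵘ-homo-* (fromℕ a) (1 ÷ suc n) ⟨
  toℚᵘ (fromℕ a * (1 ÷ suc n))            ∎)
  where
  open ℚᵘ.≃-Reasoning

1÷-* : ∀ a b → 1 ≤ a → 1 ≤ b → 1 ÷ (a ℕ.* b) ≡ (1 ÷ a) * (1 ÷ b)
1÷-* a b 1≤a 1≤b = sym (1÷-unique ((1 ÷ a) * (1 ÷ b)) (ℕ.*-mono-≤ 1≤a 1≤b) (begin
  fromℕ (a ℕ.* b) * ((1 ÷ a) * (1 ÷ b))      ≡⟨ cong (_* ((1 ÷ a) * (1 ÷ b))) (fromℕ-* a b) ⟩
  fromℕ a * fromℕ b * ((1 ÷ a) * (1 ÷ b))    ≡⟨ regroup (fromℕ a) (fromℕ b) (1 ÷ a) (1 ÷ b) ⟩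
  (fromℕ a * (1 ÷ a)) * (fromℕ b * (1 ÷ b))  ≡⟨ cong₂ _*_ (fromℕ*1÷ 1≤a) (fromℕ*1÷ 1≤b) ⟩
  1ℚ                                         ∎))
  where
  open ≡-Reasoning
  regroup : ∀ a b c d → a * b * (c * d) ≡ (a * c) * (b * d)
  regroup = solve-∀ ℚ-ring

^-nonneg : ∀ {x} n → 0ℚ ℚ.≤ x → 0ℚ ℚ.≤ x ^ n
^-nonneg zero    0≤x = 0≤1
^-nonneg (suc n) 0≤x = *-nonneg 0≤x (^-nonneg n 0≤x)

^-mono : ∀ {x y} n → 0ℚ ℚ.≤ x → x ℚ.≤ y → x ^ n ℚ.≤ y ^ n
^-mono zero    0≤x x≤y = ℚ.≤-refl
^-mono (suc n) 0≤x x≤y = *-mono (ℚ.≤-trans 0≤x x≤y) (^-nonneg n 0≤x) x≤y (^-mono n 0≤x x≤y)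

1^n≡1 : ∀ n → 1ℚ ^ n ≡ 1ℚ
1^n≡1 zero    = refl
1^n≡1 (suc n) = trans (ℚ.*-identityˡ _) (1^n≡1 n)

^-≤1 : ∀ {x} n → 0ℚ ℚ.≤ x → x ℚ.≤ 1ℚ → x ^ n ℚ.≤ 1ℚ
^-≤1 n 0≤x x≤1 = ℚ.≤-trans (^-mono n 0≤x x≤1) (ℚ.≤-reflexive (1^n≡1 n))

1≤^ : ∀ {x} n → 1ℚ ℚ.≤ x → 1ℚ ℚ.≤ x ^ n
1≤^ n 1≤x = ℚ.≤-trans (ℚ.≤-reflexive (sym (1^n≡1 n))) (^-mono n 0≤1 1≤x)

^-antitone : ∀ {x m n} → 0ℚ ℚ.≤ x → x ℚ.≤ 1ℚ → m ≤ n → x ^ n ℚ.≤ x ^ m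
^-antitone {x} {m} {n} 0≤x x≤1 m≤n = begin
  x ^ n                      ≡⟨ cong (x ^_) (ℕ.m+[n∸m]≡n m≤n) ⟨
  x ^ (m ℕ.+ (n ℕ.∸ m))      ≡⟨ ^-homo-* x m (n ℕ.∸ m) ⟩
  x ^ m * x ^ (n ℕ.∸ m)      ≤⟨ *-monoˡ (x ^ m) (^-nonneg m 0≤x) (^-≤1 (n ℕ.∸ m) 0≤x x≤1) ⟩
  x ^ m * 1ℚ                 ≡⟨ ℚ.*-identityʳ (x ^ m) ⟩
  x ^ m                      ∎
  where open ℚ.≤-Reasoning

-- Finite sums

∑ : ℕ → (ℕ → ℚ) → ℚ
∑ zero    f = 0ℚ
∑ (suc n) f = f 0 + ∑ n (λ i → f (suc i))

∑-cong< : ∀ n {f g} → (∀ i → i < n → f i ≡ g i) → ∑ n f ≡ ∑ n g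
∑-cong< zero    f≡g = refl
∑-cong< (suc n) f≡g = cong₂ _+_ (f≡g 0 z<s) (∑-cong< n (λ i i<n → f≡g (suc i) (s<s i<n)))

∑-cong : ∀ n {f g} → (∀ i → f i ≡ g i) → ∑ n f ≡ ∑ n g
∑-cong n f≡g = ∑-cong< n (λ i _ → f≡g i)

∑-mono< : ∀ n {f g} → (∀ i → i < n → f i ℚ.≤ g i) → ∑ n f ℚ.≤ ∑ n g
∑-mono< zero    f≤g = ℚ.≤-refl
∑-mono< (suc n) f≤g = ℚ.+-mono-≤ (f≤g 0 z<s) (∑-mono< n (λ i i<n → f≤g (suc i) (s<s i<n)))

∑-mono : ∀ n {f g} → (∀ i → f i ℚ.≤ g i) → ∑ n f ℚ.≤ ∑ n g
∑-mono n f≤g = ∑-mono< n (λ i _ → f≤g i)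

∑-+ : ∀ n f g → ∑ n (λ i → f i + g i) ≡ ∑ n f + ∑ n g
∑-+ zero    f g = refl
∑-+ (suc n) f g = trans (cong ((f 0 + g 0) +_) (∑-+ n (λ i → f (suc i)) (λ i → g (suc i)))) (interchange (f 0) (g 0) _ _)
  where
  interchange : ∀ a b c d → a + b + (c + d) ≡ a + c + (b + d)
  interchange = solve-∀ ℚ-ring

∑-* : ∀ n c f → ∑ n (λ i → c * f i) ≡ c * ∑ n f
∑-* zero    c f = sym (ℚ.*-zeroʳ c)
∑-* (suc n) c f = trans (cong (c * f 0 +_) (∑-* n c (λ i → f (suc i)))) (sym (ℚ.*-distribˡ-+ c (f 0) _))

∑-const : ∀ n c → ∑ n (λ _ → c) ≡ fromℕ n * c
∑-const zero    c = sym (ℚ.*-zeroˡ c)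
∑-const (suc n) c = begin
  c + ∑ n (λ _ → c)      ≡⟨ cong (c +_) (∑-const n c) ⟩
  c + fromℕ n * c        ≡⟨ factor c (fromℕ n) ⟩
  (1ℚ + fromℕ n) * c     ≡⟨ cong (_* c) (fromℕ-+ 1 n) ⟨
  fromℕ (suc n) * c      ∎
  where
  open ≡-Reasoning
  factor : ∀ c n → c + n * c ≡ (1ℚ + n) * c
  factor = solve-∀ ℚ-ring

∑-last : ∀ n f → ∑ (suc n) f ≡ ∑ n f + f n
∑-last zero    f = ℚ.+-comm (f 0) 0ℚ
∑-last (suc n) f = trans (cong (f 0 +_) (∑-last n (λ i → f (suc i)))) (sym (ℚ.+-assoc (f 0) _ _))

∑-split : ∀ m n f → ∑ (m ℕ.+ n) f ≡ ∑ m f + ∑ n (λ i → f (m ℕ.+ i))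
∑-split zero    n f = sym (ℚ.+-identityˡ _)
∑-split (suc m) n f = trans (cong (f 0 +_) (∑-split m n (λ i → f (suc i)))) (sym (ℚ.+-assoc (f 0) _ _))

∑-blocks : ∀ m n f → ∑ (m ℕ.* n) f ≡ ∑ m (λ i → ∑ n (λ j → f (n ℕ.* i ℕ.+ j)))
∑-blocks zero    n f = refl
∑-blocks (suc m) n f = trans (∑-split n (m ℕ.* n) f) (cong₂ _+_
  (∑-cong n (λ j → cong (λ x → f (x ℕ.+ j)) (sym (ℕ.*-zeroʳ n))))
  (trans (∑-blocks m n (λ i → f (n ℕ.+ i)))
    (∑-cong m (λ i → ∑-cong n (λ j → cong f (trans (sym (ℕ.+-assoc n (n ℕ.* i) j)) (cong (ℕ._+ j) (sym (ℕ.*-suc n i)))))))))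

∑-swap : ∀ m n (f : ℕ → ℕ → ℚ) → ∑ m (λ i → ∑ n (f i)) ≡ ∑ n (λ j → ∑ m (λ i → f i j))
∑-swap zero    n f = sym (trans (∑-const n 0ℚ) (ℚ.*-zeroʳ (fromℕ n)))
∑-swap (suc m) n f = trans (cong (∑ n (f 0) +_) (∑-swap m n (λ i → f (suc i)))) (sym (∑-+ n (f 0) _))

∑-nonneg : ∀ n {f} → (∀ i → 0ℚ ℚ.≤ f i) → 0ℚ ℚ.≤ ∑ n f
∑-nonneg zero    0≤f = ℚ.≤-refl
∑-nonneg (suc n) 0≤f = +-nonneg (0≤f 0) (∑-nonneg n (λ i → 0≤f (suc i)))

∑-nonneg< : ∀ n {f} → (∀ i → i < n → 0ℚ ℚ.≤ f i) → 0ℚ ℚ.≤ ∑ n f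
∑-nonneg< zero    0≤f = ℚ.≤-refl
∑-nonneg< (suc n) 0≤f = +-nonneg (0≤f 0 z<s) (∑-nonneg< n (λ i i<n → 0≤f (suc i) (s<s i<n)))

∑-mono-len : ∀ {m n f} → (∀ i → 0ℚ ℚ.≤ f i) → m ≤ n → ∑ m f ℚ.≤ ∑ n f
∑-mono-len {m} {n} {f} 0≤f m≤n = ≤-by _ (∑-nonneg (n ℕ.∸ m) (λ i → 0≤f (m ℕ.+ i)))
  (trans (cong (λ x → ∑ x f) (sym (ℕ.m+[n∸m]≡n m≤n))) (∑-split m (n ℕ.∸ m) f))

∑-term< : ∀ n a {f} → (∀ i → i < n → 0ℚ ℚ.≤ f i) → a < n → f a ℚ.≤ ∑ n f
∑-term< (suc n) zero    {f} 0≤f _ = ≤-by _ (∑-nonneg< n (λ i i<n → 0≤f (suc i) (s<s i<n))) refl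
∑-term< (suc n) (suc a) {f} 0≤f (s≤s a<n) = ℚ.≤-trans (∑-term< n a (λ i i<n → 0≤f (suc i) (s<s i<n)) a<n)
  (≤-by (f 0) (0≤f 0 z<s) (ℚ.+-comm (f 0) _))

∑-two-terms : ∀ {n a b f} → (∀ i → 0ℚ ℚ.≤ f i) → a < b → b < n → f a + f b ℚ.≤ ∑ n f
∑-two-terms {n} {a} {b} {f} 0≤f a<b b<n = begin
  f a + f b       ≤⟨ ℚ.+-monoˡ-≤ (f b) (∑-term< b a (λ i _ → 0≤f i) a<b) ⟩
  ∑ b f + f b     ≡⟨ ∑-last b f ⟨
  ∑ (suc b) f     ≤⟨ ∑-mono-len 0≤f b<n ⟩
  ∑ n f           ∎
  where open ℚ.≤-Reasoning

-- Moving a window of one period by one step drops its first term and gains the term one period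
-- later, which is equal.
∑-shift : ∀ m {f} → (∀ i → f (m ℕ.+ i) ≡ f i) → ∀ s → ∑ m (λ i → f (s ℕ.+ i)) ≡ ∑ m f
∑-shift m per zero    = refl
∑-shift m {f} per (suc s) = begin
  ∑ m (λ i → f (suc (s ℕ.+ i)))    ≡⟨ ∑-cong m (λ i → cong f (ℕ.+-suc s i)) ⟨
  ∑ m (λ i → f (s ℕ.+ suc i))      ≡⟨ rotate (λ i → f (s ℕ.+ i)) f[s+m]≡f[s] ⟩
  ∑ m (λ i → f (s ℕ.+ i))          ≡⟨ ∑-shift m per s ⟩
  ∑ m f                            ∎
  where
  open ≡-Reasoning
  f[s+m]≡f[s] : f (s ℕ.+ m) ≡ f (s ℕ.+ 0)
  f[s+m]≡f[s] = trans (cong f (ℕ.+-comm s m)) (trans (per s) (cong f (sym (ℕ.+-identityʳ s))))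
  cancel : ∀ x a b → a + x ≡ b + a → x ≡ b
  cancel x a b a+x≡b+a = trans (trans (solve₁ a x) (cong (- a +_) a+x≡b+a)) (solve₂ a b)
    where
    solve₁ : ∀ a x → x ≡ - a + (a + x)
    solve₁ = solve-∀ ℚ-ring
    solve₂ : ∀ a b → - a + (b + a) ≡ b
    solve₂ = solve-∀ ℚ-ring
  rotate : ∀ g → g m ≡ g 0 → ∑ m (λ i → g (suc i)) ≡ ∑ m g
  rotate g gm≡g0 = cancel _ (g 0) _ (trans (∑-last m g) (cong (∑ m g +_) gm≡g0))

∑-square-deviation : ∀ n f μ → ∑ n (λ i → (f i - μ) * (f i - μ)) ≡ ∑ n (λ i → f i * f i) - (μ + μ) * ∑ n f + fromℕ n * (μ * μ)
∑-square-deviation n f μ = begin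
  ∑ n (λ i → (f i - μ) * (f i - μ))                                               ≡⟨ ∑-cong n (λ i → expand (f i) μ) ⟩
  ∑ n (λ i → f i * f i + (- (μ + μ) * f i + μ * μ))                               ≡⟨ ∑-+ n (λ i → f i * f i) (λ i → - (μ + μ) * f i + μ * μ) ⟩
  ∑ n (λ i → f i * f i) + ∑ n (λ i → - (μ + μ) * f i + μ * μ)                     ≡⟨ cong (∑ n (λ i → f i * f i) +_) (∑-+ n (λ i → - (μ + μ) * f i) (λ _ → μ * μ)) ⟩
  ∑ n (λ i → f i * f i) + (∑ n (λ i → - (μ + μ) * f i) + ∑ n (λ _ → μ * μ))       ≡⟨ cong (λ x → ∑ n (λ i → f i * f i) + x) (cong₂ _+_ (∑-* n (- (μ + μ)) f) (∑-const n (μ * μ))) ⟩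
  ∑ n (λ i → f i * f i) + (- (μ + μ) * ∑ n f + fromℕ n * (μ * μ))                 ≡⟨ regroup (∑ n (λ i → f i * f i)) μ (∑ n f) (fromℕ n) ⟩
  ∑ n (λ i → f i * f i) - (μ + μ) * ∑ n f + fromℕ n * (μ * μ)                     ∎
  where
  open ≡-Reasoning
  expand : ∀ x μ → (x - μ) * (x - μ) ≡ x * x + (- (μ + μ) * x + μ * μ)
  expand = solve-∀ ℚ-ring
  regroup : ∀ a μ s n → a + (- (μ + μ) * s + n * (μ * μ)) ≡ a - (μ + μ) * s + n * (μ * μ)
  regroup = solve-∀ ℚ-ring

-- Means, variance and indicators

mean : ℕ → (ℕ → ℚ) → ℚ
mean n f = (1 ÷ n) * ∑ n f

-- The variance identity. The variance is kept, not merely bounded below by 0, because it is the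
-- loss of energy that drives the decay.
mean-variance : ∀ {n} → 1 ≤ n → ∀ f → let μ = mean n f in
                μ * μ + mean n (λ i → (f i - μ) * (f i - μ)) ≡ mean n (λ i → f i * f i)
mean-variance {n} 1≤n f = begin
  μ * μ + (1 ÷ n) * ∑ n (λ i → (f i - μ) * (f i - μ))            ≡⟨ cong (λ x → μ * μ + (1 ÷ n) * x) (∑-square-deviation n f μ) ⟩
  μ * μ + (1 ÷ n) * (S₂ - (μ + μ) * ∑ n f + fromℕ n * (μ * μ))   ≡⟨ regroup μ (1 ÷ n) S₂ (∑ n f) (fromℕ n) ⟩
  (1 ÷ n) * S₂ + μ * ((μ - (1 ÷ n) * ∑ n f) + (μ * (fromℕ n * (1 ÷ n)) - (1 ÷ n) * ∑ n f))  ≡⟨ cong (λ x → (1 ÷ n) * S₂ + μ * ((μ - μ) + (μ * x - μ))) (fromℕ*1÷ 1≤n) ⟩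
  (1 ÷ n) * S₂ + μ * ((μ - μ) + (μ * 1ℚ - μ))                    ≡⟨ vanish ((1 ÷ n) * S₂) μ ⟩
  (1 ÷ n) * S₂                                                   ∎
  where
  open ≡-Reasoning
  μ  = mean n f
  S₂ = ∑ n (λ i → f i * f i)
  regroup : ∀ μ ν s₂ s n → μ * μ + ν * (s₂ - (μ + μ) * s + n * (μ * μ)) ≡ ν * s₂ + μ * ((μ - ν * s) + (μ * (n * ν) - ν * s))
  regroup = solve-∀ ℚ-ring
  vanish : ∀ x μ → x + μ * ((μ - μ) + (μ * 1ℚ - μ)) ≡ x
  vanish = solve-∀ ℚ-ring

-- Cauchy-Schwarz against the constant 1, which is nonnegativity of the variance.
∑-cauchy : ∀ n f → ∑ n f * ∑ n f ℚ.≤ fromℕ n * ∑ n (λ i → f i * f i)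
∑-cauchy zero    f = ℚ.≤-reflexive (sym (ℚ.*-zeroˡ 0ℚ))
∑-cauchy n@(suc _) f = begin
  ∑ n f * ∑ n f                                    ≡⟨ cong₂ _*_ n*μ≡ n*μ≡ ⟨
  (fromℕ n * μ) * (fromℕ n * μ)                    ≡⟨ regroup₁ (fromℕ n) μ ⟩
  (fromℕ n * fromℕ n) * (μ * μ)                    ≤⟨ *-monoˡ (fromℕ n * fromℕ n) (²-nonneg (fromℕ n)) μ²≤ ⟩
  (fromℕ n * fromℕ n) * ((1 ÷ n) * S₂)             ≡⟨ regroup₂ (fromℕ n) (1 ÷ n) S₂ ⟩
  fromℕ n * ((fromℕ n * (1 ÷ n)) * S₂)             ≡⟨ cong (λ x → fromℕ n * (x * S₂)) (fromℕ*1÷ {n} z<s) ⟩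
  fromℕ n * (1ℚ * S₂)                              ≡⟨ cong (fromℕ n *_) (ℚ.*-identityˡ S₂) ⟩
  fromℕ n * S₂                                     ∎
  where
  open ℚ.≤-Reasoning
  μ  = mean n f
  S₂ = ∑ n (λ i → f i * f i)
  n*μ≡ : fromℕ n * μ ≡ ∑ n f
  n*μ≡ = trans (sym (ℚ.*-assoc (fromℕ n) (1 ÷ n) (∑ n f))) (trans (cong (_* ∑ n f) (fromℕ*1÷ {n} z<s)) (ℚ.*-identityˡ _))
  μ²≤ : μ * μ ℚ.≤ (1 ÷ n) * S₂
  μ²≤ = ≤-by _ (*-nonneg (1÷-nonneg n) (∑-nonneg n (λ i → ²-nonneg (f i - μ)))) (sym (mean-variance {n} z<s f))
  regroup₁ : ∀ a b → (a * b) * (a * b) ≡ (a * a) * (b * b)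
  regroup₁ = solve-∀ ℚ-ring
  regroup₂ : ∀ a b c → (a * a) * (b * c) ≡ a * ((a * b) * c)
  regroup₂ = solve-∀ ℚ-ring

⟦_⟧ : ∀ {ℓ} {A : Set ℓ} → Dec A → ℚ
⟦ yes _ ⟧ = 1ℚ
⟦ no  _ ⟧ = 0ℚ

⟦⟧-nonneg : ∀ {ℓ} {A : Set ℓ} (d : Dec A) → 0ℚ ℚ.≤ ⟦ d ⟧
⟦⟧-nonneg (yes _) = 0≤1
⟦⟧-nonneg (no  _) = ℚ.≤-refl

⟦⟧-≤1 : ∀ {ℓ} {A : Set ℓ} (d : Dec A) → ⟦ d ⟧ ℚ.≤ 1ℚ
⟦⟧-≤1 (yes _) = ℚ.≤-refl
⟦⟧-≤1 (no  _) = 0≤1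

⟦⟧-mono : ∀ {ℓ₁ ℓ₂} {A : Set ℓ₁} {B : Set ℓ₂} (d : Dec A) (d′ : Dec B) → (A → B) → ⟦ d ⟧ ℚ.≤ ⟦ d′ ⟧
⟦⟧-mono (yes a) (yes b)  A→B = ℚ.≤-refl
⟦⟧-mono (yes a) (no ¬b)  A→B = contradiction (A→B a) ¬b
⟦⟧-mono (no ¬a) d′       A→B = ⟦⟧-nonneg d′

⟦⟧-cong : ∀ {ℓ₁ ℓ₂} {A : Set ℓ₁} {B : Set ℓ₂} (d : Dec A) (d′ : Dec B) → (A → B) → (B → A) → ⟦ d ⟧ ≡ ⟦ d′ ⟧
⟦⟧-cong d d′ A→B B→A = ℚ.≤-antisym (⟦⟧-mono d d′ A→B) (⟦⟧-mono d′ d B→A)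

⟦⟧-yes : ∀ {ℓ} {A : Set ℓ} (d : Dec A) → A → ⟦ d ⟧ ≡ 1ℚ
⟦⟧-yes (yes _) a = refl
⟦⟧-yes (no ¬a) a = contradiction a ¬a

⟦⟧-no : ∀ {ℓ} {A : Set ℓ} (d : Dec A) → ¬ A → ⟦ d ⟧ ≡ 0ℚ
⟦⟧-no (yes a) ¬a = contradiction a ¬a
⟦⟧-no (no _)  ¬a = refl

-- Legendre's recursion

occurrences : ℕ → List ℕ → ℕ
occurrences p xs = length (filter (p ℕ.≟_) xs)

occurrences-++ : ∀ p xs ys → occurrences p (xs ++ ys) ≡ occurrences p xs ℕ.+ occurrences p ys
occurrences-++ p xs ys = trans (cong length (filter-++ (p ℕ.≟_) xs ys)) (length-++ (filter (p ℕ.≟_) xs))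

valuation : ℕ → (n : ℕ) .{{_ : NonZero n}} → ℕ
valuation p n = occurrences p (factors (factorise n))

-- Prime factorisations agree up to permutation, so the multiplicity of p may be read off any
-- convenient one.
valuation-unique : ∀ p {n} .{{_ : NonZero n}} (f : PrimeFactorisation n) → valuation p n ≡ occurrences p (factors f)
valuation-unique p f = ↭-length (filter-↭ (p ℕ.≟_) (factorisationUnique (factorise _) f))

valuation-* : ∀ p m n .{{_ : NonZero m}} .{{_ : NonZero n}} .{{_ : NonZero (m ℕ.* n)}} →
              valuation p (m ℕ.* n) ≡ valuation p m ℕ.+ valuation p n
valuation-* p m n = trans (valuation-unique p both) (occurrences-++ p (factors fm) (factors fn))
  where
  fm = factorise m
  fn = factorise n
  both : PrimeFactorisation (m ℕ.* n)
  both = record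
    { factors         = factors fm ++ factors fn
    ; isFactorisation = trans (cong₂ ℕ._*_ (isFactorisation fm) (isFactorisation fn)) (sym (product-++ (factors fm) (factors fn)))
    ; factorsPrime    = ++⁺ (factorsPrime fm) (factorsPrime fn)
    }

valuation-self : ∀ {p} → Prime p → .{{_ : NonZero p}} → valuation p p ≡ 1
valuation-self {p} pr = trans (valuation-unique p itself) (cong length (filter-accept (p ℕ.≟_) {x = p} {xs = []} refl))
  where
  itself : PrimeFactorisation p
  itself = record { factors = p ∷ [] ; isFactorisation = sym (ℕ.*-identityʳ p) ; factorsPrime = pr ∷ [] }

valuation-∤ : ∀ {p n} .{{_ : NonZero n}} → p ∤ n → valuation p n ≡ 0
valuation-∤ {p} {n} p∤n = cong length (filter-none (p ℕ.≟_) {xs = factors (factorise n)} (All.tabulate distinct))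
  where
  distinct : ∀ {x} → x ∈ factors (factorise n) → p ≢ x
  distinct x∈ refl = p∤n (subst (p ∣_) (sym (isFactorisation (factorise n))) (∈⇒∣product x∈))

e-suc : ∀ p n → e p (suc n) ≡ valuation p (suc n) ℕ.+ e p n
e-suc p n = valuation-* p (suc n) (n !) {{_}} {{n ℕ.!≢0}} {{suc n ℕ.!≢0}}

-- Among the factors of (pn + d)! only p, 2p, ..., np contribute. The recursion removes one factor
-- at a time: from digit d + 1 to d, and from digit 0 of block n + 1 to digit p - 1 of block n.
e-legendre : ∀ {p} → Prime p → ∀ n d → d < p → e p (p ℕ.* n ℕ.+ d) ≡ n ℕ.+ e p n
e-legendre {suc p} pr zero zero _ rewrite ℕ.*-zeroʳ p = refl
e-legendre {suc p} pr (suc n) zero _ = begin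
  e (suc p) (suc p ℕ.* suc n ℕ.+ 0)                                     ≡⟨ cong (e (suc p)) (rearrange p n) ⟩
  e (suc p) (suc N)                                                     ≡⟨ e-suc (suc p) N ⟩
  valuation (suc p) (suc N) ℕ.+ e (suc p) N                             ≡⟨ cong₂ ℕ._+_ val (e-legendre pr n p (ℕ.n<1+n p)) ⟩
  1 ℕ.+ valuation (suc p) (suc n) ℕ.+ (n ℕ.+ e (suc p) n)               ≡⟨ regroup (valuation (suc p) (suc n)) n (e (suc p) n) ⟩
  suc n ℕ.+ (valuation (suc p) (suc n) ℕ.+ e (suc p) n)                 ≡⟨ cong (suc n ℕ.+_) (e-suc (suc p) n) ⟨
  suc n ℕ.+ e (suc p) (suc n)                                           ∎
  where
  open ≡-Reasoning
  N = suc p ℕ.* n ℕ.+ p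
  rearrange : ∀ p n → suc p ℕ.* suc n ℕ.+ 0 ≡ suc (suc p ℕ.* n ℕ.+ p)
  rearrange = ℕ-solve-∀
  rearrange′ : ∀ p n → suc (suc p ℕ.* n ℕ.+ p) ≡ suc p ℕ.* suc n
  rearrange′ = ℕ-solve-∀
  regroup : ∀ v n x → 1 ℕ.+ v ℕ.+ (n ℕ.+ x) ≡ suc n ℕ.+ (v ℕ.+ x)
  regroup = ℕ-solve-∀
  val : valuation (suc p) (suc N) ≡ 1 ℕ.+ valuation (suc p) (suc n)
  val = trans (valuation-cong (rearrange′ p n)) (trans (valuation-* (suc p) (suc p) (suc n)) (cong (ℕ._+ valuation (suc p) (suc n)) (valuation-self pr)))
    where
    valuation-cong : ∀ {a b} .{{_ : NonZero a}} .{{_ : NonZero b}} → a ≡ b → valuation (suc p) a ≡ valuation (suc p) b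
    valuation-cong refl = refl
e-legendre {suc p} pr n (suc d) 1+d<p = begin
  e (suc p) (suc p ℕ.* n ℕ.+ suc d)              ≡⟨ cong (e (suc p)) (ℕ.+-suc (suc p ℕ.* n) d) ⟩
  e (suc p) (suc N)                              ≡⟨ e-suc (suc p) N ⟩
  valuation (suc p) (suc N) ℕ.+ e (suc p) N      ≡⟨ cong₂ ℕ._+_ (valuation-∤ p∤) (e-legendre pr n d (ℕ.<-trans (ℕ.n<1+n d) 1+d<p)) ⟩
  n ℕ.+ e (suc p) n                              ∎
  where
  open ≡-Reasoning
  N = suc p ℕ.* n ℕ.+ d
  p∤ : suc p ∤ suc N
  p∤ p∣ = >⇒∤ 1+d<p (∣m+n∣m⇒∣n (subst (suc p ∣_) (sym (ℕ.+-suc (suc p ℕ.* n) d)) p∣) (m∣m*n n))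

module _ {p : ℕ} (pr : Prime p) where

  private instance
    p≢0 : NonZero p
    p≢0 = prime⇒nonZero pr

  e-digit : ∀ n → e p n ≡ n / p ℕ.+ e p (n / p)
  e-digit n = trans (cong (e p) n≡) (e-legendre pr (n / p) (n % p) (ℕ.m%n<n n p))
    where
    n≡ : n ≡ p ℕ.* (n / p) ℕ.+ n % p
    n≡ = trans (ℕ.m≡m%n+[m/n]*n n p) (trans (ℕ.+-comm (n % p) _) (cong (ℕ._+ n % p) (ℕ.*-comm (n / p) p)))

  e-p* : ∀ n → e p (p ℕ.* n) ≡ n ℕ.+ e p n
  e-p* n = trans (cong (e p) (sym (ℕ.+-identityʳ (p ℕ.* n)))) (e-legendre pr n 0 (ℕ.>-nonZero⁻¹ p))

  e-small : ∀ {d} → d < p → e p d ≡ 0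
  e-small {d} d<p = trans (cong (λ x → e p (x ℕ.+ d)) (sym (ℕ.*-zeroʳ p))) (e-legendre pr 0 d d<p)

  -- Adding x < p^t causes no carry. Induct on t: the last digit drops out by Legendre's recursion,
  -- and the quotient by p splits again into a multiple of p^t and `x / p`.
  e-additive : ∀ t a {x} → x < p ^ℕ t → e p (p ^ℕ t ℕ.* a ℕ.+ x) ≡ e p (p ^ℕ t ℕ.* a) ℕ.+ e p x
  e-additive zero    a {zero} _ rewrite ℕ.+-identityʳ (a ℕ.+ 0) = sym (ℕ.+-identityʳ _)
  e-additive zero    a {suc x} (s≤s ())
  e-additive (suc t) a {x} x<p^ = begin
    e p (p ^ℕ suc t ℕ.* a ℕ.+ x)                               ≡⟨ cong (e p) (trans (cong (p ^ℕ suc t ℕ.* a ℕ.+_) x≡) (regroup p (p ^ℕ t) a (x / p) (x % p))) ⟩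
    e p (p ℕ.* (p ^ℕ t ℕ.* a ℕ.+ x / p) ℕ.+ x % p)             ≡⟨ e-legendre pr (p ^ℕ t ℕ.* a ℕ.+ x / p) (x % p) (ℕ.m%n<n x p) ⟩
    p ^ℕ t ℕ.* a ℕ.+ x / p ℕ.+ e p (p ^ℕ t ℕ.* a ℕ.+ x / p)    ≡⟨ cong (p ^ℕ t ℕ.* a ℕ.+ x / p ℕ.+_) (e-additive t a (ℕ.m<n*o⇒m/o<n (subst (x <_) (ℕ.*-comm p (p ^ℕ t)) x<p^))) ⟩
    p ^ℕ t ℕ.* a ℕ.+ x / p ℕ.+ (e p (p ^ℕ t ℕ.* a) ℕ.+ e p (x / p))   ≡⟨ interchange (p ^ℕ t ℕ.* a) (x / p) _ _ ⟩
    p ^ℕ t ℕ.* a ℕ.+ e p (p ^ℕ t ℕ.* a) ℕ.+ (x / p ℕ.+ e p (x / p))   ≡⟨ cong₂ ℕ._+_ (e-p* (p ^ℕ t ℕ.* a)) (e-digit x) ⟨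
    e p (p ℕ.* (p ^ℕ t ℕ.* a)) ℕ.+ e p x                       ≡⟨ cong (λ y → e p y ℕ.+ e p x) (ℕ.*-assoc p (p ^ℕ t) a) ⟨
    e p (p ^ℕ suc t ℕ.* a) ℕ.+ e p x                           ∎
    where
    open ≡-Reasoning
    x≡ : x ≡ x % p ℕ.+ x / p ℕ.* p
    x≡ = ℕ.m≡m%n+[m/n]*n x p
    regroup : ∀ p P a y z → p ℕ.* P ℕ.* a ℕ.+ (z ℕ.+ y ℕ.* p) ≡ p ℕ.* (P ℕ.* a ℕ.+ y) ℕ.+ z
    regroup = ℕ-solve-∀
    interchange : ∀ a b c d → a ℕ.+ b ℕ.+ (c ℕ.+ d) ≡ a ℕ.+ c ℕ.+ (b ℕ.+ d)
    interchange = ℕ-solve-∀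

  twisted : ℕ → ℕ → ℕ
  twisted w n = e p n ℕ.+ w ℕ.* n

  -- The new weight collects the linear part of e_p(p²n) = (p + 1)n + e_p(n) and the old weight
  -- times p².
  twisted-additive : ∀ w n {d} → d < p ^ℕ 2 → twisted w (p ^ℕ 2 ℕ.* n ℕ.+ d) ≡ twisted (suc p ℕ.+ w ℕ.* p ^ℕ 2) n ℕ.+ twisted w d
  twisted-additive w n {d} d<q = begin
    e p (p ^ℕ 2 ℕ.* n ℕ.+ d) ℕ.+ w ℕ.* (p ^ℕ 2 ℕ.* n ℕ.+ d)               ≡⟨ cong (ℕ._+ w ℕ.* (p ^ℕ 2 ℕ.* n ℕ.+ d)) (trans (e-additive 2 n d<q) (cong (ℕ._+ e p d) e[qn])) ⟩
    p ℕ.* n ℕ.+ (n ℕ.+ e p n) ℕ.+ e p d ℕ.+ w ℕ.* (p ^ℕ 2 ℕ.* n ℕ.+ d)    ≡⟨ regroup p (p ^ℕ 2) n w d (e p n) (e p d) ⟩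
    e p n ℕ.+ (suc p ℕ.+ w ℕ.* p ^ℕ 2) ℕ.* n ℕ.+ (e p d ℕ.+ w ℕ.* d)      ∎
    where
    open ≡-Reasoning
    assoc : ∀ p n → p ℕ.* (p ℕ.* 1) ℕ.* n ≡ p ℕ.* (p ℕ.* n)
    assoc = ℕ-solve-∀
    e[qn] : e p (p ^ℕ 2 ℕ.* n) ≡ p ℕ.* n ℕ.+ (n ℕ.+ e p n)
    e[qn] = trans (cong (e p) (assoc p n)) (trans (e-p* (p ℕ.* n)) (cong (p ℕ.* n ℕ.+_) (e-p* n)))
    regroup : ∀ p q n w d x y → p ℕ.* n ℕ.+ (n ℕ.+ x) ℕ.+ y ℕ.+ w ℕ.* (q ℕ.* n ℕ.+ d) ≡ x ℕ.+ (suc p ℕ.+ w ℕ.* q) ℕ.* n ℕ.+ (y ℕ.+ w ℕ.* d)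
    regroup = ℕ-solve-∀

-- Periodic functions

Periodic : ℕ → (ℕ → ℚ) → Set
Periodic m f = ∀ i → f (m ℕ.+ i) ≡ f i

shift-periodic : ∀ {m f} → Periodic m f → ∀ s → Periodic m (λ i → f (s ℕ.+ i))
shift-periodic {m} {f} per s i = trans (cong f (exchange s m i)) (per (s ℕ.+ i))
  where
  exchange : ∀ s m i → s ℕ.+ (m ℕ.+ i) ≡ m ℕ.+ (s ℕ.+ i)
  exchange = ℕ-solve-∀

*-periodic : ∀ {m f} → Periodic m f → ∀ a i → f (m ℕ.* a ℕ.+ i) ≡ f i
*-periodic {m} {f} per zero    i = cong (λ x → f (x ℕ.+ i)) (ℕ.*-zeroʳ m)
*-periodic {m} {f} per (suc a) i = begin
  f (m ℕ.* suc a ℕ.+ i)          ≡⟨ cong f (unfold m a i) ⟩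
  f (m ℕ.+ (m ℕ.* a ℕ.+ i))      ≡⟨ per (m ℕ.* a ℕ.+ i) ⟩
  f (m ℕ.* a ℕ.+ i)              ≡⟨ *-periodic {m} {f} per a i ⟩
  f i                            ∎
  where
  open ≡-Reasoning
  unfold : ∀ m a i → m ℕ.* suc a ℕ.+ i ≡ m ℕ.+ (m ℕ.* a ℕ.+ i)
  unfold = ℕ-solve-∀

∑-telescope : ∀ j (f : ℕ → ℚ) x → ∑ j (λ i → f (i ℕ.+ x) - f (suc i ℕ.+ x)) ≡ f x - f (j ℕ.+ x)
∑-telescope zero    f x = sym (ℚ.+-inverseʳ (f x))
∑-telescope (suc j) f x = trans (∑-last j _) (trans (cong (_+ (f (j ℕ.+ x) - f (suc j ℕ.+ x))) (∑-telescope j f x)) (cancel (f x) (f (j ℕ.+ x)) (f (suc j ℕ.+ x))))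
  where
  cancel : ∀ a b c → (a - b) + (b - c) ≡ a - c
  cancel = solve-∀ ℚ-ring

energy : ℕ → (ℕ → ℚ) → ℚ
energy m f = ∑ m (λ c → f c * f c)

energy-nonneg : ∀ m f → 0ℚ ℚ.≤ energy m f
energy-nonneg m f = ∑-nonneg m (λ c → ²-nonneg (f c))

energy-shift : ∀ {m f} → Periodic m f → ∀ s → energy m (λ c → f (s ℕ.+ c)) ≡ energy m f
energy-shift {m} {f} per s = ∑-shift m (λ i → cong₂ _*_ (per i) (per i)) s

gradient : (ℕ → ℚ) → ℕ → ℚ
gradient f c = f c - f (suc c)

gradient-periodic : ∀ {m f} → Periodic m f → Periodic m (gradient f)
gradient-periodic {m} {f} per i = cong₂ _-_ (per i) (trans (cong f (sym (ℕ.+-suc m i))) (per (suc i)))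

-- Telescope over j unit steps and apply Cauchy-Schwarz to the j summands; every translate of the
-- gradient has the same energy.
energy-difference : ∀ {m f} → Periodic m f → ∀ j → energy m (λ x → f x - f (j ℕ.+ x)) ℚ.≤ fromℕ j * (fromℕ j * energy m (gradient f))
energy-difference {m} {f} per j = begin
  ∑ m (λ x → (f x - f (j ℕ.+ x)) * (f x - f (j ℕ.+ x)))                    ≡⟨ ∑-cong m (λ x → cong₂ _*_ (∑-telescope j f x) (∑-telescope j f x)) ⟨
  ∑ m (λ x → ∑ j (λ i → g (i ℕ.+ x)) * ∑ j (λ i → g (i ℕ.+ x)))            ≤⟨ ∑-mono m (λ x → ∑-cauchy j (λ i → g (i ℕ.+ x))) ⟩
  ∑ m (λ x → fromℕ j * ∑ j (λ i → g (i ℕ.+ x) * g (i ℕ.+ x)))              ≡⟨ ∑-* m (fromℕ j) _ ⟩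
  fromℕ j * ∑ m (λ x → ∑ j (λ i → g (i ℕ.+ x) * g (i ℕ.+ x)))              ≡⟨ cong (fromℕ j *_) (∑-swap m j (λ x i → g (i ℕ.+ x) * g (i ℕ.+ x))) ⟩
  fromℕ j * ∑ j (λ i → energy m (λ x → g (i ℕ.+ x)))                       ≡⟨ cong (fromℕ j *_) (∑-cong j (λ i → energy-shift {m} {g} (gradient-periodic {m} {f} per) i)) ⟩
  fromℕ j * ∑ j (λ _ → energy m g)                                         ≡⟨ cong (fromℕ j *_) (∑-const j (energy m g)) ⟩
  fromℕ j * (fromℕ j * energy m g)                                         ∎
  where
  open ℚ.≤-Reasoning
  g = gradient f

-- Sum (f x - f (j + x))² over all j and x below m. As f has mean zero, the cross terms vanish and
-- the total is 2m times the energy E, while each j contributes at most m² times the gradient energy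
-- G. The claim is 2mE ≤ m³G divided by 2m³.
poincaré : ∀ {m f} → 1 ≤ m → Periodic m f → ∑ m f ≡ 0ℚ → (1 ÷ m) * (1 ÷ m) * energy m f ℚ.≤ ℚ.½ * energy m (gradient f)
poincaré {m} {f} 1≤m per ∑f≡0 = *-cancelˡ (M * M * M + M * M * M) 0<2M³ (begin
  (M * M * M + M * M * M) * (ν * ν * E)            ≡⟨ regroup₁ M ν E ⟩
  (M * ν) * (M * ν) * (M * E + M * E)              ≡⟨ cong (λ x → x * x * (M * E + M * E)) (fromℕ*1÷ 1≤m) ⟩
  1ℚ * 1ℚ * (M * E + M * E)                        ≡⟨ ℚ.*-identityˡ (M * E + M * E) ⟩
  M * E + M * E                                    ≡⟨ pairs ⟨
  ∑ m (λ j → energy m (λ x → f x - f (j ℕ.+ x)))   ≤⟨ ∑-mono< m (λ j j<m → ℚ.≤-trans (energy-difference {m} {f} per j) (bound (fromℕ-mono (ℕ.<⇒≤ j<m)) (fromℕ-nonneg j))) ⟩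
  ∑ m (λ _ → M * (M * G))                          ≡⟨ ∑-const m (M * (M * G)) ⟩
  M * (M * (M * G))                                ≡⟨ regroup₂ M G ⟩
  (M * M * M + M * M * M) * (ℚ.½ * G)              ∎)
  where
  open ℚ.≤-Reasoning
  M = fromℕ m
  ν = 1 ÷ m
  E = energy m f
  G = energy m (gradient f)
  0<M : 0ℚ ℚ.< M
  0<M = fromℕ-pos 1≤m
  0<M³ : 0ℚ ℚ.< M * M * M
  0<M³ = ℚ.positive⁻¹ (M * M * M) {{ℚ.pos*pos⇒pos (M * M) {{ℚ.pos*pos⇒pos M {{ℚ.positive 0<M}} M {{ℚ.positive 0<M}}}} M {{ℚ.positive 0<M}}}}
  0<2M³ : 0ℚ ℚ.< M * M * M + M * M * M
  0<2M³ = ℚ.+-mono-< 0<M³ 0<M³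
  bound : ∀ {a} → a ℚ.≤ M → 0ℚ ℚ.≤ a → a * (a * G) ℚ.≤ M * (M * G)
  bound a≤M 0≤a = *-mono (fromℕ-nonneg m) (*-nonneg 0≤a (energy-nonneg m (gradient f))) a≤M (*-monoʳ G (energy-nonneg m (gradient f)) a≤M)
  regroup₁ : ∀ M ν E → (M * M * M + M * M * M) * (ν * ν * E) ≡ (M * ν) * (M * ν) * (M * E + M * E)
  regroup₁ = solve-∀ ℚ-ring
  regroup₂ : ∀ M G → M * (M * (M * G)) ≡ (M * M * M + M * M * M) * (ℚ.½ * G)
  regroup₂ = solve-∀ ℚ-ring
  drop : ∀ a x b → a - (x + x) * 0ℚ + b ≡ a + b
  drop = solve-∀ ℚ-ring
  fixed : ∀ x → ∑ m (λ j → (f x - f (j ℕ.+ x)) * (f x - f (j ℕ.+ x))) ≡ E + M * (f x * f x)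
  fixed x = begin-equality
    ∑ m (λ j → (f x - f (j ℕ.+ x)) * (f x - f (j ℕ.+ x)))      ≡⟨ ∑-cong m (λ j → trans (flip (f x) (f (j ℕ.+ x))) (cong (λ y → (f y - f x) * (f y - f x)) (ℕ.+-comm j x))) ⟩
    ∑ m (λ j → (f (x ℕ.+ j) - f x) * (f (x ℕ.+ j) - f x))      ≡⟨ ∑-square-deviation m (λ j → f (x ℕ.+ j)) (f x) ⟩
    energy m (λ j → f (x ℕ.+ j)) - (f x + f x) * ∑ m (λ j → f (x ℕ.+ j)) + M * (f x * f x)   ≡⟨ cong₂ (λ u v → u - (f x + f x) * v + M * (f x * f x)) (energy-shift {m} {f} per x) (trans (∑-shift m {f} per x) ∑f≡0) ⟩
    E - (f x + f x) * 0ℚ + M * (f x * f x)                      ≡⟨ drop E (f x) _ ⟩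
    E + M * (f x * f x)                                         ∎
    where
    flip : ∀ a b → (a - b) * (a - b) ≡ (b - a) * (b - a)
    flip = solve-∀ ℚ-ring
  pairs : ∑ m (λ j → energy m (λ x → f x - f (j ℕ.+ x))) ≡ M * E + M * E
  pairs = begin-equality
    ∑ m (λ j → energy m (λ x → f x - f (j ℕ.+ x)))     ≡⟨ ∑-swap m m (λ j x → (f x - f (j ℕ.+ x)) * (f x - f (j ℕ.+ x))) ⟩
    ∑ m (λ x → ∑ m (λ j → (f x - f (j ℕ.+ x)) * (f x - f (j ℕ.+ x))))   ≡⟨ ∑-cong m fixed ⟩
    ∑ m (λ x → E + M * (f x * f x))                    ≡⟨ ∑-+ m (λ _ → E) (λ x → M * (f x * f x)) ⟩
    ∑ m (λ _ → E) + ∑ m (λ x → M * (f x * f x))        ≡⟨ cong₂ _+_ (∑-const m E) (∑-* m M (λ x → f x * f x)) ⟩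
    M * E + M * E                                      ∎

divisible : ℕ → ℕ → ℚ
divisible m x = ⟦ m ∣? x ⟧

divisible-periodic : ∀ m → Periodic m (divisible m)
divisible-periodic m i = ⟦⟧-cong (m ∣? (m ℕ.+ i)) (m ∣? i) (λ m∣m+i → ∣m+n∣m⇒∣n m∣m+i ∣-refl) (λ m∣i → ∣m∣n⇒∣m+n ∣-refl m∣i)

∑-divisible : ∀ {m} → 1 ≤ m → ∑ m (divisible m) ≡ 1ℚ
∑-divisible {suc m} _ = cong₂ _+_ (⟦⟧-yes (suc m ∣? 0) (divides 0 refl)) (trans (∑-cong< m (λ i i<m → ⟦⟧-no (suc m ∣? suc i) (>⇒∤ (s≤s i<m)))) (trans (∑-const m 0ℚ) (ℚ.*-zeroʳ (fromℕ m))))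

centred : ℕ → ℕ → ℚ
centred m x = divisible m x - (1 ÷ m)

centred-periodic : ∀ m → Periodic m (centred m)
centred-periodic m i = cong (_- (1 ÷ m)) (divisible-periodic m i)

∑-centred : ∀ {m} → 1 ≤ m → ∑ m (centred m) ≡ 0ℚ
∑-centred {m} 1≤m = begin
  ∑ m (λ c → divisible m c - (1 ÷ m))                     ≡⟨ ∑-+ m (divisible m) (λ _ → - (1 ÷ m)) ⟩
  ∑ m (divisible m) + ∑ m (λ _ → - (1 ÷ m))               ≡⟨ cong₂ _+_ (∑-divisible 1≤m) (trans (∑-const m (- (1 ÷ m))) (trans (sym (ℚ.neg-distribʳ-* (fromℕ m) (1 ÷ m))) (cong -_ (fromℕ*1÷ 1≤m)))) ⟩
  0ℚ                                                      ∎
  where open ≡-Reasoning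

-- An indicator equals its own square, so the exact value is 1 - 1/m.
energy-centred : ∀ {m} → 1 ≤ m → energy m (centred m) ℚ.≤ 1ℚ
energy-centred {m} 1≤m = begin
  energy m (centred m)                                            ≡⟨ ∑-square-deviation m (divisible m) ν ⟩
  energy m (divisible m) - (ν + ν) * ∑ m (divisible m) + fromℕ m * (ν * ν)   ≡⟨ cong₂ (λ x y → x - (ν + ν) * y + fromℕ m * (ν * ν)) (trans (∑-cong m (λ c → idem (m ∣? c))) (∑-divisible 1≤m)) (∑-divisible 1≤m) ⟩
  1ℚ - (ν + ν) * 1ℚ + fromℕ m * (ν * ν)                           ≡⟨ regroup (fromℕ m) ν ⟩
  1ℚ - ν + ν * (fromℕ m * ν - 1ℚ)                                 ≡⟨ cong (λ x → 1ℚ - ν + ν * (x - 1ℚ)) (fromℕ*1÷ 1≤m) ⟩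
  1ℚ - ν + ν * 0ℚ                                                 ≤⟨ ≤-by ν (1÷-nonneg m) (simplify ν) ⟩
  1ℚ                                                              ∎
  where
  open ℚ.≤-Reasoning
  ν = 1 ÷ m
  idem : ∀ {A : Set} (d : Dec A) → ⟦ d ⟧ * ⟦ d ⟧ ≡ ⟦ d ⟧
  idem (yes _) = refl
  idem (no _)  = refl
  regroup : ∀ M ν → 1ℚ - (ν + ν) * 1ℚ + M * (ν * ν) ≡ 1ℚ - ν + ν * (M * ν - 1ℚ)
  regroup = solve-∀ ℚ-ring
  simplify : ∀ ν → 1ℚ ≡ (1ℚ - ν + ν * 0ℚ) + ν
  simplify = solve-∀ ℚ-ring

-- Correlations of the p-adic valuation of factorials

module Correlation {p : ℕ} (pr : Prime p) {m : ℕ} (1≤m : 1 ≤ m) where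

  q : ℕ
  q = p ^ℕ 2

  private
    instance
      p≢0 : NonZero p
      p≢0 = prime⇒nonZero pr

      q≢0 : NonZero q
      q≢0 = ℕ.m^n≢0 p 2

    1<p : 1 < p
    1<p = ℕ.nonTrivial⇒n>1 p {{prime⇒nonTrivial pr}}

    p<q : p < q
    p<q = subst₂ _<_ (ℕ.*-identityʳ p) (cong (p ℕ.*_) (sym (ℕ.*-identityʳ p))) (ℕ.*-monoʳ-< p 1<p)

  1≤q : 1 ≤ q
  1≤q = ℕ.>-nonZero⁻¹ q

  1≤q^ : ∀ t → 1 ≤ q ^ℕ t
  1≤q^ t = ℕ.>-nonZero⁻¹ (q ^ℕ t) {{ℕ.m^n≢0 q t}}

  F : ℕ → ℕ → ℕ
  F = twisted pr

  -- m ∸ 1 stands for −1 modulo m.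
  shift : ℕ → ℕ → ℕ → ℕ
  shift w h n = F w (n ℕ.+ h) ℕ.+ (m ℕ.∸ 1) ℕ.* F w n

  -- As a function of c: the probability, for n uniform below q^t, that `shift w h n` is -c modulo
  -- m, minus 1/m. This is the reflected deviation of the law from the uniform one.
  ψ : (w t h c : ℕ) → ℚ
  ψ w t h c = mean (q ^ℕ t) (λ n → centred m (shift w h n ℕ.+ c))

  next : ℕ → ℕ
  next w = suc p ℕ.+ w ℕ.* q

  -- What the last digit d of n contributes to the difference when the shift has last digit y; the
  -- carry out of y + d is passed on to the quotient of the shift.
  digit-shift : (w y d : ℕ) → ℕ
  digit-shift w y d = F w ((y ℕ.+ d) % q) ℕ.+ (m ℕ.∸ 1) ℕ.* F w d

  ψ-periodic : ∀ w t h → Periodic m (ψ w t h)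
  ψ-periodic w t h c = cong ((1 ÷ (q ^ℕ t)) *_) (∑-cong (q ^ℕ t) (λ n → shift-periodic {m} {centred m} (centred-periodic m) (shift w h n) c))

  ∑-ψ : ∀ w t h → ∑ m (ψ w t h) ≡ 0ℚ
  ∑-ψ w t h = begin
    ∑ m (λ c → ν * ∑ Q (λ n → centred m (shift w h n ℕ.+ c)))      ≡⟨ ∑-* m ν _ ⟩
    ν * ∑ m (λ c → ∑ Q (λ n → centred m (shift w h n ℕ.+ c)))      ≡⟨ cong (ν *_) (∑-swap m Q (λ c n → centred m (shift w h n ℕ.+ c))) ⟩
    ν * ∑ Q (λ n → ∑ m (λ c → centred m (shift w h n ℕ.+ c)))      ≡⟨ cong (ν *_) (∑-cong Q (λ n → trans (∑-shift m {centred m} (centred-periodic m) (shift w h n)) (∑-centred 1≤m))) ⟩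
    ν * ∑ Q (λ _ → 0ℚ)                                             ≡⟨ cong (ν *_) (trans (∑-const Q 0ℚ) (ℚ.*-zeroʳ (fromℕ Q))) ⟩
    ν * 0ℚ                                                         ≡⟨ ℚ.*-zeroʳ ν ⟩
    0ℚ                                                             ∎
    where
    open ≡-Reasoning
    Q = q ^ℕ t
    ν = 1 ÷ Q

  shift-digit : ∀ w h y n {d} → d < q →
                shift w (q ℕ.* h ℕ.+ y) (q ℕ.* n ℕ.+ d) ≡ shift (next w) (h ℕ.+ (y ℕ.+ d) / q) n ℕ.+ digit-shift w y d
  shift-digit w h y n {d} d<q = begin
    F w (q ℕ.* n ℕ.+ d ℕ.+ (q ℕ.* h ℕ.+ y)) ℕ.+ (m ℕ.∸ 1) ℕ.* F w (q ℕ.* n ℕ.+ d)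
      ≡⟨ cong₂ (λ u v → u ℕ.+ (m ℕ.∸ 1) ℕ.* v) (trans (cong (F w) n+h≡) (twisted-additive pr w _ (ℕ.m%n<n (y ℕ.+ d) q))) (twisted-additive pr w n d<q) ⟩
    F w′ (n ℕ.+ (h ℕ.+ (y ℕ.+ d) / q)) ℕ.+ F w ((y ℕ.+ d) % q) ℕ.+ (m ℕ.∸ 1) ℕ.* (F w′ n ℕ.+ F w d)
      ≡⟨ regroup (F w′ (n ℕ.+ (h ℕ.+ (y ℕ.+ d) / q))) (F w ((y ℕ.+ d) % q)) (m ℕ.∸ 1) (F w′ n) (F w d) ⟩
    F w′ (n ℕ.+ (h ℕ.+ (y ℕ.+ d) / q)) ℕ.+ (m ℕ.∸ 1) ℕ.* F w′ n ℕ.+ (F w ((y ℕ.+ d) % q) ℕ.+ (m ℕ.∸ 1) ℕ.* F w d)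
      ∎
    where
    open ≡-Reasoning
    w′ = next w
    regroup : ∀ a b μ c d → a ℕ.+ b ℕ.+ μ ℕ.* (c ℕ.+ d) ≡ a ℕ.+ μ ℕ.* c ℕ.+ (b ℕ.+ μ ℕ.* d)
    regroup = ℕ-solve-∀
    collect : ∀ q n d h y → q ℕ.* n ℕ.+ d ℕ.+ (q ℕ.* h ℕ.+ y) ≡ q ℕ.* (n ℕ.+ h) ℕ.+ (y ℕ.+ d)
    collect = ℕ-solve-∀
    spread : ∀ q n h u v → q ℕ.* (n ℕ.+ h) ℕ.+ (v ℕ.+ u ℕ.* q) ≡ q ℕ.* (n ℕ.+ (h ℕ.+ u)) ℕ.+ v
    spread = ℕ-solve-∀
    n+h≡ : q ℕ.* n ℕ.+ d ℕ.+ (q ℕ.* h ℕ.+ y) ≡ q ℕ.* (n ℕ.+ (h ℕ.+ (y ℕ.+ d) / q)) ℕ.+ (y ℕ.+ d) % q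
    n+h≡ = trans (collect q n d h y) (trans (cong (q ℕ.* (n ℕ.+ h) ℕ.+_) (ℕ.m≡m%n+[m/n]*n (y ℕ.+ d) q)) (spread q n h _ _))

  -- Split n into quotient and last digit d. For fixed d the law is that of the quotient, translated
  -- by `digit-shift`, with the carry added to the shift.
  ψ-digit : ∀ w t h y c → ψ w (suc t) (q ℕ.* h ℕ.+ y) c ≡ mean q (λ d → ψ (next w) t (h ℕ.+ (y ℕ.+ d) / q) (digit-shift w y d ℕ.+ c))
  ψ-digit w t h y c = begin
    (1 ÷ (q ℕ.* Q)) * ∑ (q ℕ.* Q) f                            ≡⟨ cong₂ _*_ (1÷-* q Q 1≤q (1≤q^ t)) (cong (λ x → ∑ x f) (ℕ.*-comm q Q)) ⟩
    (1 ÷ q) * (1 ÷ Q) * ∑ (Q ℕ.* q) f                          ≡⟨ cong ((1 ÷ q) * (1 ÷ Q) *_) (trans (∑-blocks Q q f) (∑-swap Q q _)) ⟩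
    (1 ÷ q) * (1 ÷ Q) * ∑ q (λ d → ∑ Q (λ n → f (q ℕ.* n ℕ.+ d)))   ≡⟨ ℚ.*-assoc (1 ÷ q) (1 ÷ Q) _ ⟩
    (1 ÷ q) * ((1 ÷ Q) * ∑ q (λ d → ∑ Q (λ n → f (q ℕ.* n ℕ.+ d)))) ≡⟨ cong ((1 ÷ q) *_) (∑-* q (1 ÷ Q) _) ⟨
    (1 ÷ q) * ∑ q (λ d → (1 ÷ Q) * ∑ Q (λ n → f (q ℕ.* n ℕ.+ d)))   ≡⟨ cong ((1 ÷ q) *_) (∑-cong< q (λ d d<q → cong ((1 ÷ Q) *_) (∑-cong Q (λ n → cong (centred m) (trans (cong (ℕ._+ c) (shift-digit w h y n d<q)) (ℕ.+-assoc (shift (next w) (h ℕ.+ (y ℕ.+ d) / q) n) _ c)))))) ⟩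
    (1 ÷ q) * ∑ q (λ d → ψ (next w) t (h ℕ.+ (y ℕ.+ d) / q) (digit-shift w y d ℕ.+ c))  ∎
    where
    open ≡-Reasoning
    Q = q ^ℕ t
    f = λ n → centred m (shift w (q ℕ.* h ℕ.+ y) n ℕ.+ c)

  En : (w t h : ℕ) → ℚ
  En w t h = energy m (ψ w t h)

  En-nonneg : ∀ w t h → 0ℚ ℚ.≤ En w t h
  En-nonneg w t h = energy-nonneg m (ψ w t h)

  private
    module Step (w t h y : ℕ) where
      x : ℕ → ℕ → ℚ
      x c d = ψ (next w) t (h ℕ.+ (y ℕ.+ d) / q) (digit-shift w y d ℕ.+ c)

      deviation : ℕ → ℕ → ℚ
      deviation c d = (x c d - mean q (x c)) * (x c d - mean q (x c))

      deviation-nonneg : ∀ c d → 0ℚ ℚ.≤ deviation c d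
      deviation-nonneg c d = ²-nonneg (x c d - mean q (x c))

  open Step using (deviation; deviation-nonneg)

  -- The variance identity for each residue c, summed over c. On the right the translations
  -- disappear, because the energy runs over a full period; the extra term on the left is the spread
  -- of the translates around their mean.
  En-variance : ∀ w t h y → En w (suc t) (q ℕ.* h ℕ.+ y) + (1 ÷ q) * ∑ m (λ c → ∑ q (deviation w t h y c))
                            ≡ mean q (λ d → En (next w) t (h ℕ.+ (y ℕ.+ d) / q))
  En-variance w t h y = begin
    En w (suc t) (q ℕ.* h ℕ.+ y) + (1 ÷ q) * ∑ m (λ c → ∑ q (deviation w t h y c))
      ≡⟨ cong₂ _+_ (∑-cong m (λ c → cong₂ _*_ (ψ-digit w t h y c) (ψ-digit w t h y c))) (sym (∑-* m (1 ÷ q) _)) ⟩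
    ∑ m (λ c → mean q (x c) * mean q (x c)) + ∑ m (λ c → mean q (deviation w t h y c))
      ≡⟨ ∑-+ m _ _ ⟨
    ∑ m (λ c → mean q (x c) * mean q (x c) + mean q (deviation w t h y c))
      ≡⟨ ∑-cong m (λ c → mean-variance 1≤q (x c)) ⟩
    ∑ m (λ c → (1 ÷ q) * ∑ q (λ d → x c d * x c d))
      ≡⟨ ∑-* m (1 ÷ q) _ ⟩
    (1 ÷ q) * ∑ m (λ c → ∑ q (λ d → x c d * x c d))
      ≡⟨ cong ((1 ÷ q) *_) (∑-swap m q (λ c d → x c d * x c d)) ⟩
    (1 ÷ q) * ∑ q (λ d → ∑ m (λ c → x c d * x c d))
      ≡⟨ cong ((1 ÷ q) *_) (∑-cong q (λ d → energy-shift {m} {ψ (next w) t (h ℕ.+ (y ℕ.+ d) / q)} (ψ-periodic (next w) t (h ℕ.+ (y ℕ.+ d) / q)) (digit-shift w y d))) ⟩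
    mean q (λ d → En (next w) t (h ℕ.+ (y ℕ.+ d) / q)) ∎
    where
    open ≡-Reasoning
    open Step w t h y using (x)

  En-average : ∀ w t h y → En w (suc t) (q ℕ.* h ℕ.+ y) ℚ.≤ mean q (λ d → En (next w) t (h ℕ.+ (y ℕ.+ d) / q))
  En-average w t h y = ≤-by _ (*-nonneg (1÷-nonneg q) (∑-nonneg m (λ c → ∑-nonneg q (deviation-nonneg w t h y c)))) (sym (En-variance w t h y))

  digit-shift-0 : ∀ w → digit-shift w 1 0 ≡ w
  digit-shift-0 w = trans (cong₂ (λ u v → F w u ℕ.+ (m ℕ.∸ 1) ℕ.* (v ℕ.+ w ℕ.* 0)) (ℕ.m<n⇒m%n≡m (ℕ.<-trans 1<p p<q)) (e-small pr {0} (ℕ.<-trans z<s 1<p)))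
    (trans (cong (λ u → u ℕ.+ w ℕ.* 1 ℕ.+ (m ℕ.∸ 1) ℕ.* (w ℕ.* 0)) (e-small pr {1} 1<p)) (simplify w (m ℕ.∸ 1)))
    where
    simplify : ∀ w μ → w ℕ.* 1 ℕ.+ μ ℕ.* (w ℕ.* 0) ≡ w
    simplify = ℕ-solve-∀

  -- `e p` jumps from 0 at p - 1 to 1 at p, whence w + 1 instead of w. The rest is w·p + (m -
  -- 1)·w·(p - 1), which is w plus a multiple of m.
  digit-shift-p∸1 : ∀ w → digit-shift w 1 (p ℕ.∸ 1) ≡ m ℕ.* (w ℕ.* (p ℕ.∸ 1)) ℕ.+ suc w
  digit-shift-p∸1 w = begin
    F w ((1 ℕ.+ (p ℕ.∸ 1)) % q) ℕ.+ (m ℕ.∸ 1) ℕ.* F w (p ℕ.∸ 1)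
      ≡⟨ cong₂ (λ u v → F w u ℕ.+ (m ℕ.∸ 1) ℕ.* (v ℕ.+ w ℕ.* (p ℕ.∸ 1))) (trans (cong (_% q) 1+p′≡p) (ℕ.m<n⇒m%n≡m p<q)) (e-small pr p′<p) ⟩
    e p p ℕ.+ w ℕ.* p ℕ.+ (m ℕ.∸ 1) ℕ.* (w ℕ.* (p ℕ.∸ 1))
      ≡⟨ cong₂ (λ u v → u ℕ.+ w ℕ.* v ℕ.+ (m ℕ.∸ 1) ℕ.* (w ℕ.* (p ℕ.∸ 1))) e[p]≡1 (sym 1+p′≡p) ⟩
    1 ℕ.+ w ℕ.* suc (p ℕ.∸ 1) ℕ.+ (m ℕ.∸ 1) ℕ.* (w ℕ.* (p ℕ.∸ 1))
      ≡⟨ regroup w (p ℕ.∸ 1) (m ℕ.∸ 1) ⟩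
    suc (m ℕ.∸ 1) ℕ.* (w ℕ.* (p ℕ.∸ 1)) ℕ.+ suc w
      ≡⟨ cong (λ u → u ℕ.* (w ℕ.* (p ℕ.∸ 1)) ℕ.+ suc w) (ℕ.m+[n∸m]≡n 1≤m) ⟩
    m ℕ.* (w ℕ.* (p ℕ.∸ 1)) ℕ.+ suc w ∎
    where
    open ≡-Reasoning
    1+p′≡p : suc (p ℕ.∸ 1) ≡ p
    1+p′≡p = ℕ.m+[n∸m]≡n (ℕ.<⇒≤ 1<p)
    p′<p : p ℕ.∸ 1 < p
    p′<p = ℕ.≤-reflexive 1+p′≡p
    e[p]≡1 : e p p ≡ 1
    e[p]≡1 = trans (cong (e p) (sym (ℕ.*-identityʳ p))) (trans (e-p* pr 1) (cong suc (e-small pr 1<p)))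
    regroup : ∀ w p′ m′ → 1 ℕ.+ w ℕ.* suc p′ ℕ.+ m′ ℕ.* (w ℕ.* p′) ≡ suc m′ ℕ.* (w ℕ.* p′) ℕ.+ suc w
    regroup = ℕ-solve-∀

  -- For the shift 1 the digits 0 and p − 1 cause no carry out of the two lowest base-p places, but their
  -- contributions differ by exactly 1, which makes the average strictly smaller.
  En-gain : ∀ w t h → En w (suc t) (q ℕ.* h ℕ.+ 1) + (1 ÷ q) * ((1 ÷ m) * (1 ÷ m) * En (next w) t h)
                      ℚ.≤ mean q (λ d → En (next w) t (h ℕ.+ (1 ℕ.+ d) / q))
  En-gain w t h = begin
    En w (suc t) (q ℕ.* h ℕ.+ 1) + (1 ÷ q) * ((1 ÷ m) * (1 ÷ m) * En (next w) t h)
      ≤⟨ ℚ.+-monoʳ-≤ (En w (suc t) (q ℕ.* h ℕ.+ 1)) (*-monoˡ (1 ÷ q) (1÷-nonneg q) gain) ⟩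
    En w (suc t) (q ℕ.* h ℕ.+ 1) + (1 ÷ q) * ∑ m (λ c → ∑ q (deviation w t h 1 c))
      ≡⟨ En-variance w t h 1 ⟩
    mean q (λ d → En (next w) t (h ℕ.+ (1 ℕ.+ d) / q)) ∎
    where
    open ℚ.≤-Reasoning
    open Step w t h 1 using (x)
    φ = ψ (next w) t h
    φ-per : Periodic m φ
    φ-per = ψ-periodic (next w) t h
    1+p′≡p : suc (p ℕ.∸ 1) ≡ p
    1+p′≡p = ℕ.m+[n∸m]≡n (ℕ.<⇒≤ 1<p)
    no-carry : ∀ {d} → 1 ℕ.+ d < q → h ℕ.+ (1 ℕ.+ d) / q ≡ h
    no-carry 1+d<q = trans (cong (h ℕ.+_) (ℕ.m<n⇒m/n≡0 1+d<q)) (ℕ.+-identityʳ h)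
    x₀ : ∀ c → x c 0 ≡ φ (w ℕ.+ c)
    x₀ c = cong₂ (λ u v → ψ (next w) t u (v ℕ.+ c)) (no-carry (ℕ.<-trans 1<p p<q)) (digit-shift-0 w)
    x₁ : ∀ c → x c (p ℕ.∸ 1) ≡ φ (suc (w ℕ.+ c))
    x₁ c = trans (cong₂ (λ u v → ψ (next w) t u (v ℕ.+ c)) (no-carry (subst (_< q) (sym 1+p′≡p) p<q)) (digit-shift-p∸1 w))
      (trans (cong φ (ℕ.+-assoc (m ℕ.* (w ℕ.* (p ℕ.∸ 1))) (suc w) c)) (*-periodic {m} {φ} φ-per (w ℕ.* (p ℕ.∸ 1)) (suc (w ℕ.+ c))))
    -- Whatever μ is, the squared deviations of a and b from it total at least (a - b)²/2, so two
    -- digits suffice to bound the spread from below by the gradient.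
    midpoint : ∀ a b μ → (a - μ) * (a - μ) + (b - μ) * (b - μ) ≡ ℚ.½ * ((a - b) * (a - b)) + ℚ.½ * ((a + b - (μ + μ)) * (a + b - (μ + μ)))
    midpoint = solve-∀ ℚ-ring
    pointwise : ∀ c → ℚ.½ * (gradient φ (w ℕ.+ c) * gradient φ (w ℕ.+ c)) ℚ.≤ ∑ q (deviation w t h 1 c)
    pointwise c = begin
      ℚ.½ * (gradient φ (w ℕ.+ c) * gradient φ (w ℕ.+ c))       ≡⟨ cong₂ (λ u v → ℚ.½ * ((u - v) * (u - v))) (x₀ c) (x₁ c) ⟨
      ℚ.½ * ((x c 0 - x c (p ℕ.∸ 1)) * (x c 0 - x c (p ℕ.∸ 1))) ≤⟨ ≤-by _ (*-nonneg 0≤½ (²-nonneg (x c 0 + x c (p ℕ.∸ 1) - (mean q (x c) + mean q (x c))))) (midpoint (x c 0) (x c (p ℕ.∸ 1)) (mean q (x c))) ⟩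
      deviation w t h 1 c 0 + deviation w t h 1 c (p ℕ.∸ 1)     ≤⟨ ∑-two-terms {q} {0} {p ℕ.∸ 1} (deviation-nonneg w t h 1 c) (ℕ.m<n⇒0<n∸m 1<p) (ℕ.<-trans (ℕ.≤-reflexive 1+p′≡p) p<q) ⟩
      ∑ q (deviation w t h 1 c)                                 ∎
    gain : (1 ÷ m) * (1 ÷ m) * En (next w) t h ℚ.≤ ∑ m (λ c → ∑ q (deviation w t h 1 c))
    gain = begin
      (1 ÷ m) * (1 ÷ m) * energy m φ                                              ≤⟨ poincaré {m} {φ} 1≤m φ-per (∑-ψ (next w) t h) ⟩
      ℚ.½ * energy m (gradient φ)                                                 ≡⟨ cong (ℚ.½ *_) (energy-shift {m} {gradient φ} (gradient-periodic {m} {φ} φ-per) w) ⟨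
      ℚ.½ * energy m (λ c → gradient φ (w ℕ.+ c))                                 ≡⟨ ∑-* m ℚ.½ _ ⟨
      ∑ m (λ c → ℚ.½ * (gradient φ (w ℕ.+ c) * gradient φ (w ℕ.+ c)))             ≤⟨ ∑-mono m pointwise ⟩
      ∑ m (λ c → ∑ q (deviation w t h 1 c))                                       ∎

  -- For t = 0 the law is a point mass, and averaging over digits never increases the energy.
  En-≤1 : ∀ w t h → En w t h ℚ.≤ 1ℚ
  En-≤1 w zero h = begin
    energy m (ψ w 0 h)                                  ≡⟨ ∑-cong m (λ c → cong₂ _*_ (single c) (single c)) ⟩
    energy m (λ c → centred m (shift w h 0 ℕ.+ c))      ≡⟨ energy-shift {m} {centred m} (centred-periodic m) (shift w h 0) ⟩
    energy m (centred m)                                ≤⟨ energy-centred 1≤m ⟩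
    1ℚ                                                  ∎
    where
    open ℚ.≤-Reasoning
    single : ∀ c → ψ w 0 h c ≡ centred m (shift w h 0 ℕ.+ c)
    single c = trans (ℚ.*-identityˡ _) (ℚ.+-identityʳ _)
  En-≤1 w (suc t) h = begin
    En w (suc t) h                                              ≡⟨ cong (En w (suc t)) (cong (ℕ._+ h) (ℕ.*-zeroʳ q)) ⟨
    En w (suc t) (q ℕ.* 0 ℕ.+ h)                                ≤⟨ En-average w t 0 h ⟩
    (1 ÷ q) * ∑ q (λ d → En (next w) t ((h ℕ.+ d) / q))         ≤⟨ *-monoˡ (1 ÷ q) (1÷-nonneg q) (∑-mono q (λ d → En-≤1 (next w) t ((h ℕ.+ d) / q))) ⟩
    (1 ÷ q) * ∑ q (λ _ → 1ℚ)                                    ≡⟨ cong ((1 ÷ q) *_) (trans (∑-const q 1ℚ) (ℚ.*-identityʳ (fromℕ q))) ⟩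
    (1 ÷ q) * fromℕ q                                           ≡⟨ trans (ℚ.*-comm (1 ÷ q) (fromℕ q)) (fromℕ*1÷ 1≤q) ⟩
    1ℚ                                                          ∎
    where open ℚ.≤-Reasoning

-- Decay of the energy summed over blocks of shifts

∑-complement : ∀ n z f → ∑ n (λ i → z - f i) ≡ fromℕ n * z - ∑ n f
∑-complement n z f = begin
  ∑ n (λ i → z - f i)                    ≡⟨ ∑-+ n (λ _ → z) (λ i → - f i) ⟩
  ∑ n (λ _ → z) + ∑ n (λ i → - f i)      ≡⟨ cong₂ _+_ (∑-const n z) (trans (∑-cong n (λ i → neg (f i))) (∑-* n (- 1ℚ) f)) ⟩
  fromℕ n * z + - 1ℚ * ∑ n f             ≡⟨ cong (fromℕ n * z +_) (neg (∑ n f)) ⟨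
  fromℕ n * z - ∑ n f                    ∎
  where
  open ≡-Reasoning
  neg : ∀ x → - x ≡ - 1ℚ * x
  neg = solve-∀ ℚ-ring

module BlockDecay {p : ℕ} (pr : Prime p) {m : ℕ} (1≤m : 1 ≤ m)
                  {ρ : ℚ} (0≤ρ : 0ℚ ℚ.≤ ρ)
                  (1-ρ≤ : 1ℚ - (1 ÷ (p ^ℕ 2)) * (1 ÷ (p ^ℕ 2)) * ((1 ÷ m) * (1 ÷ m)) ℚ.≤ ρ) where

  open Correlation pr 1≤m

  private
    instance
      q≢0 : NonZero q
      q≢0 = ℕ.>-nonZero 1≤q

    1<q : 1 < q
    1<q = ℕ.<-≤-trans (ℕ.nonTrivial⇒n>1 p {{prime⇒nonTrivial pr}}) (ℕ.m≤m*n p (p ^ℕ 1) {{ℕ.m^n≢0 p 1 {{prime⇒nonZero pr}}}})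

  -- Blocks are summed, not averaged: the contraction per digit times the number q of last digits.
  κ : ℚ
  κ = fromℕ q * ρ

  0≤κ : 0ℚ ℚ.≤ κ
  0≤κ = *-nonneg (fromℕ-nonneg q) 0≤ρ

  -- Induct on r, splitting off the last digit of the shift. A carry moves the block of quotients by
  -- 1, so the offset s ≤ 1 has to be part of the claim. Every last digit is bounded by the
  -- induction hypothesis Z; the digit 1, which occurs for both offsets, by Z - μZ/q.
  block-decay : ∀ r w t j s → s ≤ 1 → ∑ (q ^ℕ r) (λ x → En w (r ℕ.+ t) (q ^ℕ r ℕ.* j ℕ.+ (x ℕ.+ s))) ℚ.≤ κ ^ r
  block-decay zero w t j s s≤1 = ℚ.≤-trans (ℚ.≤-reflexive (ℚ.+-identityʳ _)) (En-≤1 w t (1 ℕ.* j ℕ.+ s))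
  block-decay (suc r) w t j s s≤1 = begin
    ∑ (q ℕ.* Q) (λ x → En w (suc T) (q ℕ.* Q ℕ.* j ℕ.+ (x ℕ.+ s)))                            ≡⟨ cong (λ n → ∑ n (λ x → En w (suc T) (q ℕ.* Q ℕ.* j ℕ.+ (x ℕ.+ s)))) (ℕ.*-comm q Q) ⟩
    ∑ (Q ℕ.* q) (λ x → En w (suc T) (q ℕ.* Q ℕ.* j ℕ.+ (x ℕ.+ s)))                            ≡⟨ ∑-blocks Q q _ ⟩
    ∑ Q (λ x → ∑ q (λ b → En w (suc T) (q ℕ.* Q ℕ.* j ℕ.+ (q ℕ.* x ℕ.+ b ℕ.+ s))))            ≡⟨ ∑-swap Q q _ ⟩
    ∑ q (λ b → ∑ Q (λ x → En w (suc T) (q ℕ.* Q ℕ.* j ℕ.+ (q ℕ.* x ℕ.+ b ℕ.+ s))))            ≡⟨ ∑-cong q (λ b → ∑-cong Q (λ x → cong (En w (suc T)) (collect q Q j x b s))) ⟩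
    ∑ q (λ b → Y (b ℕ.+ s))                                                                   ≤⟨ total ⟩
    fromℕ q * Z - (1 ÷ q) * (μ * Z)                                                           ≡⟨ cong (λ x → fromℕ q * Z - x) (trans (cong (_* ((1 ÷ q) * (μ * Z))) (fromℕ*1÷ 1≤q)) (ℚ.*-identityˡ _)) ⟨
    fromℕ q * Z - (fromℕ q * (1 ÷ q)) * ((1 ÷ q) * (μ * Z))                                   ≡⟨ factor (fromℕ q) (1 ÷ q) μ Z ⟩
    fromℕ q * (1ℚ - (1 ÷ q) * (1 ÷ q) * μ) * Z                                                ≤⟨ *-monoʳ Z 0≤Z (*-monoˡ (fromℕ q) (fromℕ-nonneg q) 1-ρ≤) ⟩
    κ * Z                                                                                     ∎
    where
    open ℚ.≤-Reasoning
    Q = q ^ℕ r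
    T = r ℕ.+ t
    Z = κ ^ r
    μ = (1 ÷ m) * (1 ÷ m)
    0≤Z : 0ℚ ℚ.≤ Z
    0≤Z = ^-nonneg r 0≤κ
    -- `Y y` collects the shifts with last digit y, where y = q is digit 0 of the next quotient;
    -- `A u` collects the quotients after a carry u.
    Y : ℕ → ℚ
    Y y = ∑ Q (λ x → En w (suc T) (q ℕ.* (Q ℕ.* j ℕ.+ x) ℕ.+ y))
    A : ℕ → ℚ
    A u = ∑ Q (λ x → En (next w) T (Q ℕ.* j ℕ.+ (x ℕ.+ u)))
    A≤Z : ∀ {u} → u ≤ 1 → A u ℚ.≤ Z
    A≤Z {u} u≤1 = block-decay r (next w) t j u u≤1
    collect : ∀ q Q j x b s → q ℕ.* Q ℕ.* j ℕ.+ (q ℕ.* x ℕ.+ b ℕ.+ s) ≡ q ℕ.* (Q ℕ.* j ℕ.+ x) ℕ.+ (b ℕ.+ s)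
    collect = ℕ-solve-∀
    factor : ∀ q ν μ Z → q * Z - (q * ν) * (ν * (μ * Z)) ≡ q * (1ℚ - ν * ν * μ) * Z
    factor = solve-∀ ℚ-ring
    carry≤1 : ∀ {y d} → y ≤ q → d < q → (y ℕ.+ d) / q ≤ 1
    carry≤1 {y} {d} y≤q d<q = ℕ.≤-pred (ℕ.m<n*o⇒m/o<n {n = 2} (subst (y ℕ.+ d <_) (cong (q ℕ.+_) (sym (ℕ.+-identityʳ q))) (ℕ.+-mono-≤-< y≤q d<q)))
    ∑-mean : ∀ y → ∑ Q (λ x → mean q (λ d → En (next w) T (Q ℕ.* j ℕ.+ x ℕ.+ (y ℕ.+ d) / q))) ≡ mean q (λ d → A ((y ℕ.+ d) / q))
    ∑-mean y = trans (∑-* Q (1 ÷ q) _) (cong ((1 ÷ q) *_) (trans (∑-swap Q q _) (∑-cong q (λ d → ∑-cong Q (λ x → cong (En (next w) T) (ℕ.+-assoc (Q ℕ.* j) x _))))))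
    Y≤Z : ∀ {y} → y ≤ q → Y y ℚ.≤ Z
    Y≤Z {y} y≤q = begin
      Y y                                                ≤⟨ ∑-mono Q (λ x → En-average w T (Q ℕ.* j ℕ.+ x) y) ⟩
      ∑ Q (λ x → mean q (λ d → En (next w) T (Q ℕ.* j ℕ.+ x ℕ.+ (y ℕ.+ d) / q)))  ≡⟨ ∑-mean y ⟩
      (1 ÷ q) * ∑ q (λ d → A ((y ℕ.+ d) / q))            ≤⟨ *-monoˡ (1 ÷ q) (1÷-nonneg q) (∑-mono< q (λ d d<q → A≤Z (carry≤1 y≤q d<q))) ⟩
      (1 ÷ q) * ∑ q (λ _ → Z)                            ≡⟨ cong ((1 ÷ q) *_) (∑-const q Z) ⟩
      (1 ÷ q) * (fromℕ q * Z)                            ≡⟨ trans (sym (ℚ.*-assoc (1 ÷ q) (fromℕ q) Z)) (cong (_* Z) (trans (ℚ.*-comm (1 ÷ q) (fromℕ q)) (fromℕ*1÷ 1≤q))) ⟩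
      1ℚ * Z                                             ≡⟨ ℚ.*-identityˡ Z ⟩
      Z                                                  ∎
    Y₁-gain : Y 1 + (1 ÷ q) * (μ * A 0) ℚ.≤ mean q (λ d → A ((1 ℕ.+ d) / q))
    Y₁-gain = begin
      Y 1 + (1 ÷ q) * (μ * A 0)                          ≡⟨ cong (Y 1 +_) pull ⟨
      Y 1 + ∑ Q (λ x → (1 ÷ q) * (μ * En (next w) T (Q ℕ.* j ℕ.+ x)))            ≡⟨ ∑-+ Q _ _ ⟨
      ∑ Q (λ x → En w (suc T) (q ℕ.* (Q ℕ.* j ℕ.+ x) ℕ.+ 1) + (1 ÷ q) * (μ * En (next w) T (Q ℕ.* j ℕ.+ x)))  ≤⟨ ∑-mono Q (λ x → En-gain w T (Q ℕ.* j ℕ.+ x)) ⟩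
      ∑ Q (λ x → mean q (λ d → En (next w) T (Q ℕ.* j ℕ.+ x ℕ.+ (1 ℕ.+ d) / q)))  ≡⟨ ∑-mean 1 ⟩
      mean q (λ d → A ((1 ℕ.+ d) / q))                   ∎
      where
      pull : ∑ Q (λ x → (1 ÷ q) * (μ * En (next w) T (Q ℕ.* j ℕ.+ x))) ≡ (1 ÷ q) * (μ * A 0)
      pull = trans (∑-* Q (1 ÷ q) _) (cong ((1 ÷ q) *_) (trans (∑-* Q μ _) (cong (μ *_) (∑-cong Q (λ x → cong (λ y → En (next w) T (Q ℕ.* j ℕ.+ y)) (sym (ℕ.+-identityʳ x)))))))
    μ≤1 : μ ℚ.≤ 1ℚ
    μ≤1 = *-mono 0≤1 (1÷-nonneg m) (1÷-≤1 m) (1÷-≤1 m)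
    -- The gain at digit 1 is proportional to `A 0`, which may be below Z. But digit 0 of n causes
    -- no carry, so `A 0` is among the averaged terms and the mean then falls short of Z too; μ ≤ 1
    -- makes this compensate the missing gain.
    deficit : μ * (Z - A 0) ℚ.≤ fromℕ q * Z - ∑ q (λ d → A ((1 ℕ.+ d) / q))
    deficit = begin
      μ * (Z - A 0)                                      ≤⟨ *-monoʳ (Z - A 0) (≤⇒0≤- (A≤Z z≤n)) μ≤1 ⟩
      1ℚ * (Z - A 0)                                     ≡⟨ ℚ.*-identityˡ (Z - A 0) ⟩
      Z - A 0                                            ≡⟨ cong (λ u → Z - A u) (ℕ.m<n⇒m/n≡0 1<q) ⟨
      Z - A (1 / q)                                      ≤⟨ ∑-term< q 0 {λ d → Z - A ((1 ℕ.+ d) / q)} (λ d d<q → ≤⇒0≤- (A≤Z (carry≤1 1≤q d<q))) (ℕ.<-trans z<s 1<q) ⟩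
      ∑ q (λ d → Z - A ((1 ℕ.+ d) / q))                  ≡⟨ ∑-complement q Z (λ d → A ((1 ℕ.+ d) / q)) ⟩
      fromℕ q * Z - ∑ q (λ d → A ((1 ℕ.+ d) / q))        ∎
    Y₁≤ : (1 ÷ q) * (μ * Z) ℚ.≤ Z - Y 1
    Y₁≤ = ≤-by ((D - Y₁) + (1 ÷ q) * (C - D′)) (+-nonneg (≤⇒0≤- Y₁-gain) (*-nonneg (1÷-nonneg q) (≤⇒0≤- deficit)))
      (trans (cong (_- Y 1) (trans (sym (ℚ.*-identityˡ Z)) (cong (_* Z) (sym (fromℕ*1÷ 1≤q)))))
        (identity (fromℕ q) (1 ÷ q) μ Z (Y 1) (A 0) (∑ q (λ d → A ((1 ℕ.+ d) / q)))))
      where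
      D  = mean q (λ d → A ((1 ℕ.+ d) / q))
      Y₁ = Y 1 + (1 ÷ q) * (μ * A 0)
      C  = fromℕ q * Z - ∑ q (λ d → A ((1 ℕ.+ d) / q))
      D′ = μ * (Z - A 0)
      identity : ∀ q ν μ Z y a S → (q * ν) * Z - y ≡ ν * (μ * Z) + ((ν * S - (y + ν * (μ * a))) + ν * ((q * Z - S) - μ * (Z - a)))
      identity = solve-∀ ℚ-ring
    total : ∑ q (λ b → Y (b ℕ.+ s)) ℚ.≤ fromℕ q * Z - (1 ÷ q) * (μ * Z)
    total = ≤-by _ (≤⇒0≤- at-1) (swap (fromℕ q * Z) (∑ q (λ b → Y (b ℕ.+ s))) ((1 ÷ q) * (μ * Z)))
      where
      swap : ∀ a y x → a - x ≡ y + ((a - y) - x)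
      swap = solve-∀ ℚ-ring
      -- The shift digit 1 is reached at b = 1 ∸ s; all other summands Z - Y are only known to be
      -- nonnegative.
      at-1 : (1 ÷ q) * (μ * Z) ℚ.≤ fromℕ q * Z - ∑ q (λ b → Y (b ℕ.+ s))
      at-1 = begin
        (1 ÷ q) * (μ * Z)                          ≤⟨ Y₁≤ ⟩
        Z - Y 1                                    ≡⟨ cong (λ y → Z - Y y) (ℕ.m∸n+n≡m s≤1) ⟨
        Z - Y (1 ℕ.∸ s ℕ.+ s)                      ≤⟨ ∑-term< q (1 ℕ.∸ s) {λ b → Z - Y (b ℕ.+ s)} (λ b b<q → ≤⇒0≤- (Y≤Z (ℕ.≤-trans (ℕ.+-monoʳ-≤ b s≤1) (subst (_≤ q) (ℕ.+-comm 1 b) b<q)))) (ℕ.≤-<-trans (ℕ.m∸n≤m 1 s) 1<q) ⟩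
        ∑ q (λ b → Z - Y (b ℕ.+ s))                ≡⟨ ∑-complement q Z (λ b → Y (b ℕ.+ s)) ⟩
        fromℕ q * Z - ∑ q (λ b → Y (b ℕ.+ s))      ∎

  energy-decay : ∀ J r w t → ∑ (J ℕ.* q ^ℕ r) (En w (r ℕ.+ t)) ℚ.≤ fromℕ J * κ ^ r
  energy-decay J r w t = begin
    ∑ (J ℕ.* q ^ℕ r) (En w (r ℕ.+ t))                                                   ≡⟨ ∑-blocks J (q ^ℕ r) _ ⟩
    ∑ J (λ j → ∑ (q ^ℕ r) (λ x → En w (r ℕ.+ t) (q ^ℕ r ℕ.* j ℕ.+ x)))                  ≡⟨ ∑-cong J (λ j → ∑-cong (q ^ℕ r) (λ x → cong (λ y → En w (r ℕ.+ t) (q ^ℕ r ℕ.* j ℕ.+ y)) (sym (ℕ.+-identityʳ x)))) ⟩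
    ∑ J (λ j → ∑ (q ^ℕ r) (λ x → En w (r ℕ.+ t) (q ^ℕ r ℕ.* j ℕ.+ (x ℕ.+ 0))))          ≤⟨ ∑-mono J (λ j → block-decay r w t j 0 z≤n) ⟩
    ∑ J (λ _ → κ ^ r)                                                                   ≡⟨ ∑-const J (κ ^ r) ⟩
    fromℕ J * κ ^ r                                                                     ∎
    where open ℚ.≤-Reasoning

-- Products of periodic functions with coprime periods

-- Bézout writes 1 as a difference of multiples of Q and R; over ℕ the two signs are separate cases.
coprime-period : ∀ {Q R f} → Coprime Q R → Periodic Q f → Periodic R f → ∀ y → f (suc y) ≡ f y
coprime-period {Q} {R} {f} Q⊥R perQ perR y with coprime-Bézout Q⊥R
... | Bézout.+- a b 1+bR≡aQ = begin
  f (suc y)                  ≡⟨ *-periodic {R} {f} perR b (suc y) ⟨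
  f (R ℕ.* b ℕ.+ suc y)      ≡⟨ cong f (trans (collect R b y) (cong (ℕ._+ y) (trans 1+bR≡aQ (ℕ.*-comm a Q)))) ⟩
  f (Q ℕ.* a ℕ.+ y)          ≡⟨ *-periodic {Q} {f} perQ a y ⟩
  f y                        ∎
  where
  open ≡-Reasoning
  collect : ∀ R b y → R ℕ.* b ℕ.+ suc y ≡ suc (b ℕ.* R) ℕ.+ y
  collect = ℕ-solve-∀
... | Bézout.-+ a b 1+aQ≡bR = begin
  f (suc y)                  ≡⟨ *-periodic {Q} {f} perQ a (suc y) ⟨
  f (Q ℕ.* a ℕ.+ suc y)      ≡⟨ cong f (trans (collect Q a y) (cong (ℕ._+ y) (trans 1+aQ≡bR (ℕ.*-comm b R)))) ⟩
  f (R ℕ.* b ℕ.+ y)          ≡⟨ *-periodic {R} {f} perR b y ⟩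
  f y                        ∎
  where
  open ≡-Reasoning
  collect : ∀ R b y → R ℕ.* b ℕ.+ suc y ≡ suc (b ℕ.* R) ℕ.+ y
  collect = ℕ-solve-∀

constant : ∀ {f : ℕ → ℚ} → (∀ y → f (suc y) ≡ f y) → ∀ y → f y ≡ f 0
constant step zero    = refl
constant step (suc y) = trans (step y) (constant step y)

-- As a function of y the sum has period R, and also period Q because y + Q only rotates the index
-- a. By coprimality it is constant, and its average over y < R is the full sum of G.
∑-coprime-progression : ∀ {Q R G} → 1 ≤ R → Coprime Q R → Periodic R G → ∀ y → ∑ R (λ a → G (Q ℕ.* a ℕ.+ y)) ≡ ∑ R G
∑-coprime-progression {Q} {R} {G} 1≤R Q⊥R per y = begin
  Φ y                                ≡⟨ ℚ.*-identityˡ (Φ y) ⟨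
  1ℚ * Φ y                           ≡⟨ cong (_* Φ y) (trans (ℚ.*-comm (1 ÷ R) (fromℕ R)) (fromℕ*1÷ 1≤R)) ⟨
  (1 ÷ R) * fromℕ R * Φ y            ≡⟨ ℚ.*-assoc (1 ÷ R) (fromℕ R) (Φ y) ⟩
  (1 ÷ R) * (fromℕ R * Φ y)          ≡⟨ cong ((1 ÷ R) *_) double ⟩
  (1 ÷ R) * (fromℕ R * ∑ R G)        ≡⟨ ℚ.*-assoc (1 ÷ R) (fromℕ R) (∑ R G) ⟨
  (1 ÷ R) * fromℕ R * ∑ R G          ≡⟨ cong (_* ∑ R G) (trans (ℚ.*-comm (1 ÷ R) (fromℕ R)) (fromℕ*1÷ 1≤R)) ⟩
  1ℚ * ∑ R G                         ≡⟨ ℚ.*-identityˡ (∑ R G) ⟩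
  ∑ R G                              ∎
  where
  open ≡-Reasoning
  Φ : ℕ → ℚ
  Φ y = ∑ R (λ a → G (Q ℕ.* a ℕ.+ y))
  Φ-perR : Periodic R Φ
  Φ-perR y = ∑-cong R (λ a → shift-periodic {R} {G} per (Q ℕ.* a) y)
  Φ-perQ : Periodic Q Φ
  Φ-perQ y = trans (∑-cong R (λ a → cong G (absorb Q a y))) (∑-shift R {λ a → G (Q ℕ.* a ℕ.+ y)} (λ a → trans (cong G (expand Q R a y)) (*-periodic {R} {G} per Q (Q ℕ.* a ℕ.+ y))) 1)
    where
    absorb : ∀ Q a y → Q ℕ.* a ℕ.+ (Q ℕ.+ y) ≡ Q ℕ.* (1 ℕ.+ a) ℕ.+ y
    absorb = ℕ-solve-∀
    expand : ∀ Q R a y → Q ℕ.* (R ℕ.+ a) ℕ.+ y ≡ R ℕ.* Q ℕ.+ (Q ℕ.* a ℕ.+ y)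
    expand = ℕ-solve-∀
  Φ-constant : ∀ z → Φ z ≡ Φ 0
  Φ-constant = constant {Φ} (coprime-period {Q} {R} {Φ} Q⊥R Φ-perQ Φ-perR)
  double : fromℕ R * Φ y ≡ fromℕ R * ∑ R G
  double = begin
    fromℕ R * Φ y                                   ≡⟨ ∑-const R (Φ y) ⟨
    ∑ R (λ _ → Φ y)                                 ≡⟨ ∑-cong R (λ z → trans (Φ-constant y) (sym (Φ-constant z))) ⟩
    ∑ R Φ                                           ≡⟨ ∑-swap R R (λ z a → G (Q ℕ.* a ℕ.+ z)) ⟩
    ∑ R (λ a → ∑ R (λ z → G (Q ℕ.* a ℕ.+ z)))       ≡⟨ ∑-cong R (λ a → ∑-shift R {G} per (Q ℕ.* a)) ⟩
    ∑ R (λ _ → ∑ R G)                               ≡⟨ ∑-const R (∑ R G) ⟩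
    fromℕ R * ∑ R G                                 ∎

-- Write n = Q·a + y: g depends only on y, and for fixed y the progression in a meets each residue
-- modulo R once.
mean-coprime : ∀ {Q R g G} → 1 ≤ Q → 1 ≤ R → Coprime Q R → Periodic Q g → Periodic R G →
               mean (Q ℕ.* R) (λ n → g n * G n) ≡ mean Q g * mean R G
mean-coprime {Q} {R} {g} {G} 1≤Q 1≤R Q⊥R perg perG = begin
  (1 ÷ (Q ℕ.* R)) * ∑ (Q ℕ.* R) (λ n → g n * G n)               ≡⟨ cong₂ _*_ (1÷-* Q R 1≤Q 1≤R) (trans (cong (λ x → ∑ x (λ n → g n * G n)) (ℕ.*-comm Q R)) rectangle) ⟩
  (1 ÷ Q) * (1 ÷ R) * (∑ R G * ∑ Q g)                           ≡⟨ regroup (1 ÷ Q) (1 ÷ R) (∑ R G) (∑ Q g) ⟩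
  mean Q g * mean R G                                           ∎
  where
  open ≡-Reasoning
  regroup : ∀ a b c d → a * b * (c * d) ≡ (a * d) * (b * c)
  regroup = solve-∀ ℚ-ring
  rectangle : ∑ (R ℕ.* Q) (λ n → g n * G n) ≡ ∑ R G * ∑ Q g
  rectangle = begin
    ∑ (R ℕ.* Q) (λ n → g n * G n)                                          ≡⟨ ∑-blocks R Q _ ⟩
    ∑ R (λ a → ∑ Q (λ y → g (Q ℕ.* a ℕ.+ y) * G (Q ℕ.* a ℕ.+ y)))          ≡⟨ ∑-swap R Q _ ⟩
    ∑ Q (λ y → ∑ R (λ a → g (Q ℕ.* a ℕ.+ y) * G (Q ℕ.* a ℕ.+ y)))          ≡⟨ ∑-cong Q (λ y → ∑-cong R (λ a → cong (_* G (Q ℕ.* a ℕ.+ y)) (*-periodic {Q} {g} perg a y))) ⟩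
    ∑ Q (λ y → ∑ R (λ a → g y * G (Q ℕ.* a ℕ.+ y)))                        ≡⟨ ∑-cong Q (λ y → trans (∑-* R (g y) _) (trans (cong (g y *_) (∑-coprime-progression {Q} {R} {G} 1≤R Q⊥R perG y)) (ℚ.*-comm (g y) (∑ R G)))) ⟩
    ∑ Q (λ y → ∑ R G * g y)                                                ≡⟨ ∑-* Q (∑ R G) g ⟩
    ∑ R G * ∑ Q g                                                          ∎

∏ℚ ∑ℚ : ∀ {k} → Vector ℚ k → ℚ
∏ℚ = foldr _*_ 1ℚ
∑ℚ = foldr _+_ 0ℚ

∑ℚ-nonneg : ∀ {k} {x : Vector ℚ k} → (∀ i → 0ℚ ℚ.≤ x i) → 0ℚ ℚ.≤ ∑ℚ x
∑ℚ-nonneg {zero}  0≤x = ℚ.≤-refl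
∑ℚ-nonneg {suc k} 0≤x = +-nonneg (0≤x zero) (∑ℚ-nonneg (λ i → 0≤x (suc i)))

∏ℚ-nonneg : ∀ {k} {x : Vector ℚ k} → (∀ i → 0ℚ ℚ.≤ x i) → 0ℚ ℚ.≤ ∏ℚ x
∏ℚ-nonneg {zero}  0≤x = 0≤1
∏ℚ-nonneg {suc k} 0≤x = *-nonneg (0≤x zero) (∏ℚ-nonneg (λ i → 0≤x (suc i)))

∏ℚ-≤1 : ∀ {k} {x : Vector ℚ k} → (∀ i → 0ℚ ℚ.≤ x i) → (∀ i → x i ℚ.≤ 1ℚ) → ∏ℚ x ℚ.≤ 1ℚ
∏ℚ-≤1 {zero}  0≤x x≤1 = ℚ.≤-refl
∏ℚ-≤1 {suc k} 0≤x x≤1 = *-mono 0≤1 (∏ℚ-nonneg (λ i → 0≤x (suc i))) (x≤1 zero) (∏ℚ-≤1 (λ i → 0≤x (suc i)) (λ i → x≤1 (suc i)))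

-- Replace one factor at a time; the other factors lie in [0, 1], so the errors add. An upper bound
-- is enough, as van der Corput's inequality needs no lower bound for correlations.
∏ℚ-perturb : ∀ {k} {x y ε : Vector ℚ k} → (∀ i → 0ℚ ℚ.≤ x i) → (∀ i → x i ℚ.≤ 1ℚ) → (∀ i → 0ℚ ℚ.≤ y i) → (∀ i → y i ℚ.≤ 1ℚ) →
             (∀ i → 0ℚ ℚ.≤ ε i) → (∀ i → x i ℚ.≤ y i + ε i) → ∏ℚ x ℚ.≤ ∏ℚ y + ∑ℚ ε
∏ℚ-perturb {zero}  0≤x x≤1 0≤y y≤1 0≤ε x≤y+ε = ℚ.≤-reflexive (sym (ℚ.+-identityʳ 1ℚ))
∏ℚ-perturb {suc k} {x} {y} {ε} 0≤x x≤1 0≤y y≤1 0≤ε x≤y+ε = begin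
  x zero * X                         ≤⟨ *-monoˡ (x zero) (0≤x zero) (∏ℚ-perturb (λ i → 0≤x (suc i)) (λ i → x≤1 (suc i)) (λ i → 0≤y (suc i)) (λ i → y≤1 (suc i)) (λ i → 0≤ε (suc i)) (λ i → x≤y+ε (suc i))) ⟩
  x zero * (Y + S)                   ≡⟨ ℚ.*-distribˡ-+ (x zero) Y S ⟩
  x zero * Y + x zero * S            ≤⟨ ℚ.+-mono-≤ (*-monoʳ Y 0≤Y (x≤y+ε zero)) (ℚ.≤-trans (*-monoʳ S 0≤S (x≤1 zero)) (ℚ.≤-reflexive (ℚ.*-identityˡ S))) ⟩
  (y zero + ε zero) * Y + S          ≡⟨ cong (_+ S) (ℚ.*-distribʳ-+ Y (y zero) (ε zero)) ⟩
  y zero * Y + ε zero * Y + S        ≤⟨ ℚ.+-monoˡ-≤ S (ℚ.+-monoʳ-≤ (y zero * Y) (ℚ.≤-trans (*-monoˡ (ε zero) (0≤ε zero) (∏ℚ-≤1 (λ i → 0≤y (suc i)) (λ i → y≤1 (suc i)))) (ℚ.≤-reflexive (ℚ.*-identityʳ (ε zero))))) ⟩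
  y zero * Y + ε zero + S            ≡⟨ ℚ.+-assoc (y zero * Y) (ε zero) S ⟩
  y zero * Y + (ε zero + S)          ∎
  where
  open ℚ.≤-Reasoning
  X = ∏ℚ (λ i → x (suc i))
  Y = ∏ℚ (λ i → y (suc i))
  S = ∑ℚ (λ i → ε (suc i))
  0≤Y : 0ℚ ℚ.≤ Y
  0≤Y = ∏ℚ-nonneg (λ i → 0≤y (suc i))
  0≤S : 0ℚ ℚ.≤ S
  0≤S = ∑ℚ-nonneg (λ i → 0≤ε (suc i))

∏-pos : ∀ {k} {Q : Vector ℕ k} → (∀ i → 1 ≤ Q i) → 1 ≤ ∏ Q
∏-pos {zero}  1≤Q = ℕ.≤-refl
∏-pos {suc k} 1≤Q = ℕ.*-mono-≤ (1≤Q zero) (∏-pos (λ i → 1≤Q (suc i)))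

∏-1÷ : ∀ {k} {m : Vector ℕ k} → (∀ i → 1 ≤ m i) → ∏ℚ (λ i → 1 ÷ m i) ≡ 1 ÷ ∏ m
∏-1÷ {zero}  1≤m = refl
∏-1÷ {suc k} {m} 1≤m = trans (cong ((1 ÷ m zero) *_) (∏-1÷ (λ i → 1≤m (suc i)))) (sym (1÷-* (m zero) _ (1≤m zero) (∏-pos (λ i → 1≤m (suc i)))))

coprime-* : ∀ {a b c} → Coprime a b → Coprime a c → Coprime a (b ℕ.* c)
coprime-* {a} {b} {c} a⊥b a⊥c {d} (d∣a , d∣bc) = a⊥c (d∣a , coprime-divisor {d} {b} (λ (x∣d , x∣b) → a⊥b (∣-trans x∣d d∣a , x∣b)) d∣bc)

coprime-∏ : ∀ {k a} {Q : Vector ℕ k} → (∀ i → Coprime a (Q i)) → Coprime a (∏ Q)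
coprime-∏ {zero}  a⊥Q (_ , d∣1) = ∣1⇒≡1 d∣1
coprime-∏ {suc k} a⊥Q = coprime-* (a⊥Q zero) (coprime-∏ (λ i → a⊥Q (suc i)))

∏ℚ-periodic : ∀ {k} {Q : Vector ℕ k} {g : Fin k → ℕ → ℚ} → (∀ i → Periodic (Q i) (g i)) → Periodic (∏ Q) (λ n → ∏ℚ (λ i → g i n))
∏ℚ-periodic {zero}  per n = refl
∏ℚ-periodic {suc k} {Q} {g} per n = cong₂ _*_
  (*-periodic {Q zero} {g zero} (per zero) R n)
  (trans (cong (λ x → G (x ℕ.+ n)) (ℕ.*-comm (Q zero) R)) (*-periodic {R} {G} (∏ℚ-periodic {k} {λ i → Q (suc i)} {λ i → g (suc i)} (λ i → per (suc i))) (Q zero) n))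
  where
  R = ∏ (λ i → Q (suc i))
  G = λ n → ∏ℚ (λ i → g (suc i) n)

mean-∏ : ∀ {k} {Q : Vector ℕ k} {g : Fin k → ℕ → ℚ} → (∀ i → 1 ≤ Q i) → (∀ i j → i ≢ j → Coprime (Q i) (Q j)) →
         (∀ i → Periodic (Q i) (g i)) → mean (∏ Q) (λ n → ∏ℚ (λ i → g i n)) ≡ ∏ℚ (λ i → mean (Q i) (g i))
mean-∏ {zero}  1≤Q Q⊥Q per = refl
mean-∏ {suc k} {Q} {g} 1≤Q Q⊥Q per = trans
  (mean-coprime {Q zero} {_} {g zero} (1≤Q zero) (∏-pos (λ i → 1≤Q (suc i))) (coprime-∏ (λ i → Q⊥Q zero (suc i) (λ ()))) (per zero) (∏ℚ-periodic {k} {λ i → Q (suc i)} {λ i → g (suc i)} (λ i → per (suc i))))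
  (cong (mean (Q zero) (g zero) *_) (mean-∏ (λ i → 1≤Q (suc i)) (λ i j i≢j → Q⊥Q (suc i) (suc j) (λ 1+i≡1+j → i≢j (suc-injective 1+i≡1+j))) (λ i → per (suc i))))

-- Round N up to a multiple of W: at most W further terms enter, all nonnegative.
∑-periodic-≤ : ∀ {W f} → 1 ≤ W → Periodic W f → (∀ n → 0ℚ ℚ.≤ f n) → ∀ N → ∑ N f ℚ.≤ (fromℕ N + fromℕ W) * mean W f
∑-periodic-≤ {W@(suc _)} {f} 1≤W per 0≤f N = begin
  ∑ N f                                                 ≤⟨ ∑-mono-len 0≤f N≤ ⟩
  ∑ (suc (N / W) ℕ.* W) f                               ≡⟨ ∑-blocks (suc (N / W)) W f ⟩
  ∑ (suc (N / W)) (λ a → ∑ W (λ y → f (W ℕ.* a ℕ.+ y))) ≡⟨ ∑-cong (suc (N / W)) (λ a → ∑-cong W (λ y → *-periodic {W} {f} per a y)) ⟩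
  ∑ (suc (N / W)) (λ _ → ∑ W f)                         ≡⟨ ∑-const (suc (N / W)) (∑ W f) ⟩
  fromℕ (suc (N / W)) * ∑ W f                           ≡⟨ cong (fromℕ (suc (N / W)) *_) W*mean ⟨
  fromℕ (suc (N / W)) * (fromℕ W * mean W f)            ≡⟨ ℚ.*-assoc (fromℕ (suc (N / W))) (fromℕ W) (mean W f) ⟨
  fromℕ (suc (N / W)) * fromℕ W * mean W f              ≡⟨ cong (_* mean W f) (fromℕ-* (suc (N / W)) W) ⟨
  fromℕ (suc (N / W) ℕ.* W) * mean W f                  ≤⟨ *-monoʳ (mean W f) (*-nonneg (1÷-nonneg W) (∑-nonneg W 0≤f)) (fromℕ-mono ≤N+W) ⟩
  fromℕ (N ℕ.+ W) * mean W f                            ≡⟨ cong (_* mean W f) (fromℕ-+ N W) ⟩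
  (fromℕ N + fromℕ W) * mean W f                        ∎
  where
  open ℚ.≤-Reasoning
  N≤ : N ≤ suc (N / W) ℕ.* W
  N≤ = subst (_≤ suc (N / W) ℕ.* W) (sym (ℕ.m≡m%n+[m/n]*n N W)) (ℕ.+-monoˡ-≤ (N / W ℕ.* W) (ℕ.<⇒≤ (ℕ.m%n<n N W)))
  ≤N+W : suc (N / W) ℕ.* W ≤ N ℕ.+ W
  ≤N+W = subst (_≤ N ℕ.+ W) (ℕ.+-comm (N / W ℕ.* W) W) (ℕ.+-monoˡ-≤ W (ℕ.m/n*n≤m N W))
  W*mean : fromℕ W * mean W f ≡ ∑ W f
  W*mean = trans (sym (ℚ.*-assoc (fromℕ W) (1 ÷ W) (∑ W f))) (trans (cong (_* ∑ W f) (fromℕ*1÷ {W} 1≤W)) (ℚ.*-identityˡ (∑ W f)))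

∑-overshoot : ∀ n ℓ → ∑ n (λ y → ⟦ n ℕ.≤? (y ℕ.+ ℓ) ⟧) ℚ.≤ fromℕ (n ℕ.⊓ ℓ)
∑-overshoot zero    ℓ = fromℕ-nonneg 0
∑-overshoot (suc n) ℓ = begin
  ⟦ suc n ℕ.≤? ℓ ⟧ + ∑ n (λ y → ⟦ suc n ℕ.≤? suc (y ℕ.+ ℓ) ⟧)   ≡⟨ cong (⟦ suc n ℕ.≤? ℓ ⟧ +_) (∑-cong n (λ y → ⟦⟧-cong (suc n ℕ.≤? suc (y ℕ.+ ℓ)) (n ℕ.≤? (y ℕ.+ ℓ)) ℕ.≤-pred s≤s)) ⟩
  ⟦ suc n ℕ.≤? ℓ ⟧ + ∑ n (λ y → ⟦ n ℕ.≤? (y ℕ.+ ℓ) ⟧)           ≤⟨ ℚ.+-monoʳ-≤ ⟦ suc n ℕ.≤? ℓ ⟧ (∑-overshoot n ℓ) ⟩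
  ⟦ suc n ℕ.≤? ℓ ⟧ + fromℕ (n ℕ.⊓ ℓ)                            ≤⟨ step (suc n ℕ.≤? ℓ) ⟩
  fromℕ (suc n ℕ.⊓ ℓ)                                           ∎
  where
  open ℚ.≤-Reasoning
  step : (d : Dec (suc n ≤ ℓ)) → ⟦ d ⟧ + fromℕ (n ℕ.⊓ ℓ) ℚ.≤ fromℕ (suc n ℕ.⊓ ℓ)
  step (yes n<ℓ) = begin
    1ℚ + fromℕ (n ℕ.⊓ ℓ)    ≡⟨ cong (λ x → 1ℚ + fromℕ x) (ℕ.m≤n⇒m⊓n≡m (ℕ.<⇒≤ n<ℓ)) ⟩
    1ℚ + fromℕ n            ≡⟨ fromℕ-+ 1 n ⟨
    fromℕ (suc n)           ≡⟨ cong fromℕ (ℕ.m≤n⇒m⊓n≡m n<ℓ) ⟨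
    fromℕ (suc n ℕ.⊓ ℓ)     ∎
  step (no n≮ℓ) = begin
    0ℚ + fromℕ (n ℕ.⊓ ℓ)    ≡⟨ ℚ.+-identityˡ (fromℕ (n ℕ.⊓ ℓ)) ⟩
    fromℕ (n ℕ.⊓ ℓ)         ≤⟨ fromℕ-mono (ℕ.⊓-monoˡ-≤ ℓ (ℕ.n≤1+n n)) ⟩
    fromℕ (suc n ℕ.⊓ ℓ)     ∎

mean-mono : ∀ n {f g} → (∀ i → f i ℚ.≤ g i) → mean n f ℚ.≤ mean n g
mean-mono n f≤g = *-monoˡ (1 ÷ n) (1÷-nonneg n) (∑-mono n f≤g)

mean-const : ∀ {n} → 1 ≤ n → ∀ c → mean n (λ _ → c) ≡ c
mean-const {n} 1≤n c = begin
  (1 ÷ n) * ∑ n (λ _ → c)      ≡⟨ cong ((1 ÷ n) *_) (∑-const n c) ⟩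
  (1 ÷ n) * (fromℕ n * c)      ≡⟨ ℚ.*-assoc (1 ÷ n) (fromℕ n) c ⟨
  (1 ÷ n) * fromℕ n * c        ≡⟨ cong (_* c) (trans (ℚ.*-comm (1 ÷ n) (fromℕ n)) (fromℕ*1÷ 1≤n)) ⟩
  1ℚ * c                       ≡⟨ ℚ.*-identityˡ c ⟩
  c                            ∎
  where open ≡-Reasoning

mean-+ : ∀ n f g → mean n (λ i → f i + g i) ≡ mean n f + mean n g
mean-+ n f g = trans (cong ((1 ÷ n) *_) (∑-+ n f g)) (ℚ.*-distribˡ-+ (1 ÷ n) (∑ n f) (∑ n g))

-- Truncation to the low digits

module Truncation {p : ℕ} (pr : Prime p) {m : ℕ} (1≤m : 1 ≤ m) (t : ℕ) where

  open Correlation pr 1≤m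

  Q : ℕ
  Q = q ^ℕ t

  1≤Q : 1 ≤ Q
  1≤Q = 1≤q^ t

  private instance
    Q≢0 : NonZero Q
    Q≢0 = ℕ.>-nonZero 1≤Q

  -- Below Q the addition of ℓ does not disturb the higher digits; overshooting residues are simply counted.
  Good : ℕ → ℕ → Set
  Good ℓ y = m ∣ shift 0 ℓ y ⊎ Q ≤ y ℕ.+ ℓ

  good? : ∀ ℓ y → Dec (Good ℓ y)
  good? ℓ y = (m ∣? shift 0 ℓ y) ⊎-dec (Q ℕ.≤? (y ℕ.+ ℓ))

  local : ℕ → ℕ → ℚ
  local ℓ n = ⟦ good? ℓ (n % Q) ⟧

  local-periodic : ∀ ℓ → Periodic Q (local ℓ)
  local-periodic ℓ n = cong (λ y → ⟦ good? ℓ y ⟧) (trans (cong (_% Q) (ℕ.+-comm Q n)) (ℕ.[m+n]%n≡m%n n Q))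

  shift-0 : ∀ ℓ n → shift 0 ℓ n ≡ e p (n ℕ.+ ℓ) ℕ.+ (m ℕ.∸ 1) ℕ.* e p n
  shift-0 ℓ n = cong₂ (λ u v → u ℕ.+ (m ℕ.∸ 1) ℕ.* v) (ℕ.+-identityʳ (e p (n ℕ.+ ℓ))) (ℕ.+-identityʳ (e p n))

  -- Unless `n % Q ℕ.+ ℓ` reaches Q, n and n + ℓ share their higher digits. Their common
  -- contribution E enters as E + (m - 1)E = mE and is invisible modulo m.
  shift⇒good : ∀ ℓ n → m ∣ shift 0 ℓ n → Good ℓ (n % Q)
  shift⇒good ℓ n m∣ with Q ℕ.≤? (n % Q ℕ.+ ℓ)
  ... | yes Q≤y+ℓ = inj₂ Q≤y+ℓ
  ... | no  Q≰y+ℓ = inj₁ (∣m+n∣m⇒∣n (subst (m ∣_) shift≡ m∣) (m∣m*n E))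
    where
    open ≡-Reasoning
    a = n / Q
    y = n % Q
    E = e p (Q ℕ.* a)
    additive : ∀ {x} → x < Q → e p (Q ℕ.* a ℕ.+ x) ≡ E ℕ.+ e p x
    additive {x} x<Q = subst (λ R → e p (R ℕ.* a ℕ.+ x) ≡ e p (R ℕ.* a) ℕ.+ e p x) (sym (ℕ.^-*-assoc p 2 t))
      (e-additive pr (2 ℕ.* t) a (subst (x <_) (ℕ.^-*-assoc p 2 t) x<Q))
    n≡ : n ≡ Q ℕ.* a ℕ.+ y
    n≡ = trans (ℕ.m≡m%n+[m/n]*n n Q) (trans (ℕ.+-comm y _) (cong (ℕ._+ y) (ℕ.*-comm a Q)))
    regroup : ∀ E u m′ v → E ℕ.+ u ℕ.+ m′ ℕ.* (E ℕ.+ v) ≡ suc m′ ℕ.* E ℕ.+ (u ℕ.+ m′ ℕ.* v)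
    regroup = ℕ-solve-∀
    shift≡ : shift 0 ℓ n ≡ m ℕ.* E ℕ.+ shift 0 ℓ y
    shift≡ = begin
      shift 0 ℓ n                                                      ≡⟨ shift-0 ℓ n ⟩
      e p (n ℕ.+ ℓ) ℕ.+ (m ℕ.∸ 1) ℕ.* e p n                            ≡⟨ cong₂ (λ u v → e p u ℕ.+ (m ℕ.∸ 1) ℕ.* e p v) (trans (cong (ℕ._+ ℓ) n≡) (ℕ.+-assoc (Q ℕ.* a) y ℓ)) n≡ ⟩
      e p (Q ℕ.* a ℕ.+ (y ℕ.+ ℓ)) ℕ.+ (m ℕ.∸ 1) ℕ.* e p (Q ℕ.* a ℕ.+ y)  ≡⟨ cong₂ (λ u v → u ℕ.+ (m ℕ.∸ 1) ℕ.* v) (additive (ℕ.≰⇒> Q≰y+ℓ)) (additive (ℕ.m%n<n n Q)) ⟩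
      E ℕ.+ e p (y ℕ.+ ℓ) ℕ.+ (m ℕ.∸ 1) ℕ.* (E ℕ.+ e p y)              ≡⟨ regroup E (e p (y ℕ.+ ℓ)) (m ℕ.∸ 1) (e p y) ⟩
      suc (m ℕ.∸ 1) ℕ.* E ℕ.+ (e p (y ℕ.+ ℓ) ℕ.+ (m ℕ.∸ 1) ℕ.* e p y)  ≡⟨ cong₂ (λ u v → u ℕ.* E ℕ.+ v) (ℕ.m+[n∸m]≡n 1≤m) (sym (shift-0 ℓ y)) ⟩
      m ℕ.* E ℕ.+ shift 0 ℓ y                                          ∎

  mean-local-nonneg : ∀ ℓ → 0ℚ ℚ.≤ mean Q (local ℓ)
  mean-local-nonneg ℓ = *-nonneg (1÷-nonneg Q) (∑-nonneg Q (λ n → ⟦⟧-nonneg (good? ℓ (n % Q))))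

  mean-local-≤1 : ∀ ℓ → mean Q (local ℓ) ℚ.≤ 1ℚ
  mean-local-≤1 ℓ = ℚ.≤-trans (mean-mono Q (λ n → ⟦⟧-≤1 (good? ℓ (n % Q)))) (ℚ.≤-reflexive (mean-const 1≤Q 1ℚ))

  -- The probability of residue 0 is 1/m plus the entry `ψ 0 t ℓ 0`. The square of this entry is at
  -- most the energy, and at most H of the Q residues overshoot.
  mean-local : ∀ {τ τ′} → 0ℚ ℚ.≤ τ′ → τ * τ′ ≡ 1ℚ → ∀ {H ℓ} → ℓ ≤ H →
               mean Q (local ℓ) ℚ.≤ (1 ÷ m) + (ℚ.½ * τ + ℚ.½ * (τ′ * En 0 t ℓ) + fromℕ H * (1 ÷ Q))
  mean-local {τ} {τ′} 0≤τ′ ττ′≡1 {H} {ℓ} ℓ≤H = begin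
    mean Q (local ℓ)                                                              ≡⟨ cong ((1 ÷ Q) *_) (∑-cong< Q (λ n n<Q → cong (λ y → ⟦ good? ℓ y ⟧) (ℕ.m<n⇒m%n≡m n<Q))) ⟩
    mean Q (λ y → ⟦ good? ℓ y ⟧)                                                  ≤⟨ mean-mono Q union ⟩
    mean Q (λ y → (1 ÷ m) + centred m (shift 0 ℓ y ℕ.+ 0) + ⟦ Q ℕ.≤? (y ℕ.+ ℓ) ⟧)  ≡⟨ trans (mean-+ Q _ _) (cong (_+ over) (trans (mean-+ Q (λ _ → 1 ÷ m) _) (cong (_+ x) (mean-const 1≤Q (1 ÷ m))))) ⟩
    (1 ÷ m) + x + over                                                            ≤⟨ ℚ.+-mono-≤ (ℚ.+-monoʳ-≤ (1 ÷ m) am-gm) over≤ ⟩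
    (1 ÷ m) + (ℚ.½ * τ + ℚ.½ * (τ′ * En 0 t ℓ)) + fromℕ H * (1 ÷ Q)               ≡⟨ ℚ.+-assoc (1 ÷ m) _ _ ⟩
    (1 ÷ m) + (ℚ.½ * τ + ℚ.½ * (τ′ * En 0 t ℓ) + fromℕ H * (1 ÷ Q))               ∎
    where
    open ℚ.≤-Reasoning
    x = ψ 0 t ℓ 0
    over = mean Q (λ y → ⟦ Q ℕ.≤? (y ℕ.+ ℓ) ⟧)
    split : ∀ {A B : Set} (a : Dec A) (b : Dec B) → ⟦ a ⊎-dec b ⟧ ℚ.≤ ⟦ a ⟧ + ⟦ b ⟧
    split (yes _) b = ≤-by ⟦ b ⟧ (⟦⟧-nonneg b) refl
    split (no _) (yes _) = ℚ.≤-refl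
    split (no _) (no _)  = ℚ.≤-refl
    recentre : ∀ ν d → d ≡ ν + (d - ν)
    recentre = solve-∀ ℚ-ring
    union : ∀ y → ⟦ good? ℓ y ⟧ ℚ.≤ (1 ÷ m) + centred m (shift 0 ℓ y ℕ.+ 0) + ⟦ Q ℕ.≤? (y ℕ.+ ℓ) ⟧
    union y = begin
      ⟦ good? ℓ y ⟧                                                              ≤⟨ split (m ∣? shift 0 ℓ y) (Q ℕ.≤? (y ℕ.+ ℓ)) ⟩
      divisible m (shift 0 ℓ y) + ⟦ Q ℕ.≤? (y ℕ.+ ℓ) ⟧                           ≡⟨ cong (λ z → divisible m z + ⟦ Q ℕ.≤? (y ℕ.+ ℓ) ⟧) (ℕ.+-identityʳ (shift 0 ℓ y)) ⟨
      divisible m (shift 0 ℓ y ℕ.+ 0) + ⟦ Q ℕ.≤? (y ℕ.+ ℓ) ⟧                     ≡⟨ cong (_+ ⟦ Q ℕ.≤? (y ℕ.+ ℓ) ⟧) (recentre (1 ÷ m) (divisible m (shift 0 ℓ y ℕ.+ 0))) ⟩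
      (1 ÷ m) + centred m (shift 0 ℓ y ℕ.+ 0) + ⟦ Q ℕ.≤? (y ℕ.+ ℓ) ⟧             ∎
    over≤ : over ℚ.≤ fromℕ H * (1 ÷ Q)
    over≤ = begin
      (1 ÷ Q) * ∑ Q (λ y → ⟦ Q ℕ.≤? (y ℕ.+ ℓ) ⟧)      ≤⟨ *-monoˡ (1 ÷ Q) (1÷-nonneg Q) (ℚ.≤-trans (∑-overshoot Q ℓ) (fromℕ-mono (ℕ.≤-trans (ℕ.m⊓n≤n Q ℓ) ℓ≤H))) ⟩
      (1 ÷ Q) * fromℕ H                               ≡⟨ ℚ.*-comm (1 ÷ Q) (fromℕ H) ⟩
      fromℕ H * (1 ÷ Q)                               ∎
    -- The nonnegative remainder is τ′(x - τ)²/2. The multiples of 1 - ττ′ stay explicit, since a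
    -- ring identity cannot use ττ′ = 1; they vanish in the next step.
    expand : ∀ τ τ′ x → ℚ.½ * (τ * 1ℚ) + ℚ.½ * (τ′ * (x * x)) ≡ x * 1ℚ + ℚ.½ * τ * (1ℚ - τ * τ′) + x * (τ * τ′ - 1ℚ) + ℚ.½ * (τ′ * ((x - τ) * (x - τ)))
    expand = solve-∀ ℚ-ring
    tidy : ∀ x c b → x * 1ℚ + c * (1ℚ - 1ℚ) + x * (1ℚ - 1ℚ) + b ≡ x + b
    tidy = solve-∀ ℚ-ring
    am-gm : x ℚ.≤ ℚ.½ * τ + ℚ.½ * (τ′ * En 0 t ℓ)
    am-gm = begin
      x                                              ≤⟨ ≤-by (ℚ.½ * (τ′ * ((x - τ) * (x - τ)))) (*-nonneg 0≤½ (*-nonneg 0≤τ′ (²-nonneg (x - τ))))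
                                                         (trans (expand τ τ′ x) (trans (cong (λ u → x * 1ℚ + ℚ.½ * τ * (1ℚ - u) + x * (u - 1ℚ) + ℚ.½ * (τ′ * ((x - τ) * (x - τ)))) ττ′≡1) (tidy x (ℚ.½ * τ) _))) ⟩
      ℚ.½ * (τ * 1ℚ) + ℚ.½ * (τ′ * (x * x))          ≡⟨ cong (λ u → ℚ.½ * u + ℚ.½ * (τ′ * (x * x))) (ℚ.*-identityʳ τ) ⟩
      ℚ.½ * τ + ℚ.½ * (τ′ * (x * x))                 ≤⟨ ℚ.+-monoʳ-≤ (ℚ.½ * τ) (*-monoˡ ℚ.½ 0≤½ (*-monoˡ τ′ 0≤τ′ (∑-term< m 0 {λ c → ψ 0 t ℓ c * ψ 0 t ℓ c} (λ c _ → ²-nonneg (ψ 0 t ℓ c)) 1≤m))) ⟩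
      ℚ.½ * τ + ℚ.½ * (τ′ * En 0 t ℓ)                ∎

-- Van der Corput's inequality for the distribution of an integer sequence

≟-sym : ∀ (a b : ℕ) → ⟦ a ℕ.≟ b ⟧ ≡ ⟦ b ℕ.≟ a ⟧
≟-sym a b = ⟦⟧-cong (a ℕ.≟ b) (b ℕ.≟ a) sym sym

∑-select : ∀ {M a} → a < M → ∀ f → ∑ M (λ x → ⟦ a ℕ.≟ x ⟧ * f x) ≡ f a
∑-select {suc M} {zero}  _ f = begin
  1ℚ * f 0 + ∑ M (λ x → ⟦ 0 ℕ.≟ suc x ⟧ * f (suc x))     ≡⟨ cong₂ _+_ (ℚ.*-identityˡ (f 0)) (∑-cong M (λ x → ℚ.*-zeroˡ (f (suc x)))) ⟩
  f 0 + ∑ M (λ _ → 0ℚ)                                   ≡⟨ cong (f 0 +_) (trans (∑-const M 0ℚ) (ℚ.*-zeroʳ (fromℕ M))) ⟩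
  f 0 + 0ℚ                                               ≡⟨ ℚ.+-identityʳ (f 0) ⟩
  f 0                                                    ∎
  where open ≡-Reasoning
∑-select {suc M} {suc a} (s≤s a<M) f = begin
  0ℚ * f 0 + ∑ M (λ x → ⟦ suc a ℕ.≟ suc x ⟧ * f (suc x)) ≡⟨ cong₂ _+_ (ℚ.*-zeroˡ (f 0)) (∑-cong M (λ x → cong (_* f (suc x)) (⟦⟧-cong (suc a ℕ.≟ suc x) (a ℕ.≟ x) ℕ.suc-injective (cong suc)))) ⟩
  0ℚ + ∑ M (λ x → ⟦ a ℕ.≟ x ⟧ * f (suc x))               ≡⟨ ℚ.+-identityˡ _ ⟩
  ∑ M (λ x → ⟦ a ℕ.≟ x ⟧ * f (suc x))                    ≡⟨ ∑-select a<M (λ x → f (suc x)) ⟩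
  f (suc a)                                              ∎
  where open ≡-Reasoning

∑-product : ∀ m n f g → ∑ m f * ∑ n g ≡ ∑ m (λ i → ∑ n (λ j → f i * g j))
∑-product m n f g = begin
  ∑ m f * ∑ n g                          ≡⟨ ℚ.*-comm (∑ m f) (∑ n g) ⟩
  ∑ n g * ∑ m f                          ≡⟨ ∑-* m (∑ n g) f ⟨
  ∑ m (λ i → ∑ n g * f i)                ≡⟨ ∑-cong m (λ i → trans (ℚ.*-comm (∑ n g) (f i)) (sym (∑-* n (f i) g))) ⟩
  ∑ m (λ i → ∑ n (λ j → f i * g j))      ∎
  where open ≡-Reasoning

-- For fixed h each distance occurs at most twice, once on either side of h.
∑-distance : ∀ {U} → (∀ ℓ → 0ℚ ℚ.≤ U ℓ) → ∀ h n → ∑ n (λ j → U ℕ.∣ h - j ∣) ℚ.≤ ∑ (suc h) U + ∑ n U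
∑-distance {U} 0≤U h zero = +-nonneg (∑-nonneg (suc h) 0≤U) ℚ.≤-refl
∑-distance {U} 0≤U zero (suc n) = ≤-by (∑ 1 U) (∑-nonneg 1 0≤U) (ℚ.+-comm (∑ 1 U) (∑ (suc n) U))
∑-distance {U} 0≤U (suc h) (suc n) = begin
  U (suc h) + ∑ n (λ j → U ℕ.∣ h - j ∣)         ≤⟨ ℚ.+-monoʳ-≤ (U (suc h)) (∑-distance {U} 0≤U h n) ⟩
  U (suc h) + (∑ (suc h) U + ∑ n U)             ≡⟨ regroup (U (suc h)) (∑ (suc h) U) (∑ n U) ⟩
  ∑ (suc h) U + U (suc h) + ∑ n U               ≡⟨ cong (_+ ∑ n U) (∑-last (suc h) U) ⟨
  ∑ (suc (suc h)) U + ∑ n U                     ≤⟨ ℚ.+-monoʳ-≤ (∑ (suc (suc h)) U) (∑-mono-len 0≤U (ℕ.n≤1+n n)) ⟩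
  ∑ (suc (suc h)) U + ∑ (suc n) U               ∎
  where
  open ℚ.≤-Reasoning
  regroup : ∀ a b c → a + (b + c) ≡ b + a + c
  regroup = solve-∀ ℚ-ring

-- Both windows are parts of [0, N + h) and differ only in h terms at each end.
∑-translate : ∀ N h f → ∑ N (λ n → f (n ℕ.+ h)) ≡ ∑ N f + ∑ h (λ n → f (N ℕ.+ n) - f n)
∑-translate N h f = begin
  ∑ N (λ n → f (n ℕ.+ h))                                       ≡⟨ ∑-cong N (λ n → cong f (ℕ.+-comm n h)) ⟩
  A                                                             ≡⟨ add (∑ h f) A ⟩
  (∑ h f + A) - ∑ h f                                           ≡⟨ cong (_- ∑ h f) (∑-split h N f) ⟨
  ∑ (h ℕ.+ N) f - ∑ h f                                         ≡⟨ cong (λ x → ∑ x f - ∑ h f) (ℕ.+-comm h N) ⟩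
  ∑ (N ℕ.+ h) f - ∑ h f                                         ≡⟨ cong (_- ∑ h f) (∑-split N h f) ⟩
  ∑ N f + ∑ h (λ n → f (N ℕ.+ n)) - ∑ h f                       ≡⟨ assoc (∑ N f) (∑ h (λ n → f (N ℕ.+ n))) (∑ h f) ⟩
  ∑ N f + (∑ h (λ n → f (N ℕ.+ n)) + - 1ℚ * ∑ h f)              ≡⟨ cong (λ x → ∑ N f + (∑ h (λ n → f (N ℕ.+ n)) + x)) (∑-* h (- 1ℚ) f) ⟨
  ∑ N f + (∑ h (λ n → f (N ℕ.+ n)) + ∑ h (λ n → - 1ℚ * f n))    ≡⟨ cong (∑ N f +_) (∑-+ h _ _) ⟨
  ∑ N f + ∑ h (λ n → f (N ℕ.+ n) + - 1ℚ * f n)                  ≡⟨ cong (∑ N f +_) (∑-cong h (λ n → cong (f (N ℕ.+ n) +_) (neg (f n)))) ⟨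
  ∑ N f + ∑ h (λ n → f (N ℕ.+ n) - f n)                         ∎
  where
  open ≡-Reasoning
  A = ∑ N (λ n → f (h ℕ.+ n))
  add : ∀ a b → b ≡ (a + b) - a
  add = solve-∀ ℚ-ring
  assoc : ∀ a b c → a + b - c ≡ a + (b + - 1ℚ * c)
  assoc = solve-∀ ℚ-ring
  neg : ∀ a → - a ≡ - 1ℚ * a
  neg = solve-∀ ℚ-ring

²-mono : ∀ {d b} → - b ℚ.≤ d → d ℚ.≤ b → d * d ℚ.≤ b * b
²-mono {d} {b} -b≤d d≤b = ≤-by ((b - d) * (d - - b)) (*-nonneg (≤⇒0≤- d≤b) (≤⇒0≤- -b≤d)) (identity b d)
  where
  identity : ∀ b d → b * b ≡ d * d + (b - d) * (d - - b)
  identity = solve-∀ ℚ-ring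

-- The sequence continues beyond N, so moving the window costs boundary terms, collected in `drift`.
-- U holds the errors of one-sided correlation bounds.
module VanDerCorput (c : ℕ → ℕ) {M : ℕ} (1≤M : 1 ≤ M) (c<M : ∀ n → c n < M) (N H : ℕ)
                    (U : ℕ → ℚ) (0≤U : ∀ ℓ → 0ℚ ℚ.≤ U ℓ)
                    (correlation : ∀ ℓ → ℓ < H → ∑ N (λ n → ⟦ c (n ℕ.+ ℓ) ℕ.≟ c n ⟧) ℚ.≤ fromℕ N * (1 ÷ M) + U ℓ)
                    {x : ℕ} (x<M : x < M) where

  ν η : ℚ
  ν = 1 ÷ M
  η = fromℕ H

  u : ℕ → ℕ → ℚ
  u z n = ⟦ c n ℕ.≟ z ⟧ - ν

  S : ℚ
  S = ∑ N (u x)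

  V : ℚ
  V = ∑ N (λ n → ∑ H (λ h → u x (n ℕ.+ h)))

  drift : ℕ → ℚ
  drift h = ∑ h (λ n → u x (N ℕ.+ n) - u x n)

  private
    cancel-ν : ∀ a b ν → (a - ν) - (b - ν) ≡ a - b
    cancel-ν = solve-∀ ℚ-ring

    ⟦⟧-diff-≤1 : ∀ {A B : Set} (a : Dec A) (b : Dec B) → ⟦ a ⟧ - ⟦ b ⟧ ℚ.≤ 1ℚ
    ⟦⟧-diff-≤1 a b = ≤-by ((1ℚ - ⟦ a ⟧) + ⟦ b ⟧) (+-nonneg (≤⇒0≤- (⟦⟧-≤1 a)) (⟦⟧-nonneg b)) (identity ⟦ a ⟧ ⟦ b ⟧)
      where
      identity : ∀ a b → 1ℚ ≡ (a - b) + ((1ℚ - a) + b)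
      identity = solve-∀ ℚ-ring

    -1≤⟦⟧-diff : ∀ {A B : Set} (a : Dec A) (b : Dec B) → - 1ℚ ℚ.≤ ⟦ a ⟧ - ⟦ b ⟧
    -1≤⟦⟧-diff a b = ≤-by ((1ℚ - ⟦ b ⟧) + ⟦ a ⟧) (+-nonneg (≤⇒0≤- (⟦⟧-≤1 b)) (⟦⟧-nonneg a)) (identity ⟦ a ⟧ ⟦ b ⟧)
      where
      identity : ∀ a b → a - b ≡ - 1ℚ + ((1ℚ - b) + a)
      identity = solve-∀ ℚ-ring

  drift-≤ : ∀ h → drift h ℚ.≤ fromℕ h
  drift-≤ h = ℚ.≤-trans (∑-mono h (λ n → ℚ.≤-trans (ℚ.≤-reflexive (cancel-ν ⟦ c (N ℕ.+ n) ℕ.≟ x ⟧ ⟦ c n ℕ.≟ x ⟧ ν)) (⟦⟧-diff-≤1 (c (N ℕ.+ n) ℕ.≟ x) (c n ℕ.≟ x))))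
    (ℚ.≤-reflexive (trans (∑-const h 1ℚ) (ℚ.*-identityʳ (fromℕ h))))

  -≤drift : ∀ h → - fromℕ h ℚ.≤ drift h
  -≤drift h = ℚ.≤-trans (ℚ.≤-reflexive (trans (trans (cong -_ (sym (ℚ.*-identityʳ (fromℕ h)))) (ℚ.neg-distribʳ-* (fromℕ h) 1ℚ)) (sym (∑-const h (- 1ℚ)))))
    (∑-mono h (λ n → ℚ.≤-trans (-1≤⟦⟧-diff (c (N ℕ.+ n) ℕ.≟ x) (c n ℕ.≟ x)) (ℚ.≤-reflexive (sym (cancel-ν ⟦ c (N ℕ.+ n) ℕ.≟ x ⟧ ⟦ c n ℕ.≟ x ⟧ ν)))))

  V≡ : V ≡ η * S + ∑ H drift
  V≡ = begin
    ∑ N (λ n → ∑ H (λ h → u x (n ℕ.+ h)))   ≡⟨ ∑-swap N H (λ n h → u x (n ℕ.+ h)) ⟩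
    ∑ H (λ h → ∑ N (λ n → u x (n ℕ.+ h)))   ≡⟨ ∑-cong H (λ h → ∑-translate N h (u x)) ⟩
    ∑ H (λ h → S + drift h)                 ≡⟨ ∑-+ H (λ _ → S) drift ⟩
    ∑ H (λ _ → S) + ∑ H drift               ≡⟨ cong (_+ ∑ H drift) (∑-const H S) ⟩
    η * S + ∑ H drift                       ∎
    where open ≡-Reasoning

  ∑-drift² : ∑ H drift * ∑ H drift ℚ.≤ η * η * (η * η)
  ∑-drift² = ²-mono {∑ H drift} {η * η}
    (begin
      - (η * η)                  ≡⟨ ℚ.neg-distribʳ-* η η ⟩
      η * (- η)                  ≡⟨ ∑-const H (- η) ⟨
      ∑ H (λ _ → - η)            ≤⟨ ∑-mono< H (λ h h<H → ℚ.≤-trans (ℚ.neg-antimono-≤ (fromℕ-mono (ℕ.<⇒≤ h<H))) (-≤drift h)) ⟩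
      ∑ H drift                  ∎)
    (begin
      ∑ H drift                  ≤⟨ ∑-mono< H (λ h h<H → ℚ.≤-trans (drift-≤ h) (fromℕ-mono (ℕ.<⇒≤ h<H))) ⟩
      ∑ H (λ _ → η)              ≡⟨ ∑-const H η ⟩
      η * η                      ∎)
    where open ℚ.≤-Reasoning

  -- Orthogonality over all residues, playing the part of a sum over characters: products of centred
  -- indicators add up to the centred indicator of coincidence.
  ∑-u*u : ∀ a b → ∑ M (λ z → u z a * u z b) ≡ ⟦ c a ℕ.≟ c b ⟧ - ν
  ∑-u*u a b = begin
    ∑ M (λ z → u z a * u z b)                                                       ≡⟨ ∑-cong M (λ z → expand ⟦ c a ℕ.≟ z ⟧ ⟦ c b ℕ.≟ z ⟧ ν) ⟩
    ∑ M (λ z → ⟦ c a ℕ.≟ z ⟧ * (⟦ c b ℕ.≟ z ⟧ - ν) + (⟦ c b ℕ.≟ z ⟧ * (- ν) + ν * ν))  ≡⟨ trans (∑-+ M (λ z → ⟦ c a ℕ.≟ z ⟧ * (⟦ c b ℕ.≟ z ⟧ - ν)) (λ z → ⟦ c b ℕ.≟ z ⟧ * (- ν) + ν * ν)) (cong (∑ M (λ z → ⟦ c a ℕ.≟ z ⟧ * (⟦ c b ℕ.≟ z ⟧ - ν)) +_) (∑-+ M (λ z → ⟦ c b ℕ.≟ z ⟧ * (- ν)) (λ _ → ν * ν))) ⟩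
    ∑ M (λ z → ⟦ c a ℕ.≟ z ⟧ * (⟦ c b ℕ.≟ z ⟧ - ν)) + (∑ M (λ z → ⟦ c b ℕ.≟ z ⟧ * (- ν)) + ∑ M (λ _ → ν * ν))
      ≡⟨ cong₂ _+_ (∑-select (c<M a) (λ z → ⟦ c b ℕ.≟ z ⟧ - ν)) (cong₂ _+_ (∑-select (c<M b) (λ _ → - ν)) (∑-const M (ν * ν))) ⟩
    (⟦ c b ℕ.≟ c a ⟧ - ν) + (- ν + fromℕ M * (ν * ν))                                ≡⟨ regroup ⟦ c b ℕ.≟ c a ⟧ ν (fromℕ M) ⟩
    ⟦ c b ℕ.≟ c a ⟧ - ν + ν * (fromℕ M * ν - 1ℚ)                                     ≡⟨ cong₂ (λ y z → y - ν + ν * (z - 1ℚ)) (≟-sym (c b) (c a)) (fromℕ*1÷ 1≤M) ⟩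
    ⟦ c a ℕ.≟ c b ⟧ - ν + ν * (1ℚ - 1ℚ)                                              ≡⟨ trans (cong (⟦ c a ℕ.≟ c b ⟧ - ν +_) (ℚ.*-zeroʳ ν)) (ℚ.+-identityʳ _) ⟩
    ⟦ c a ℕ.≟ c b ⟧ - ν                                                             ∎
    where
    open ≡-Reasoning
    expand : ∀ a b ν → (a - ν) * (b - ν) ≡ a * (b - ν) + (b * (- ν) + ν * ν)
    expand = solve-∀ ℚ-ring
    regroup : ∀ d ν M → (d - ν) + (- ν + M * (ν * ν)) ≡ d - ν + ν * (M * ν - 1ℚ)
    regroup = solve-∀ ℚ-ring

  T : ℕ → ℕ → ℚ
  T h h′ = ∑ N (λ n → ⟦ c (n ℕ.+ h) ℕ.≟ c (n ℕ.+ h′) ⟧)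

  T-sym : ∀ h h′ → T h h′ ≡ T h′ h
  T-sym h h′ = ∑-cong N (λ n → ≟-sym (c (n ℕ.+ h)) (c (n ℕ.+ h′)))

  -- Translating the window by h turns the pair into (n + ℓ, n), at a boundary cost of at most h <
  -- H.
  T-≤ : ∀ {h h′} → h ≤ h′ → h′ < H → T h h′ ℚ.≤ fromℕ N * ν + (U (h′ ℕ.∸ h) + η)
  T-≤ {h} {h′} h≤h′ h′<H = begin
    T h h′                                                           ≡⟨ ∑-cong N (λ n → trans (≟-sym (c (n ℕ.+ h)) (c (n ℕ.+ h′))) (cong (λ y → ⟦ c y ℕ.≟ c (n ℕ.+ h) ⟧) (n+h′≡ n))) ⟩
    ∑ N (λ n → g (n ℕ.+ h))                                          ≡⟨ ∑-translate N h g ⟩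
    ∑ N g + ∑ h (λ n → g (N ℕ.+ n) - g n)                            ≤⟨ ℚ.+-mono-≤ (correlation ℓ (ℕ.≤-<-trans (ℕ.m∸n≤m h′ h) h′<H)) (ℚ.≤-trans (∑-mono h (λ n → ⟦⟧-diff-≤1 (c (N ℕ.+ n ℕ.+ ℓ) ℕ.≟ c (N ℕ.+ n)) (c (n ℕ.+ ℓ) ℕ.≟ c n))) (ℚ.≤-reflexive (trans (∑-const h 1ℚ) (ℚ.*-identityʳ (fromℕ h))))) ⟩
    fromℕ N * ν + U ℓ + fromℕ h                                      ≤⟨ ℚ.+-monoʳ-≤ (fromℕ N * ν + U ℓ) (fromℕ-mono (ℕ.<⇒≤ (ℕ.≤-<-trans h≤h′ h′<H))) ⟩
    fromℕ N * ν + U ℓ + η                                            ≡⟨ ℚ.+-assoc (fromℕ N * ν) (U ℓ) η ⟩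
    fromℕ N * ν + (U ℓ + η)                                          ∎
    where
    open ℚ.≤-Reasoning
    ℓ = h′ ℕ.∸ h
    g = λ n → ⟦ c (n ℕ.+ ℓ) ℕ.≟ c n ⟧
    n+h′≡ : ∀ n → n ℕ.+ h′ ≡ n ℕ.+ h ℕ.+ ℓ
    n+h′≡ n = trans (cong (n ℕ.+_) (sym (ℕ.m+[n∸m]≡n h≤h′))) (sym (ℕ.+-assoc n h ℓ))

  T-distance : ∀ {h h′} → h < H → h′ < H → T h h′ ℚ.≤ fromℕ N * ν + (U ℕ.∣ h - h′ ∣ + η)
  T-distance {h} {h′} h<H h′<H with ℕ.≤-total h h′
  ... | inj₁ h≤h′ = subst (λ ℓ → T h h′ ℚ.≤ fromℕ N * ν + (U ℓ + η)) (sym (ℕ.m≤n⇒∣m-n∣≡n∸m h≤h′)) (T-≤ h≤h′ h′<H)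
  ... | inj₂ h′≤h = subst₂ (λ y ℓ → y ℚ.≤ fromℕ N * ν + (U ℓ + η)) (T-sym h′ h) (sym (ℕ.m≤n⇒∣n-m∣≡n∸m h′≤h)) (T-≤ h′≤h h<H)

  A : ℚ
  A = ∑ H U

  -- By positivity the residue x may be replaced by the sum over all residues, where orthogonality
  -- turns squares into centred pair counts. Distances between shifts occur at most twice, whence A
  -- + A.
  ∑-W² : ∑ N (λ n → ∑ H (λ h → u x (n ℕ.+ h)) * ∑ H (λ h → u x (n ℕ.+ h))) ℚ.≤ η * (A + A + η * η)
  ∑-W² = begin
    ∑ N (λ n → W x n * W x n)                                                             ≤⟨ ∑-mono N (λ n → ∑-term< M x {λ z → W z n * W z n} (λ z _ → ²-nonneg (W z n)) x<M) ⟩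
    ∑ N (λ n → ∑ M (λ z → W z n * W z n))                                                 ≡⟨ ∑-cong N spectral ⟩
    ∑ N (λ n → ∑ H (λ h → ∑ H (λ h′ → ⟦ c (n ℕ.+ h) ℕ.≟ c (n ℕ.+ h′) ⟧ - ν)))             ≡⟨ trans (∑-swap N H _) (∑-cong H (λ h → ∑-swap N H _)) ⟩
    ∑ H (λ h → ∑ H (λ h′ → ∑ N (λ n → ⟦ c (n ℕ.+ h) ℕ.≟ c (n ℕ.+ h′) ⟧ - ν)))             ≤⟨ ∑-mono< H (λ h h<H → ∑-mono< H (λ h′ h′<H → pair h<H h′<H)) ⟩
    ∑ H (λ h → ∑ H (λ h′ → U ℕ.∣ h - h′ ∣ + η))                                           ≡⟨ ∑-cong H (λ h → trans (∑-+ H _ _) (cong (∑ H (λ h′ → U ℕ.∣ h - h′ ∣) +_) (∑-const H η))) ⟩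
    ∑ H (λ h → ∑ H (λ h′ → U ℕ.∣ h - h′ ∣) + η * η)                                       ≤⟨ ∑-mono< H (λ h h<H → ℚ.+-monoˡ-≤ (η * η) (ℚ.≤-trans (∑-distance {U} 0≤U h H) (ℚ.+-monoˡ-≤ A (∑-mono-len 0≤U h<H)))) ⟩
    ∑ H (λ _ → A + A + η * η)                                                             ≡⟨ ∑-const H (A + A + η * η) ⟩
    η * (A + A + η * η)                                                                   ∎
    where
    open ℚ.≤-Reasoning
    W : ℕ → ℕ → ℚ
    W z n = ∑ H (λ h → u z (n ℕ.+ h))
    spectral : ∀ n → ∑ M (λ z → W z n * W z n) ≡ ∑ H (λ h → ∑ H (λ h′ → ⟦ c (n ℕ.+ h) ℕ.≟ c (n ℕ.+ h′) ⟧ - ν))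
    spectral n = trans (∑-cong M (λ z → ∑-product H H (λ h → u z (n ℕ.+ h)) (λ h → u z (n ℕ.+ h))))
      (trans (∑-swap M H (λ z h → ∑ H (λ h′ → u z (n ℕ.+ h) * u z (n ℕ.+ h′)))) (∑-cong H (λ h → trans (∑-swap M H (λ z h′ → u z (n ℕ.+ h) * u z (n ℕ.+ h′))) (∑-cong H (λ h′ → ∑-u*u (n ℕ.+ h) (n ℕ.+ h′))))))
    pair : ∀ {h h′} → h < H → h′ < H → ∑ N (λ n → ⟦ c (n ℕ.+ h) ℕ.≟ c (n ℕ.+ h′) ⟧ - ν) ℚ.≤ U ℕ.∣ h - h′ ∣ + η
    pair {h} {h′} h<H h′<H = begin
      ∑ N (λ n → ⟦ c (n ℕ.+ h) ℕ.≟ c (n ℕ.+ h′) ⟧ - ν)                 ≡⟨ trans (∑-+ N _ _) (cong (T h h′ +_) (trans (∑-const N (- ν)) (sym (ℚ.neg-distribʳ-* (fromℕ N) ν)))) ⟩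
      T h h′ - fromℕ N * ν                                             ≤⟨ ℚ.+-monoˡ-≤ (- (fromℕ N * ν)) (T-distance h<H h′<H) ⟩
      fromℕ N * ν + (U ℕ.∣ h - h′ ∣ + η) - fromℕ N * ν                 ≡⟨ cancel (fromℕ N * ν) (U ℕ.∣ h - h′ ∣ + η) ⟩
      U ℕ.∣ h - h′ ∣ + η                                               ∎
      where
      cancel : ∀ a b → a + b - a ≡ b
      cancel = solve-∀ ℚ-ring

  -- From V = ηS + D follows η²S² ≤ 2(V² + D²); Cauchy-Schwarz over n bounds V² by N times the
  -- second moment of the windows.
  van-der-corput : η * η * (S * S) ℚ.≤ (1ℚ + 1ℚ) * (fromℕ N * (η * (A + A + η * η)) + η * η * (η * η))
  van-der-corput = begin
    η * η * (S * S)                                                  ≤⟨ ≤-by ((η * S + D + D) * (η * S + D + D)) (²-nonneg (η * S + D + D)) (parallelogram η S D) ⟩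
    (1ℚ + 1ℚ) * ((η * S + D) * (η * S + D) + D * D)                  ≡⟨ cong (λ v → (1ℚ + 1ℚ) * (v * v + D * D)) V≡ ⟨
    (1ℚ + 1ℚ) * (V * V + D * D)                                      ≤⟨ *-monoˡ (1ℚ + 1ℚ) (+-nonneg 0≤1 0≤1) (ℚ.+-mono-≤ (ℚ.≤-trans (∑-cauchy N _) (*-monoˡ (fromℕ N) (fromℕ-nonneg N) ∑-W²)) ∑-drift²) ⟩
    (1ℚ + 1ℚ) * (fromℕ N * (η * (A + A + η * η)) + η * η * (η * η))  ∎
    where
    open ℚ.≤-Reasoning
    D = ∑ H drift
    parallelogram : ∀ η S D → (1ℚ + 1ℚ) * ((η * S + D) * (η * S + D) + D * D) ≡ η * η * (S * S) + (η * S + D + D) * (η * S + D + D)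
    parallelogram = solve-∀ ℚ-ring

-- Joint distribution modulo m₁, …, m_k

-- Packs the residue tuple into a single number below `∏ m`, so that van der Corput's inequality
-- applies to one integer sequence.
mixed-radix : ∀ {k} → Vector ℕ k → Vector ℕ k → ℕ
mixed-radix {zero}  m a = 0
mixed-radix {suc k} m a = a zero ℕ.+ m zero ℕ.* mixed-radix (λ i → m (suc i)) (λ i → a (suc i))

mixed-radix-< : ∀ {k} {m a : Vector ℕ k} → (∀ i → a i < m i) → mixed-radix m a < ∏ m
mixed-radix-< {zero}  a<m = z<s
mixed-radix-< {suc k} {m} {a} a<m = begin-strict
  a zero ℕ.+ m zero ℕ.* R      <⟨ ℕ.+-monoˡ-< (m zero ℕ.* R) (a<m zero) ⟩
  m zero ℕ.+ m zero ℕ.* R      ≡⟨ ℕ.*-suc (m zero) R ⟨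
  m zero ℕ.* suc R             ≤⟨ ℕ.*-monoʳ-≤ (m zero) (mixed-radix-< (λ i → a<m (suc i))) ⟩
  m zero ℕ.* ∏ (λ i → m (suc i)) ∎
  where
  open ℕ.≤-Reasoning
  R = mixed-radix (λ i → m (suc i)) (λ i → a (suc i))

mixed-radix-cong : ∀ {k} (m : Vector ℕ k) {a b : Vector ℕ k} → (∀ i → a i ≡ b i) → mixed-radix m a ≡ mixed-radix m b
mixed-radix-cong {zero}  m a≡b = refl
mixed-radix-cong {suc k} m a≡b = cong₂ (λ x y → x ℕ.+ m zero ℕ.* y) (a≡b zero) (mixed-radix-cong (λ i → m (suc i)) (λ i → a≡b (suc i)))

mixed-radix-injective : ∀ {k} {m a b : Vector ℕ k} → (∀ i → a i < m i) → (∀ i → b i < m i) → mixed-radix m a ≡ mixed-radix m b → ∀ i → a i ≡ b i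
mixed-radix-injective {suc k} {m} {a} {b} a<m b<m eq = λ { zero → head ; (suc i) → mixed-radix-injective (λ i → a<m (suc i)) (λ i → b<m (suc i)) tail i }
  where
  open ≡-Reasoning
  instance
    m₀≢0 : NonZero (m zero)
    m₀≢0 = ℕ.>-nonZero (ℕ.≤-<-trans z≤n (a<m zero))
  rest : Vector ℕ (suc k) → ℕ
  rest c = mixed-radix (λ i → m (suc i)) (λ i → c (suc i))
  digit : ∀ c → c zero < m zero → mixed-radix m c % m zero ≡ c zero
  digit c c<m = trans (cong (λ x → (c zero ℕ.+ x) % m zero) (ℕ.*-comm (m zero) (rest c))) (trans (ℕ.[m+kn]%n≡m%n (c zero) (rest c) (m zero)) (ℕ.m<n⇒m%n≡m c<m))
  head : a zero ≡ b zero
  head = trans (sym (digit a (a<m zero))) (trans (cong (_% m zero) eq) (digit b (b<m zero)))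
  tail : rest a ≡ rest b
  tail = ℕ.*-cancelˡ-≡ (rest a) (rest b) (m zero) (ℕ.+-cancelˡ-≡ (a zero) _ _ (trans eq (cong (ℕ._+ m zero ℕ.* rest b) (sym head))))

mod⇒% : ∀ {m x a} .{{_ : NonZero m}} → a < m → x ≡ a [mod m ] → x % m ≡ a
mod⇒% {m} {x} {a} a<m m∣ with ℕ.≤-total a x
... | inj₁ a≤x with subst (m ∣_) (ℕ.m≤n⇒∣n-m∣≡n∸m a≤x) m∣
...   | divides c x∸a≡cm = trans (cong (_% m) (trans (sym (ℕ.m+[n∸m]≡n a≤x)) (cong (a ℕ.+_) x∸a≡cm))) (trans (ℕ.[m+kn]%n≡m%n a c m) (ℕ.m<n⇒m%n≡m a<m))
mod⇒% {m} {x} {a} a<m m∣ | inj₂ x≤a with a ℕ.∸ x in a∸x≡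
... | zero  = trans (cong (_% m) (ℕ.≤-antisym x≤a (ℕ.m∸n≡0⇒m≤n a∸x≡))) (ℕ.m<n⇒m%n≡m a<m)
... | suc d = contradiction (subst (m ∣_) (trans (ℕ.m≤n⇒∣m-n∣≡n∸m x≤a) a∸x≡) m∣) (>⇒∤ (subst (_< m) a∸x≡ (ℕ.≤-<-trans (ℕ.m∸n≤m a x) a<m)))

%⇒mod : ∀ {m x a} .{{_ : NonZero m}} → x % m ≡ a → x ≡ a [mod m ]
%⇒mod {m} {x} {a} x%m≡a = divides (x / m) (trans (cong (λ y → ℕ.∣ y - a ∣) (trans (ℕ.m≡m%n+[m/n]*n x m) (cong (ℕ._+ x / m ℕ.* m) x%m≡a))) (trans (ℕ.∣-∣-comm (a ℕ.+ x / m ℕ.* m) a) (ℕ.∣m-m+n∣≡n a (x / m ℕ.* m))))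

-- x + (m - 1)y stands for x - y modulo m, free of truncated subtraction.
%≡%⇒∣ : ∀ {m} .{{_ : NonZero m}} x y → x % m ≡ y % m → m ∣ x ℕ.+ (m ℕ.∸ 1) ℕ.* y
%≡%⇒∣ {suc m} x y x%≡y% = divides (x / suc m ℕ.+ y % suc m ℕ.+ m ℕ.* (y / suc m)) (begin
  x ℕ.+ m ℕ.* y                                                                  ≡⟨ cong₂ (λ u v → u ℕ.+ m ℕ.* v) (trans (ℕ.m≡m%n+[m/n]*n x (suc m)) (cong (ℕ._+ x / suc m ℕ.* suc m) x%≡y%)) (ℕ.m≡m%n+[m/n]*n y (suc m)) ⟩
  y % suc m ℕ.+ x / suc m ℕ.* suc m ℕ.+ m ℕ.* (y % suc m ℕ.+ y / suc m ℕ.* suc m)  ≡⟨ regroup m (y % suc m) (x / suc m) (y / suc m) ⟩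
  (x / suc m ℕ.+ y % suc m ℕ.+ m ℕ.* (y / suc m)) ℕ.* suc m                      ∎)
  where
  open ≡-Reasoning
  regroup : ∀ m r a b → r ℕ.+ a ℕ.* suc m ℕ.+ m ℕ.* (r ℕ.+ b ℕ.* suc m) ≡ (a ℕ.+ r ℕ.+ m ℕ.* b) ℕ.* suc m
  regroup = ℕ-solve-∀

length-filter : ∀ {P : ℕ → Set} (P? : ∀ n → Dec (P n)) (f : ℕ → ℕ) N → fromℕ (length (filter P? (applyUpTo f N))) ≡ ∑ N (λ n → ⟦ P? (f n) ⟧)
length-filter P? f zero = refl
length-filter P? f (suc N) with P? (f 0)
... | yes _ = trans (fromℕ-+ 1 (length (filter P? (applyUpTo (λ n → f (suc n)) N)))) (cong (1ℚ +_) (length-filter P? (λ n → f (suc n)) N))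
... | no  _ = trans (length-filter P? (λ n → f (suc n)) N) (sym (ℚ.+-identityˡ _))

coprime-^ : ∀ {a b} n → Coprime a b → Coprime a (b ^ℕ n)
coprime-^ zero    a⊥b (_ , d∣1) = ∣1⇒≡1 d∣1
coprime-^ (suc n) a⊥b = coprime-* a⊥b (coprime-^ n a⊥b)

primes-coprime : ∀ {p p′} → Prime p → Prime p′ → p ≢ p′ → Coprime p p′
primes-coprime {p} {p′} pr pr′ p≢p′ {d} (d∣p , d∣p′) with prime⇒irreducible pr d∣p
... | inj₁ d≡1 = d≡1
... | inj₂ d≡p with prime⇒irreducible pr′ d∣p′
...   | inj₁ d≡1  = d≡1
...   | inj₂ d≡p′ = contradiction (trans (sym d≡p) d≡p′) p≢p′

⟦⟧-≤-∏ : ∀ {k} {A : Set} {B : Fin k → Set} (d : Dec A) (d′ : ∀ i → Dec (B i)) → (A → ∀ i → B i) → ⟦ d ⟧ ℚ.≤ ∏ℚ (λ i → ⟦ d′ i ⟧)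
⟦⟧-≤-∏ (no _)  d′ A→B = ∏ℚ-nonneg (λ i → ⟦⟧-nonneg (d′ i))
⟦⟧-≤-∏ (yes a) d′ A→B = ℚ.≤-reflexive (sym (all-yes d′ (A→B a)))
  where
  all-yes : ∀ {k} {B : Fin k → Set} (d′ : ∀ i → Dec (B i)) → (∀ i → B i) → ∏ℚ (λ i → ⟦ d′ i ⟧) ≡ 1ℚ
  all-yes {zero}  d′ b = refl
  all-yes {suc k} d′ b = trans (cong₂ _*_ (⟦⟧-yes (d′ zero) (b zero)) (all-yes (λ i → d′ (suc i)) (λ i → b (suc i)))) (ℚ.*-identityˡ 1ℚ)

∑ℚ-≤ : ∀ {k c} {x : Vector ℚ k} → (∀ i → x i ℚ.≤ c) → ∑ℚ x ℚ.≤ fromℕ k * c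
∑ℚ-≤ {zero}  {c} x≤c = ℚ.≤-reflexive (sym (ℚ.*-zeroˡ c))
∑ℚ-≤ {suc k} {c} {x} x≤c = begin
  x zero + ∑ℚ (λ i → x (suc i))     ≤⟨ ℚ.+-mono-≤ (x≤c zero) (∑ℚ-≤ (λ i → x≤c (suc i))) ⟩
  c + fromℕ k * c                   ≡⟨ factor c (fromℕ k) ⟩
  (1ℚ + fromℕ k) * c                ≡⟨ cong (_* c) (fromℕ-+ 1 k) ⟨
  fromℕ (suc k) * c                 ∎
  where
  open ℚ.≤-Reasoning
  factor : ∀ c k → c + k * c ≡ (1ℚ + k) * c
  factor = solve-∀ ℚ-ring

∑-∑ℚ : ∀ {k} n (f : Fin k → ℕ → ℚ) → ∑ n (λ j → ∑ℚ (λ i → f i j)) ≡ ∑ℚ (λ i → ∑ n (f i))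
∑-∑ℚ {zero}  n f = trans (∑-const n 0ℚ) (ℚ.*-zeroʳ (fromℕ n))
∑-∑ℚ {suc k} n f = trans (∑-+ n (f zero) _) (cong (∑ n (f zero) +_) (∑-∑ℚ n (λ i → f (suc i))))

module Residues {k : ℕ} (p : Vector ℕ k) (m : Vector ℕ k) (1≤m : ∀ i → 1 ≤ m i) where

  residue : ℕ → Vector ℕ k
  residue n i = (e (p i) n % m i) {{ℕ.>-nonZero (1≤m i)}}

  residue-< : ∀ n i → residue n i < m i
  residue-< n i = ℕ.m%n<n (e (p i) n) (m i) {{ℕ.>-nonZero (1≤m i)}}

  code : ℕ → ℕ
  code n = mixed-radix m (residue n)

  code-< : ∀ n → code n < ∏ m
  code-< n = mixed-radix-< (residue-< n)

  code≡⇒∣ : ∀ n ℓ → code (n ℕ.+ ℓ) ≡ code n → ∀ i → m i ∣ e (p i) (n ℕ.+ ℓ) ℕ.+ (m i ℕ.∸ 1) ℕ.* e (p i) n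
  code≡⇒∣ n ℓ eq i = %≡%⇒∣ {{ℕ.>-nonZero (1≤m i)}} (e (p i) (n ℕ.+ ℓ)) (e (p i) n) (mixed-radix-injective (residue-< (n ℕ.+ ℓ)) (residue-< n) eq i)

  count≡ : ∀ a → (∀ i → a i < m i) → ∀ N → fromℕ (count p m a N) ≡ ∑ N (λ n → ⟦ code n ℕ.≟ mixed-radix m a ⟧)
  count≡ a a<m N = trans (length-filter _ id N) (∑-cong N (λ n → ⟦⟧-cong (all? (λ i → ≡mod? (m i) (e (p i) n) (a i))) (code n ℕ.≟ mixed-radix m a)
    (λ e≡a → mixed-radix-cong m (λ i → mod⇒% {{ℕ.>-nonZero (1≤m i)}} (a<m i) (e≡a i)))
    (λ eq i → %⇒mod {{ℕ.>-nonZero (1≤m i)}} (mixed-radix-injective (residue-< n) a<m eq i))))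

-- The hypotheses balance the errors. As ρ^r = τ², the energy term divided by τ has size τ. H is a
-- common multiple of the (p_i²)^r, so the shifts form full blocks. The s_i extra digits make
-- overshooting rare, and the joint period of the low digits stays below Nτ.
module Discrepancy {k : ℕ} {p m : Vector ℕ k} (pr : ∀ i → Prime (p i)) (p-injective : Injective _≡_ _≡_ p) (1≤m : ∀ i → 1 ≤ m i)
                   {ρ τ τ′ : ℚ} (0≤ρ : 0ℚ ℚ.≤ ρ) (1-ρ≤ : ∀ i → 1ℚ - (1 ÷ (p i ^ℕ 2)) * (1 ÷ (p i ^ℕ 2)) * ((1 ÷ m i) * (1 ÷ m i)) ℚ.≤ ρ)
                   (0≤τ : 0ℚ ℚ.≤ τ) (0≤τ′ : 0ℚ ℚ.≤ τ′) (ττ′≡1 : τ * τ′ ≡ 1ℚ)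
                   (r : ℕ) (ρ^r≡τ² : ρ ^ r ≡ τ * τ) (s J : Vector ℕ k)
                   {H N : ℕ} (1≤H : 1 ≤ H) (H≡ : ∀ i → H ≡ J i ℕ.* (p i ^ℕ 2) ^ℕ r)
                   (H≤Qτ : ∀ i → fromℕ H ℚ.≤ fromℕ ((p i ^ℕ 2) ^ℕ (r ℕ.+ s i)) * τ)
                   (∏Q≤Nτ : fromℕ (∏ (λ i → (p i ^ℕ 2) ^ℕ (r ℕ.+ s i))) ℚ.≤ fromℕ N * τ)
                   (H≤Nτ : fromℕ H ℚ.≤ fromℕ N * τ) (H²≤N²τ : fromℕ H * fromℕ H ℚ.≤ fromℕ N * fromℕ N * τ) where

  open Residues p m 1≤m

  t Q : Vector ℕ k
  t i = r ℕ.+ s i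
  Q i = (p i ^ℕ 2) ^ℕ t i

  M W : ℕ
  M = ∏ m
  W = ∏ Q

  private
    module T (i : Fin k) = Truncation (pr i) (1≤m i) (t i)
    module C (i : Fin k) = Correlation (pr i) (1≤m i)

  1≤Q : ∀ i → 1 ≤ Q i
  1≤Q = T.1≤Q

  Q-coprime : ∀ i j → i ≢ j → Coprime (Q i) (Q j)
  Q-coprime i j i≢j = coprime-^ (t j) (coprime-^ 2 (Coprime-sym (coprime-^ (t i) (coprime-^ 2
    (Coprime-sym (primes-coprime (pr i) (pr j) (λ pi≡pj → i≢j (p-injective pi≡pj))))))))

  ε : Fin k → ℕ → ℚ
  ε i ℓ = ℚ.½ * τ + ℚ.½ * (τ′ * C.En i 0 (t i) ℓ) + fromℕ H * (1 ÷ Q i)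

  ε-nonneg : ∀ i ℓ → 0ℚ ℚ.≤ ε i ℓ
  ε-nonneg i ℓ = +-nonneg (+-nonneg (*-nonneg 0≤½ 0≤τ) (*-nonneg 0≤½ (*-nonneg 0≤τ′ (C.En-nonneg i 0 (t i) ℓ)))) (*-nonneg (fromℕ-nonneg H) (1÷-nonneg (Q i)))

  U : ℕ → ℚ
  U ℓ = fromℕ N * ∑ℚ (λ i → ε i ℓ) + fromℕ W

  U-nonneg : ∀ ℓ → 0ℚ ℚ.≤ U ℓ
  U-nonneg ℓ = +-nonneg (*-nonneg (fromℕ-nonneg N) (∑ℚ-nonneg (λ i → ε-nonneg i ℓ))) (fromℕ-nonneg W)

  -- Equal codes pass the local test at every prime; the tests are independent, and test i has mean
  -- at most 1/m_i + ε_i. Completing N to full periods adds W.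
  correlation : ∀ ℓ → ℓ < H → ∑ N (λ n → ⟦ code (n ℕ.+ ℓ) ℕ.≟ code n ⟧) ℚ.≤ fromℕ N * (1 ÷ M) + U ℓ
  correlation ℓ ℓ<H = begin
    ∑ N (λ n → ⟦ code (n ℕ.+ ℓ) ℕ.≟ code n ⟧)        ≤⟨ ∑-mono N (λ n → ⟦⟧-≤-∏ (code (n ℕ.+ ℓ) ℕ.≟ code n) (λ i → T.good? i ℓ ((n % Q i) {{Q≢0 i}})) (λ eq i → T.shift⇒good i ℓ n (subst (m i ∣_) (sym (T.shift-0 i ℓ n)) (code≡⇒∣ n ℓ eq i)))) ⟩
    ∑ N G                                            ≤⟨ ∑-periodic-≤ {W} {G} (∏-pos 1≤Q) (∏ℚ-periodic {k} {Q} {λ i → T.local i ℓ} (λ i → T.local-periodic i ℓ)) (λ n → ∏ℚ-nonneg (λ i → ⟦⟧-nonneg (T.good? i ℓ ((n % Q i) {{Q≢0 i}})))) N ⟩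
    (fromℕ N + fromℕ W) * mean W G                   ≡⟨ cong ((fromℕ N + fromℕ W) *_) (mean-∏ {k} {Q} {λ i → T.local i ℓ} 1≤Q Q-coprime (λ i → T.local-periodic i ℓ)) ⟩
    (fromℕ N + fromℕ W) * Π                          ≡⟨ ℚ.*-distribʳ-+ Π (fromℕ N) (fromℕ W) ⟩
    fromℕ N * Π + fromℕ W * Π                        ≤⟨ ℚ.+-mono-≤ (*-monoˡ (fromℕ N) (fromℕ-nonneg N) Π≤) (ℚ.≤-trans (*-monoˡ (fromℕ W) (fromℕ-nonneg W) Π≤1) (ℚ.≤-reflexive (ℚ.*-identityʳ (fromℕ W)))) ⟩
    fromℕ N * ((1 ÷ M) + ∑ℚ (λ i → ε i ℓ)) + fromℕ W ≡⟨ regroup (fromℕ N) (1 ÷ M) (∑ℚ (λ i → ε i ℓ)) (fromℕ W) ⟩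
    fromℕ N * (1 ÷ M) + U ℓ                          ∎
    where
    open ℚ.≤-Reasoning
    Q≢0 : ∀ i → NonZero (Q i)
    Q≢0 i = ℕ.>-nonZero (1≤Q i)
    G : ℕ → ℚ
    G n = ∏ℚ (λ i → T.local i ℓ n)
    Π = ∏ℚ (λ i → mean (Q i) (T.local i ℓ))
    Π≤1 : Π ℚ.≤ 1ℚ
    Π≤1 = ∏ℚ-≤1 (λ i → T.mean-local-nonneg i ℓ) (λ i → T.mean-local-≤1 i ℓ)
    Π≤ : Π ℚ.≤ (1 ÷ M) + ∑ℚ (λ i → ε i ℓ)
    Π≤ = ℚ.≤-trans (∏ℚ-perturb {k} {_} {λ i → 1 ÷ m i} {λ i → ε i ℓ} (λ i → T.mean-local-nonneg i ℓ) (λ i → T.mean-local-≤1 i ℓ) (λ i → 1÷-nonneg (m i)) (λ i → 1÷-≤1 (m i)) (λ i → ε-nonneg i ℓ) (λ i → T.mean-local i {τ} {τ′} 0≤τ′ ττ′≡1 (ℕ.<⇒≤ ℓ<H)))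
           (ℚ.≤-reflexive (cong (_+ ∑ℚ (λ i → ε i ℓ)) (∏-1÷ 1≤m)))
    regroup : ∀ n a b w → n * (a + b) + w ≡ n * a + (n * b + w)
    regroup = solve-∀ ℚ-ring

  η ν : ℚ
  η = fromℕ H
  ν = fromℕ N

  -- The energy is small only on average over shifts, so the errors are summed over ℓ < H. The three
  -- parts give at most ητ/2, ητ/2 and ητ.
  ∑-ε : ∀ i → ∑ H (ε i) ℚ.≤ η * (τ + τ)
  ∑-ε i = begin
    ∑ H (ε i)                                                                         ≡⟨ trans (∑-+ H _ _) (cong₂ _+_ (trans (∑-+ H _ _) (cong₂ _+_ (∑-const H (ℚ.½ * τ)) (trans (∑-* H ℚ.½ _) (cong (ℚ.½ *_) (∑-* H τ′ _))))) (∑-const H (η * (1 ÷ Q i)))) ⟩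
    η * (ℚ.½ * τ) + ℚ.½ * (τ′ * ∑ H (C.En i 0 (t i))) + η * (η * (1 ÷ Q i))           ≤⟨ ℚ.+-mono-≤ (ℚ.+-monoʳ-≤ (η * (ℚ.½ * τ)) (*-monoˡ ℚ.½ 0≤½ (*-monoˡ τ′ 0≤τ′ decay))) (*-monoˡ η (fromℕ-nonneg H) H/Q≤τ) ⟩
    η * (ℚ.½ * τ) + ℚ.½ * (τ′ * (η * (τ * τ))) + η * τ                                ≡⟨ regroup η τ τ′ ⟩
    η * (ℚ.½ * τ) + ℚ.½ * (η * τ * (τ * τ′)) + η * τ                                  ≡⟨ cong (λ x → η * (ℚ.½ * τ) + ℚ.½ * (η * τ * x) + η * τ) ττ′≡1 ⟩
    η * (ℚ.½ * τ) + ℚ.½ * (η * τ * 1ℚ) + η * τ                                        ≡⟨ collect η τ ⟩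
    η * (τ + τ)                                                                       ∎
    where
    open ℚ.≤-Reasoning
    regroup : ∀ η τ τ′ → η * (ℚ.½ * τ) + ℚ.½ * (τ′ * (η * (τ * τ))) + η * τ ≡ η * (ℚ.½ * τ) + ℚ.½ * (η * τ * (τ * τ′)) + η * τ
    regroup = solve-∀ ℚ-ring
    collect : ∀ η τ → η * (ℚ.½ * τ) + ℚ.½ * (η * τ * 1ℚ) + η * τ ≡ η * (τ + τ)
    collect = solve-∀ ℚ-ring
    qi = p i ^ℕ 2
    decay : ∑ H (C.En i 0 (t i)) ℚ.≤ η * (τ * τ)
    decay = begin
      ∑ H (C.En i 0 (t i))                          ≡⟨ cong (λ n → ∑ n (C.En i 0 (t i))) (H≡ i) ⟩
      -- Only r of the r + s_i digits contribute decay.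
      ∑ (J i ℕ.* qi ^ℕ r) (C.En i 0 (t i))          ≤⟨ BlockDecay.energy-decay (pr i) (1≤m i) 0≤ρ (1-ρ≤ i) (J i) r 0 (s i) ⟩
      fromℕ (J i) * (fromℕ qi * ρ) ^ r              ≡⟨ cong (fromℕ (J i) *_) (trans (^-distrib-* (fromℕ qi) ρ r) (cong₂ _*_ (sym (fromℕ-^ qi r)) ρ^r≡τ²)) ⟩
      fromℕ (J i) * (fromℕ (qi ^ℕ r) * (τ * τ))     ≡⟨ ℚ.*-assoc (fromℕ (J i)) (fromℕ (qi ^ℕ r)) (τ * τ) ⟨
      fromℕ (J i) * fromℕ (qi ^ℕ r) * (τ * τ)       ≡⟨ cong (_* (τ * τ)) (trans (sym (fromℕ-* (J i) (qi ^ℕ r))) (cong fromℕ (sym (H≡ i)))) ⟩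
      η * (τ * τ)                                   ∎
    H/Q≤τ : η * (1 ÷ Q i) ℚ.≤ τ
    H/Q≤τ = begin
      η * (1 ÷ Q i)                       ≤⟨ *-monoʳ (1 ÷ Q i) (1÷-nonneg (Q i)) (H≤Qτ i) ⟩
      fromℕ (Q i) * τ * (1 ÷ Q i)         ≡⟨ swap (fromℕ (Q i)) τ (1 ÷ Q i) ⟩
      fromℕ (Q i) * (1 ÷ Q i) * τ         ≡⟨ cong (_* τ) (fromℕ*1÷ (1≤Q i)) ⟩
      1ℚ * τ                              ≡⟨ ℚ.*-identityˡ τ ⟩
      τ                                   ∎
      where
      swap : ∀ a b c → a * b * c ≡ a * c * b
      swap = solve-∀ ℚ-ring

  ∑-U : ∑ H U ℚ.≤ η * (ν * τ) * (fromℕ k + fromℕ k + 1ℚ)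
  ∑-U = begin
    ∑ H U                                                   ≡⟨ trans (∑-+ H _ _) (cong₂ _+_ (trans (∑-* H ν _) (cong (ν *_) (∑-∑ℚ H ε))) (∑-const H (fromℕ W))) ⟩
    ν * ∑ℚ (λ i → ∑ H (ε i)) + η * fromℕ W                  ≤⟨ ℚ.+-mono-≤ (*-monoˡ ν (fromℕ-nonneg N) (∑ℚ-≤ {k} {η * (τ + τ)} ∑-ε)) (*-monoˡ η (fromℕ-nonneg H) ∏Q≤Nτ) ⟩
    ν * (fromℕ k * (η * (τ + τ))) + η * (ν * τ)             ≡⟨ regroup ν (fromℕ k) η τ ⟩
    η * (ν * τ) * (fromℕ k + fromℕ k + 1ℚ)                  ∎
    where
    open ℚ.≤-Reasoning
    regroup : ∀ ν k η τ → ν * (k * (η * (τ + τ))) + η * (ν * τ) ≡ η * (ν * τ) * (k + k + 1ℚ)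
    regroup = solve-∀ ℚ-ring

  -- Van der Corput's factor 2 times 2(2k + 1) from the two sums of U and 1 from each of the two
  -- boundary terms.
  constant-factor : ℚ
  constant-factor = fromℕ 8 * (fromℕ k + 1ℚ)

  discrepancy : ∀ a → (∀ i → a i < m i) →
    let S = fromℕ (count p m a N) - N ÷ M in S * S ℚ.≤ constant-factor * (ν * ν * τ)
  discrepancy a a<m = subst (λ x → x * x ℚ.≤ constant-factor * (ν * ν * τ)) S≡ (*-cancelˡ (η * η) 0<η² (begin
    η * η * (S * S)                                                              ≤⟨ VDC.van-der-corput ⟩
    (1ℚ + 1ℚ) * (ν * (η * (A + A + η * η)) + η * η * (η * η))                    ≤⟨ *-monoˡ (1ℚ + 1ℚ) (+-nonneg 0≤1 0≤1) (ℚ.+-mono-≤ (*-monoˡ ν 0≤ν (*-monoˡ η 0≤η (ℚ.+-mono-≤ (ℚ.+-mono-≤ ∑-U ∑-U) (*-monoˡ η 0≤η H≤Nτ)))) (*-monoˡ (η * η) (*-nonneg 0≤η 0≤η) H²≤N²τ)) ⟩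
    (1ℚ + 1ℚ) * (ν * (η * (X + X + η * (ν * τ))) + η * η * (ν * ν * τ))          ≡⟨ collect ν η τ (fromℕ k) ⟩
    η * η * (eight * (fromℕ k + 1ℚ) * (ν * ν * τ))                               ∎))
    where
    open ℚ.≤-Reasoning
    module VDC = VanDerCorput code (∏-pos 1≤m) code-< N H U U-nonneg correlation (mixed-radix-< a<m)
    open VDC using (S; A)
    X = η * (ν * τ) * (fromℕ k + fromℕ k + 1ℚ)
    0≤ν : 0ℚ ℚ.≤ ν
    0≤ν = fromℕ-nonneg N
    0≤η : 0ℚ ℚ.≤ η
    0≤η = fromℕ-nonneg H
    0<η² : 0ℚ ℚ.< η * η
    0<η² = ℚ.positive⁻¹ (η * η) {{ℚ.pos*pos⇒pos η {{ℚ.positive (fromℕ-pos 1≤H)}} η {{ℚ.positive (fromℕ-pos 1≤H)}}}}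
    eight : ℚ
    eight = (1ℚ + 1ℚ) * ((1ℚ + 1ℚ) * (1ℚ + 1ℚ))
    collect : ∀ ν η τ k → (1ℚ + 1ℚ) * (ν * (η * (η * (ν * τ) * (k + k + 1ℚ) + η * (ν * τ) * (k + k + 1ℚ) + η * (ν * τ))) + η * η * (ν * ν * τ)) ≡ η * η * ((1ℚ + 1ℚ) * ((1ℚ + 1ℚ) * (1ℚ + 1ℚ)) * (k + 1ℚ) * (ν * ν * τ))
    collect = solve-∀ ℚ-ring
    S≡ : S ≡ fromℕ (count p m a N) - N ÷ M
    S≡ = begin-equality
      S                                                                             ≡⟨ ∑-+ N _ (λ _ → - (1 ÷ M)) ⟩
      ∑ N (λ n → ⟦ code n ℕ.≟ mixed-radix m a ⟧) + ∑ N (λ _ → - (1 ÷ M))            ≡⟨ cong₂ _+_ (sym (count≡ a a<m N)) (trans (∑-const N (- (1 ÷ M))) (sym (ℚ.neg-distribʳ-* ν (1 ÷ M)))) ⟩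
      fromℕ (count p m a N) - ν * (1 ÷ M)                                           ≡⟨ cong (λ x → fromℕ (count p m a N) - x) (÷-as-* N (∏-pos 1≤m)) ⟨
      fromℕ (count p m a N) - N ÷ M                                                 ∎

-- Choice of parameters

≤maximum : ∀ {k} (v : Vector ℕ k) i → v i ≤ maximum v
≤maximum v zero    = ℕ.m≤m⊔n (v zero) _
≤maximum v (suc i) = ℕ.≤-trans (≤maximum (λ i → v (suc i)) i) (ℕ.m≤n⊔m (v zero) _)

∏-≤-^ : ∀ {k c} {v : Vector ℕ k} → (∀ i → v i ≤ c) → ∏ v ≤ c ^ℕ k
∏-≤-^ {zero}  v≤c = ℕ.≤-refl
∏-≤-^ {suc k} v≤c = ℕ.*-mono-≤ (v≤c zero) (∏-≤-^ (λ i → v≤c (suc i)))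

∣∏ : ∀ {k} (v : Vector ℕ k) i → v i ∣ ∏ v
∣∏ v zero    = m∣m*n _
∣∏ v (suc i) = ∣-trans (∣∏ (λ i → v (suc i)) i) (n∣m*n (v zero))

logarithm : ∀ {b} → 2 ≤ b → ∀ n → 1 ≤ n → ∃[ r ] (b ^ℕ r ≤ n × n < b ^ℕ suc r)
logarithm {b} 2≤b (suc zero) _ = 0 , ℕ.≤-refl , subst (1 <_) (sym (ℕ.*-identityʳ b)) 2≤b
logarithm {b} 2≤b (suc n@(suc _)) _ with logarithm 2≤b n z<s
... | r , b^r≤n , n<b^ with suc n ℕ.<? b ^ℕ suc r
...   | yes 1+n<b^ = r , ℕ.≤-trans b^r≤n (ℕ.n≤1+n n) , 1+n<b^
...   | no  1+n≮b^ = suc r , ℕ.≮⇒≥ 1+n≮b^ , ℕ.≤-<-trans n<b^ (ℕ.^-monoʳ-< b 2≤b (ℕ.n<1+n (suc r)))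

^ℕ-distrib-* : ∀ n a b → (a ℕ.* b) ^ℕ n ≡ a ^ℕ n ℕ.* b ^ℕ n
^ℕ-distrib-* zero    a b = refl
^ℕ-distrib-* (suc n) a b = trans (cong (a ℕ.* b ℕ.*_) (^ℕ-distrib-* n a b)) (interchange a b (a ^ℕ n) (b ^ℕ n))
  where
  interchange : ∀ a b x y → a ℕ.* b ℕ.* (x ℕ.* y) ≡ a ℕ.* x ℕ.* (b ℕ.* y)
  interchange = ℕ-solve-∀

n≤2^n : ∀ n → n ≤ 2 ^ℕ n
n≤2^n zero    = z≤n
n≤2^n (suc n) = ℕ.≤-trans (ℕ.+-mono-≤ (ℕ.>-nonZero⁻¹ (2 ^ℕ n) {{ℕ.m^n≢0 2 n}}) (n≤2^n n)) (ℕ.+-monoʳ-≤ (2 ^ℕ n) (ℕ.≤-reflexive (sym (ℕ.+-identityʳ (2 ^ℕ n)))))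

1÷-antitone : ∀ {a b} → 1 ≤ a → a ≤ b → 1 ÷ b ℚ.≤ 1 ÷ a
1÷-antitone {a} {b} 1≤a a≤b = begin
  1 ÷ b                               ≡⟨ ℚ.*-identityˡ (1 ÷ b) ⟨
  1ℚ * (1 ÷ b)                        ≡⟨ cong (_* (1 ÷ b)) (fromℕ*1÷ 1≤a) ⟨
  fromℕ a * (1 ÷ a) * (1 ÷ b)         ≡⟨ swap (fromℕ a) (1 ÷ a) (1 ÷ b) ⟩
  fromℕ a * ((1 ÷ a) * (1 ÷ b))       ≤⟨ *-monoʳ ((1 ÷ a) * (1 ÷ b)) (*-nonneg (1÷-nonneg a) (1÷-nonneg b)) (fromℕ-mono a≤b) ⟩
  fromℕ b * ((1 ÷ a) * (1 ÷ b))       ≡⟨ swap′ (fromℕ b) (1 ÷ a) (1 ÷ b) ⟩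
  fromℕ b * (1 ÷ b) * (1 ÷ a)         ≡⟨ cong (_* (1 ÷ a)) (fromℕ*1÷ (ℕ.≤-trans 1≤a a≤b)) ⟩
  1ℚ * (1 ÷ a)                        ≡⟨ ℚ.*-identityˡ (1 ÷ a) ⟩
  1 ÷ a                               ∎
  where
  open ℚ.≤-Reasoning
  swap : ∀ a b c → a * b * c ≡ a * (b * c)
  swap = solve-∀ ℚ-ring
  swap′ : ∀ a b c → a * (b * c) ≡ a * c * b
  swap′ = solve-∀ ℚ-ring

bernoulli : ∀ {x} → 0ℚ ℚ.≤ x → ∀ n → 1ℚ + fromℕ n * x ℚ.≤ (1ℚ + x) ^ n
bernoulli {x} 0≤x zero    = ℚ.≤-reflexive (trans (cong (1ℚ +_) (ℚ.*-zeroˡ x)) (ℚ.+-identityʳ 1ℚ))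
bernoulli {x} 0≤x (suc n) = begin
  1ℚ + fromℕ (suc n) * x                 ≡⟨ cong (λ y → 1ℚ + y * x) (fromℕ-+ 1 n) ⟩
  1ℚ + (1ℚ + fromℕ n) * x                ≤⟨ ≤-by (x * (fromℕ n * x)) (*-nonneg 0≤x (*-nonneg (fromℕ-nonneg n) 0≤x)) (expand x (fromℕ n)) ⟩
  (1ℚ + x) * (1ℚ + fromℕ n * x)          ≤⟨ *-monoˡ (1ℚ + x) (+-nonneg 0≤1 0≤x) (bernoulli 0≤x n) ⟩
  (1ℚ + x) * (1ℚ + x) ^ n                ∎
  where
  open ℚ.≤-Reasoning
  expand : ∀ x n → (1ℚ + x) * (1ℚ + n * x) ≡ (1ℚ + (1ℚ + n) * x) + x * (n * x)
  expand = solve-∀ ℚ-ring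

-- By Bernoulli 2 ≤ (1 + 1/n)^n, and (1 + 1/n)(1 - 1/n) ≤ 1.
halving : ∀ {n} → 1 ≤ n → fromℕ 2 * (1ℚ - (1 ÷ n)) ^ n ℚ.≤ 1ℚ
halving {n} 1≤n = begin
  fromℕ 2 * σ ^ n                   ≡⟨ cong (λ y → (1ℚ + y) * σ ^ n) (fromℕ*1÷ 1≤n) ⟨
  (1ℚ + fromℕ n * ν) * σ ^ n        ≤⟨ *-monoʳ (σ ^ n) (^-nonneg n 0≤σ) (bernoulli (1÷-nonneg n) n) ⟩
  (1ℚ + ν) ^ n * σ ^ n              ≡⟨ ^-distrib-* (1ℚ + ν) σ n ⟨
  ((1ℚ + ν) * σ) ^ n                ≤⟨ ^-≤1 n (*-nonneg (+-nonneg 0≤1 (1÷-nonneg n)) 0≤σ) (≤-by (ν * ν) (²-nonneg ν) (difference ν)) ⟩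
  1ℚ                                ∎
  where
  open ℚ.≤-Reasoning
  ν = 1 ÷ n
  σ = 1ℚ - ν
  0≤σ : 0ℚ ℚ.≤ σ
  0≤σ = ≤⇒0≤- (1÷-≤1 n)
  difference : ∀ ν → 1ℚ ≡ (1ℚ + ν) * (1ℚ - ν) + ν * ν
  difference = solve-∀ ℚ-ring

module Parameters {k : ℕ} (1≤k : 1 ≤ k) (p m : Vector ℕ k) (pr : ∀ i → Prime (p i)) (p-injective : Injective _≡_ _≡_ p) (2≤m : ∀ i → 2 ≤ m i) where

  1≤m : ∀ i → 1 ≤ m i
  1≤m i = ℕ.<⇒≤ (2≤m i)

  2≤p : ∀ i → 2 ≤ p i
  2≤p i = ℕ.nonTrivial⇒n>1 (p i) {{prime⇒nonTrivial (pr i)}}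

  -- The joint period is at most P^(3kr) and division by τ costs at most P^r, so N ≥ P^(5kr) is
  -- ample. The factor 2 in n₀ makes σ², rather than σ, dominate the contraction factor.
  p̂ m̂ P B n₀ : ℕ
  p̂  = maximum p
  m̂  = maximum m
  P  = ∏ (λ i → p i ^ℕ 2)
  B  = P ^ℕ (5 ℕ.* k)
  n₀ = 2 ℕ.* (p̂ ^ℕ 4 ℕ.* m̂ ^ℕ 2)

  some : Fin k
  some = fromℕ< 1≤k

  2≤p̂ : 2 ≤ p̂
  2≤p̂ = ℕ.≤-trans (2≤p some) (≤maximum p some)

  2≤m̂ : 2 ≤ m̂
  2≤m̂ = ℕ.≤-trans (2≤m some) (≤maximum m some)

  1≤p̂⁴m̂² : 1 ≤ p̂ ^ℕ 4 ℕ.* m̂ ^ℕ 2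
  1≤p̂⁴m̂² = ℕ.*-mono-≤ (ℕ.^-monoˡ-≤ 4 (ℕ.<⇒≤ 2≤p̂)) (ℕ.^-monoˡ-≤ 2 (ℕ.<⇒≤ 2≤m̂))

  2≤n₀ : 2 ≤ n₀
  2≤n₀ = ℕ.*-mono-≤ (ℕ.≤-refl {2}) 1≤p̂⁴m̂²

  1≤n₀ : 1 ≤ n₀
  1≤n₀ = ℕ.<⇒≤ 2≤n₀

  1≤P : 1 ≤ P
  1≤P = ∏-pos (λ i → ℕ.^-monoˡ-≤ 2 (1≤p i))
    where
    1≤p : ∀ i → 1 ≤ p i
    1≤p i = ℕ.<⇒≤ (2≤p i)

  instance
    P≢0 : NonZero P
    P≢0 = ℕ.>-nonZero 1≤P

  p²≤P : ∀ i → p i ^ℕ 2 ≤ P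
  p²≤P i = ∣⇒≤ (∣∏ (λ i → p i ^ℕ 2) i)

  2≤p² : ∀ i → 2 ≤ p i ^ℕ 2
  2≤p² i = ℕ.≤-trans (s≤s (s≤s z≤n)) (ℕ.^-monoˡ-≤ 2 (2≤p i))

  2≤P : 2 ≤ P
  2≤P = ℕ.≤-trans (2≤p² some) (p²≤P some)

  2≤B : 2 ≤ B
  2≤B = ℕ.≤-trans 2≤P (ℕ.≤-trans (ℕ.≤-reflexive (sym (ℕ.^-identityʳ P))) (ℕ.^-monoʳ-≤ P (ℕ.*-mono-≤ (s≤s (z≤n {4})) 1≤k)))

  ν σ σ′ : ℚ
  ν  = 1 ÷ n₀
  σ  = 1ℚ - ν
  σ′ = fromℕ n₀ * (1 ÷ (n₀ ℕ.∸ 1))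

  2ν≤1 : fromℕ 2 * ν ℚ.≤ 1ℚ
  2ν≤1 = ℚ.≤-trans (*-monoʳ ν (1÷-nonneg n₀) (fromℕ-mono 2≤n₀)) (ℚ.≤-reflexive (fromℕ*1÷ 1≤n₀))

  0≤σ : 0ℚ ℚ.≤ σ
  0≤σ = ≤⇒0≤- (1÷-≤1 n₀)

  σ≤1 : σ ℚ.≤ 1ℚ
  σ≤1 = ≤-by ν (1÷-nonneg n₀) (identity ν)
    where
    identity : ∀ ν → 1ℚ ≡ (1ℚ - ν) + ν
    identity = solve-∀ ℚ-ring

  0≤σ′ : 0ℚ ℚ.≤ σ′
  0≤σ′ = *-nonneg (fromℕ-nonneg n₀) (1÷-nonneg (n₀ ℕ.∸ 1))

  σσ′≡1 : σ * σ′ ≡ 1ℚ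
  σσ′≡1 = begin
    (1ℚ - ν) * (fromℕ n₀ * ν′)             ≡⟨ expand ν (fromℕ n₀) ν′ ⟩
    (fromℕ n₀ - fromℕ n₀ * ν) * ν′         ≡⟨ cong₂ (λ a b → (a - b) * ν′) (trans (cong fromℕ (sym (ℕ.m+[n∸m]≡n 1≤n₀))) (fromℕ-+ 1 (n₀ ℕ.∸ 1))) (fromℕ*1÷ 1≤n₀) ⟩
    (1ℚ + fromℕ (n₀ ℕ.∸ 1) - 1ℚ) * ν′      ≡⟨ cancel (fromℕ (n₀ ℕ.∸ 1)) ν′ ⟩
    fromℕ (n₀ ℕ.∸ 1) * ν′                  ≡⟨ fromℕ*1÷ (ℕ.m<n⇒0<n∸m 2≤n₀) ⟩
    1ℚ                                     ∎
    where
    open ≡-Reasoning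
    ν′ = 1 ÷ (n₀ ℕ.∸ 1)
    expand : ∀ ν n ν′ → (1ℚ - ν) * (n * ν′) ≡ (n - n * ν) * ν′
    expand = solve-∀ ℚ-ring
    cancel : ∀ a b → (1ℚ + a - 1ℚ) * b ≡ a * b
    cancel = solve-∀ ℚ-ring

  -- Because σ ≥ 1/2 and P ≥ 2. The r-th power gives 1/τ ≤ H.
  1≤Pσ : 1ℚ ℚ.≤ fromℕ P * σ
  1≤Pσ = begin
    1ℚ                                 ≤⟨ ≤-by (1ℚ - fromℕ 2 * ν) (≤⇒0≤- 2ν≤1) (identity ν) ⟩
    fromℕ 2 * σ                        ≤⟨ *-monoʳ σ 0≤σ (fromℕ-mono 2≤P) ⟩
    fromℕ P * σ                        ∎
    where
    open ℚ.≤-Reasoning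
    identity : ∀ ν → (1ℚ + 1ℚ) * (1ℚ - ν) ≡ 1ℚ + (1ℚ - (1ℚ + 1ℚ) * ν)
    identity = solve-∀ ℚ-ring

  -- The contraction is weakest for the maximal prime and modulus, where the factor is 1 - 2/n₀ ≤ (1
  -- - 1/n₀)².
  decay-rate : ∀ i → 1ℚ - (1 ÷ (p i ^ℕ 2)) * (1 ÷ (p i ^ℕ 2)) * ((1 ÷ m i) * (1 ÷ m i)) ℚ.≤ σ * σ
  decay-rate i = begin
    1ℚ - (1 ÷ q) * (1 ÷ q) * ((1 ÷ m i) * (1 ÷ m i))     ≡⟨ cong (λ x → 1ℚ - x) recip ⟨
    1ℚ - (1 ÷ (q ℕ.* q ℕ.* (m i ℕ.* m i)))               ≤⟨ ℚ.+-monoʳ-≤ 1ℚ (ℚ.neg-antimono-≤ (1÷-antitone 1≤qqmm qqmm≤)) ⟩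
    1ℚ - (1 ÷ (p̂ ^ℕ 4 ℕ.* m̂ ^ℕ 2))                       ≡⟨ cong (λ x → 1ℚ - x) double ⟨
    1ℚ - fromℕ 2 * ν                                     ≤⟨ ≤-by (ν * ν) (²-nonneg ν) (square ν) ⟩
    σ * σ                                                ∎
    where
    open ℚ.≤-Reasoning
    q = p i ^ℕ 2
    1≤q : 1 ≤ q
    1≤q = ℕ.<⇒≤ (2≤p² i)
    1≤qqmm : 1 ≤ q ℕ.* q ℕ.* (m i ℕ.* m i)
    1≤qqmm = ℕ.*-mono-≤ (ℕ.*-mono-≤ 1≤q 1≤q) (ℕ.*-mono-≤ (1≤m i) (1≤m i))
    recip : 1 ÷ (q ℕ.* q ℕ.* (m i ℕ.* m i)) ≡ (1 ÷ q) * (1 ÷ q) * ((1 ÷ m i) * (1 ÷ m i))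
    recip = trans (1÷-* (q ℕ.* q) (m i ℕ.* m i) (ℕ.*-mono-≤ 1≤q 1≤q) (ℕ.*-mono-≤ (1≤m i) (1≤m i))) (cong₂ _*_ (1÷-* q q 1≤q 1≤q) (1÷-* (m i) (m i) (1≤m i) (1≤m i)))
    fourth : ∀ x y → x ℕ.* (x ℕ.* 1) ℕ.* (x ℕ.* (x ℕ.* 1)) ℕ.* (y ℕ.* y) ≡ x ℕ.* (x ℕ.* (x ℕ.* (x ℕ.* 1))) ℕ.* (y ℕ.* (y ℕ.* 1))
    fourth = ℕ-solve-∀
    qqmm≤ : q ℕ.* q ℕ.* (m i ℕ.* m i) ≤ p̂ ^ℕ 4 ℕ.* m̂ ^ℕ 2
    qqmm≤ = ℕ.≤-trans (ℕ.≤-reflexive (fourth (p i) (m i))) (ℕ.*-mono-≤ (ℕ.^-monoˡ-≤ 4 (≤maximum p i)) (ℕ.^-monoˡ-≤ 2 (≤maximum m i)))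
    double : fromℕ 2 * ν ≡ 1 ÷ (p̂ ^ℕ 4 ℕ.* m̂ ^ℕ 2)
    double = trans (cong (fromℕ 2 *_) (1÷-* 2 (p̂ ^ℕ 4 ℕ.* m̂ ^ℕ 2) (s≤s z≤n) 1≤p̂⁴m̂²)) (trans (sym (ℚ.*-assoc (fromℕ 2) (1 ÷ 2) (1 ÷ (p̂ ^ℕ 4 ℕ.* m̂ ^ℕ 2)))) (ℚ.*-identityˡ (1 ÷ (p̂ ^ℕ 4 ℕ.* m̂ ^ℕ 2))))
    square : ∀ ν → (1ℚ - ν) * (1ℚ - ν) ≡ (1ℚ - (1ℚ + 1ℚ) * ν) + ν * ν
    square = solve-∀ ℚ-ring

  -- Chosen so that (p_i²)^(L_i) ≤ P² < (p_i²)^(L_i + 1): all low-digit moduli then lie between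
  -- P^(2r) and P^(3r), however unequal the primes.
  L : Vector ℕ k
  L i = proj₁ (logarithm (2≤p² i) (P ℕ.* P) (ℕ.*-mono-≤ 1≤P 1≤P))

  p²ᴸ≤P² : ∀ i → (p i ^ℕ 2) ^ℕ L i ≤ P ℕ.* P
  p²ᴸ≤P² i = proj₁ (proj₂ (logarithm (2≤p² i) (P ℕ.* P) (ℕ.*-mono-≤ 1≤P 1≤P)))

  P²≤p²ᴸ⁺¹ : ∀ i → P ℕ.* P ≤ (p i ^ℕ 2) ^ℕ suc (L i)
  P²≤p²ᴸ⁺¹ i = ℕ.<⇒≤ (proj₂ (proj₂ (logarithm (2≤p² i) (P ℕ.* P) (ℕ.*-mono-≤ 1≤P 1≤P))))

  module _ (r N : ℕ) (Bʳ≤N : B ^ℕ r ≤ N) where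

    private
      H : ℕ
      H = P ^ℕ r

      τ : ℚ
      τ = σ ^ r

      Q : Vector ℕ k
      Q i = (p i ^ℕ 2) ^ℕ (suc (L i) ℕ.* r)

      0≤τ : 0ℚ ℚ.≤ τ
      0≤τ = ^-nonneg r 0≤σ

      J : Vector ℕ k
      J i = _∣_.quotient (∣∏ (λ i → p i ^ℕ 2) i) ^ℕ r

      H≡ : ∀ i → H ≡ J i ℕ.* (p i ^ℕ 2) ^ℕ r
      H≡ i = trans (cong (_^ℕ r) (_∣_.equality (∣∏ (λ i → p i ^ℕ 2) i))) (^ℕ-distrib-* r (_∣_.quotient (∣∏ (λ i → p i ^ℕ 2) i)) (p i ^ℕ 2))

      1≤Hτ : 1ℚ ℚ.≤ fromℕ H * τ
      1≤Hτ = ℚ.≤-trans (1≤^ r 1≤Pσ) (ℚ.≤-reflexive (trans (^-distrib-* (fromℕ P) σ r) (cong (_* τ) (sym (fromℕ-^ P r)))))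

      -- Each bound X ≤ Yτ below follows from X · H ≤ Y, because 1 ≤ Hτ.
      absorb : ∀ X Y → X ℕ.* H ≤ Y → fromℕ X ℚ.≤ fromℕ Y * τ
      absorb X Y XH≤Y = begin
        fromℕ X                      ≡⟨ ℚ.*-identityʳ (fromℕ X) ⟨
        fromℕ X * 1ℚ                 ≤⟨ *-monoˡ (fromℕ X) (fromℕ-nonneg X) 1≤Hτ ⟩
        fromℕ X * (fromℕ H * τ)      ≡⟨ ℚ.*-assoc (fromℕ X) (fromℕ H) τ ⟨
        fromℕ X * fromℕ H * τ        ≡⟨ cong (_* τ) (fromℕ-* X H) ⟨
        fromℕ (X ℕ.* H) * τ          ≤⟨ *-monoʳ τ 0≤τ (fromℕ-mono XH≤Y) ⟩
        fromℕ Y * τ                  ∎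
        where open ℚ.≤-Reasoning

      P^≤N : ∀ j → j ≤ 5 ℕ.* k ℕ.* r → P ^ℕ j ≤ N
      P^≤N j j≤ = ℕ.≤-trans (ℕ.^-monoʳ-≤ P j≤) (ℕ.≤-trans (ℕ.≤-reflexive (sym (ℕ.^-*-assoc P (5 ℕ.* k) r))) Bʳ≤N)

      r≤kr : r ≤ k ℕ.* r
      r≤kr = ℕ.m≤n*m r k {{ℕ.>-nonZero 1≤k}}

      H≤Qτ : ∀ i → fromℕ H ℚ.≤ fromℕ (Q i) * τ
      H≤Qτ i = absorb H (Q i) (begin
        P ^ℕ r ℕ.* P ^ℕ r                        ≡⟨ ^ℕ-distrib-* r P P ⟨
        (P ℕ.* P) ^ℕ r                           ≤⟨ ℕ.^-monoˡ-≤ r (P²≤p²ᴸ⁺¹ i) ⟩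
        ((p i ^ℕ 2) ^ℕ suc (L i)) ^ℕ r           ≡⟨ ℕ.^-*-assoc (p i ^ℕ 2) (suc (L i)) r ⟩
        Q i                                      ∎)
        where open ℕ.≤-Reasoning

      Q≤ : ∀ i → Q i ≤ P ^ℕ (3 ℕ.* r)
      Q≤ i = begin
        Q i                                      ≡⟨ ℕ.^-*-assoc (p i ^ℕ 2) (suc (L i)) r ⟨
        ((p i ^ℕ 2) ^ℕ suc (L i)) ^ℕ r           ≤⟨ ℕ.^-monoˡ-≤ r (ℕ.*-mono-≤ (p²≤P i) (p²ᴸ≤P² i)) ⟩
        (P ℕ.* (P ℕ.* P)) ^ℕ r                   ≡⟨ cong (_^ℕ r) (cube P) ⟩
        (P ^ℕ 3) ^ℕ r                            ≡⟨ ℕ.^-*-assoc P 3 r ⟩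
        P ^ℕ (3 ℕ.* r)                           ∎
        where
        open ℕ.≤-Reasoning
        cube : ∀ x → x ℕ.* (x ℕ.* x) ≡ x ℕ.* (x ℕ.* (x ℕ.* 1))
        cube = ℕ-solve-∀

      ∏Q≤Nτ : fromℕ (∏ Q) ℚ.≤ fromℕ N * τ
      ∏Q≤Nτ = absorb (∏ Q) N (begin
        ∏ Q ℕ.* P ^ℕ r                           ≤⟨ ℕ.*-monoˡ-≤ (P ^ℕ r) (∏-≤-^ Q≤) ⟩
        (P ^ℕ (3 ℕ.* r)) ^ℕ k ℕ.* P ^ℕ r         ≡⟨ cong (ℕ._* P ^ℕ r) (ℕ.^-*-assoc P (3 ℕ.* r) k) ⟩
        P ^ℕ (3 ℕ.* r ℕ.* k) ℕ.* P ^ℕ r          ≡⟨ ℕ.^-distribˡ-+-* P (3 ℕ.* r ℕ.* k) r ⟨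
        P ^ℕ (3 ℕ.* r ℕ.* k ℕ.+ r)               ≤⟨ P^≤N _ (ℕ.≤-trans (ℕ.+-monoʳ-≤ (3 ℕ.* r ℕ.* k) r≤kr) (ℕ.≤-trans (ℕ.m≤m+n _ (k ℕ.* r)) (ℕ.≤-reflexive (collect r k)))) ⟩
        N                                        ∎)
        where
        open ℕ.≤-Reasoning
        collect : ∀ r k → 3 ℕ.* r ℕ.* k ℕ.+ k ℕ.* r ℕ.+ k ℕ.* r ≡ 5 ℕ.* k ℕ.* r
        collect = ℕ-solve-∀

      kr*≤ : ∀ j j′ → j ℕ.+ j′ ≡ 5 → j ℕ.* r ≤ 5 ℕ.* k ℕ.* r
      kr*≤ j j′ j+j′≡5 = begin
        j ℕ.* r                  ≤⟨ ℕ.*-monoˡ-≤ r (subst (j ≤_) j+j′≡5 (ℕ.m≤m+n j j′)) ⟩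
        5 ℕ.* r                  ≤⟨ ℕ.*-monoʳ-≤ 5 r≤kr ⟩
        5 ℕ.* (k ℕ.* r)          ≡⟨ ℕ.*-assoc 5 k r ⟨
        5 ℕ.* k ℕ.* r            ∎
        where open ℕ.≤-Reasoning

      H≤Nτ : fromℕ H ℚ.≤ fromℕ N * τ
      H≤Nτ = absorb H N (ℕ.≤-trans (ℕ.≤-reflexive (trans (sym (ℕ.^-distribˡ-+-* P r r)) (cong (P ^ℕ_) (double r)))) (P^≤N _ (kr*≤ 2 3 refl)))
        where
        double : ∀ r → r ℕ.+ r ≡ 2 ℕ.* r
        double = ℕ-solve-∀

      H≤N : H ≤ N
      H≤N = ℕ.≤-trans (ℕ.≤-reflexive (cong (P ^ℕ_) (sym (ℕ.*-identityˡ r)))) (P^≤N _ (kr*≤ 1 4 refl))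

      H²≤N²τ : fromℕ H * fromℕ H ℚ.≤ fromℕ N * fromℕ N * τ
      H²≤N²τ = ℚ.≤-trans (*-mono (fromℕ-nonneg N) (fromℕ-nonneg H) (fromℕ-mono H≤N) H≤Nτ) (ℚ.≤-reflexive (sym (ℚ.*-assoc (fromℕ N) (fromℕ N) τ)))

    discrepancy-decay : ∀ a → (∀ i → a i < m i) →
      let S = fromℕ (count p m a N) - N ÷ ∏ m in S * S ℚ.≤ fromℕ 8 * (fromℕ k + 1ℚ) * (fromℕ N * fromℕ N * σ ^ r)
    -- ρ is the square σ², which gives ρ^r = τ². With s_i = L_i·r, the exponent r + s_i is
    -- `suc (L i) ℕ.* r` by definition.
    discrepancy-decay = Discrepancy.discrepancy pr p-injective 1≤m {σ * σ} {τ} {σ′ ^ r} (*-nonneg 0≤σ 0≤σ) decay-rate 0≤τ (^-nonneg r 0≤σ′)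
      (trans (sym (^-distrib-* σ σ′ r)) (trans (cong (_^ r) σσ′≡1) (1^n≡1 r))) r (^-distrib-* σ σ r) (λ i → L i ℕ.* r) J {H} {N} (ℕ.>-nonZero⁻¹ H {{ℕ.m^n≢0 P r}}) H≡ H≤Qτ ∏Q≤Nτ H≤Nτ H²≤N²τ

-- The power saving

module PowerSaving {k : ℕ} (1≤k : 1 ≤ k) (p m : Vector ℕ k) (pr : ∀ i → Prime (p i)) (p-injective : Injective _≡_ _≡_ p) (2≤m : ∀ i → 2 ≤ m i) where

  open Parameters 1≤k p m pr p-injective 2≤m

  -- D is 1/δ; its half E is the exponent that suits the squared discrepancy.
  D E : ℕ
  D = 120 ℕ.* k ^ℕ 2 ℕ.* p̂ ^ℕ (3 ℕ.* m̂) ℕ.* m̂ ^ℕ 2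
  E = 60 ℕ.* k ^ℕ 2 ℕ.* p̂ ^ℕ (3 ℕ.* m̂) ℕ.* m̂ ^ℕ 2

  private
    instance
      p̂≢0 : NonZero p̂
      p̂≢0 = ℕ.>-nonZero (ℕ.<⇒≤ 2≤p̂)

  D≡2E : D ≡ 2 ℕ.* E
  D≡2E = double (k ^ℕ 2) (p̂ ^ℕ (3 ℕ.* m̂)) (m̂ ^ℕ 2)
    where
    double : ∀ x y z → 120 ℕ.* x ℕ.* y ℕ.* z ≡ 2 ℕ.* (60 ℕ.* x ℕ.* y ℕ.* z)
    double = ℕ-solve-∀

  1≤E : 1 ≤ E
  1≤E = ℕ.*-mono-≤ (ℕ.*-mono-≤ (ℕ.*-mono-≤ (s≤s (z≤n {59})) (ℕ.^-monoˡ-≤ 2 1≤k)) (ℕ.>-nonZero⁻¹ (p̂ ^ℕ (3 ℕ.* m̂)) {{ℕ.m^n≢0 p̂ (3 ℕ.* m̂)}})) (ℕ.^-monoˡ-≤ 2 (ℕ.<⇒≤ 2≤m̂))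

  1≤D : 1 ≤ D
  1≤D = subst (1 ≤_) (sym D≡2E) (ℕ.≤-trans 1≤E (ℕ.m≤m+n E _))

  exponent : ℕ
  exponent = 10 ℕ.* k ^ℕ 2 ℕ.* p̂

  -- From P ≤ p̂^(2k) follows B ≤ p̂^(10k²), and p̂ ≤ 2^p̂ takes the place of a logarithm.
  B≤2^ : B ≤ 2 ^ℕ exponent
  B≤2^ = begin
    P ^ℕ (5 ℕ.* k)                                    ≤⟨ ℕ.^-monoˡ-≤ (5 ℕ.* k) (∏-≤-^ (λ i → ℕ.^-monoˡ-≤ 2 (≤maximum p i))) ⟩
    ((p̂ ^ℕ 2) ^ℕ k) ^ℕ (5 ℕ.* k)                      ≤⟨ ℕ.^-monoˡ-≤ (5 ℕ.* k) (ℕ.^-monoˡ-≤ k (ℕ.^-monoˡ-≤ 2 (n≤2^n p̂))) ⟩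
    (((2 ^ℕ p̂) ^ℕ 2) ^ℕ k) ^ℕ (5 ℕ.* k)               ≡⟨ trans (cong (_^ℕ (5 ℕ.* k)) (trans (cong (_^ℕ k) (ℕ.^-*-assoc 2 p̂ 2)) (ℕ.^-*-assoc 2 (p̂ ℕ.* 2) k))) (ℕ.^-*-assoc 2 (p̂ ℕ.* 2 ℕ.* k) (5 ℕ.* k)) ⟩
    2 ^ℕ (p̂ ℕ.* 2 ℕ.* k ℕ.* (5 ℕ.* k))                ≡⟨ cong (2 ^ℕ_) (collect p̂ k) ⟩
    2 ^ℕ exponent                                     ∎
    where
    open ℕ.≤-Reasoning
    collect : ∀ p k → p ℕ.* 2 ℕ.* k ℕ.* (5 ℕ.* k) ≡ 10 ℕ.* (k ℕ.* (k ℕ.* 1)) ℕ.* p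
    collect = ℕ-solve-∀

  n₀*exponent≤E : n₀ ℕ.* exponent ≤ E
  n₀*exponent≤E = begin
    2 ℕ.* (p̂ ^ℕ 4 ℕ.* m̂ ^ℕ 2) ℕ.* (10 ℕ.* k ^ℕ 2 ℕ.* p̂)        ≡⟨ collect (p̂ ^ℕ 4) (m̂ ^ℕ 2) (k ^ℕ 2) p̂ ⟩
    20 ℕ.* k ^ℕ 2 ℕ.* p̂ ^ℕ 5 ℕ.* m̂ ^ℕ 2                        ≤⟨ ℕ.*-monoˡ-≤ (m̂ ^ℕ 2) (ℕ.*-mono-≤ (ℕ.*-monoˡ-≤ (k ^ℕ 2) (ℕ.m≤m+n 20 40)) (ℕ.^-monoʳ-≤ p̂ (ℕ.≤-trans (ℕ.n≤1+n 5) (ℕ.*-monoʳ-≤ 3 2≤m̂)))) ⟩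
    E                                                          ∎
    where
    open ℕ.≤-Reasoning
    collect : ∀ x y z p → 2 ℕ.* (x ℕ.* y) ℕ.* (10 ℕ.* z ℕ.* p) ≡ 20 ℕ.* z ℕ.* (p ℕ.* x) ℕ.* y
    collect = ℕ-solve-∀

  -- Every n₀ factors σ at least halve the product, and E contains enough such groups to outweigh B.
  Bσ^E≤1 : fromℕ B * σ ^ E ℚ.≤ 1ℚ
  Bσ^E≤1 = begin
    fromℕ B * σ ^ E                                        ≤⟨ *-mono (fromℕ-nonneg (2 ^ℕ exponent)) (^-nonneg E 0≤σ) (fromℕ-mono B≤2^) (^-antitone 0≤σ σ≤1 n₀*exponent≤E) ⟩
    fromℕ (2 ^ℕ exponent) * σ ^ (n₀ ℕ.* exponent)          ≡⟨ cong₂ _*_ (fromℕ-^ 2 exponent) (sym (^-assocʳ σ n₀ exponent)) ⟩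
    fromℕ 2 ^ exponent * (σ ^ n₀) ^ exponent               ≡⟨ ^-distrib-* (fromℕ 2) (σ ^ n₀) exponent ⟨
    (fromℕ 2 * σ ^ n₀) ^ exponent                          ≤⟨ ^-≤1 exponent (*-nonneg (fromℕ-nonneg 2) (^-nonneg n₀ 0≤σ)) (halving 1≤n₀) ⟩
    1ℚ                                                     ∎
    where open ℚ.≤-Reasoning

  C₀ C : ℕ
  C₀ = 8 ℕ.* (k ℕ.+ 1)
  C  = C₀ ℕ.* B

  S : Vector ℕ k → ℕ → ℚ
  S a N = fromℕ (count p m a N) - N ÷ ∏ m

  -- For B^r ≤ N < B^(r+1) one has Nτ^E ≤ B(Bσ^E)^r ≤ B: the E-th power of the squared discrepancy
  -- has gained a factor N.
  power-saving : ∀ a → (∀ i → a i < m i) → ∀ N → 1 ≤ N → ∣ S a N ∣ ^ D * fromℕ N ℚ.≤ fromℕ C ^ D * fromℕ N ^ D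
  power-saving a a<m N 1≤N with logarithm 2≤B N 1≤N
  ... | r , Bʳ≤N , N<Bʳ⁺¹ = begin
    x ^ D * n                                                   ≡⟨ cong (_* n) (square x) ⟩
    (x * x) ^ E * n                                             ≤⟨ *-monoʳ n 0≤n (^-mono E (²-nonneg x) x²≤) ⟩
    (c * (n * n * τ)) ^ E * n                                   ≡⟨ cong (_* n) (trans (^-distrib-* c (n * n * τ) E) (cong (c ^ E *_) (^-distrib-* (n * n) τ E))) ⟩
    c ^ E * ((n * n) ^ E * τ ^ E) * n                           ≡⟨ regroup (c ^ E) ((n * n) ^ E) (τ ^ E) n ⟩
    c ^ E * (n * n) ^ E * (n * τ ^ E)                           ≤⟨ *-monoˡ (c ^ E * (n * n) ^ E) (*-nonneg (^-nonneg E 0≤c) (^-nonneg E (²-nonneg n))) nτ^E≤B ⟩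
    c ^ E * (n * n) ^ E * b                                     ≡⟨ regroup′ (c ^ E) ((n * n) ^ E) b ⟩
    c ^ E * b * (n * n) ^ E                                     ≤⟨ *-monoʳ ((n * n) ^ E) (^-nonneg E (²-nonneg n)) c^Eb≤ ⟩
    fromℕ C ^ D * (n * n) ^ E                                   ≡⟨ cong (fromℕ C ^ D *_) (square n) ⟨
    fromℕ C ^ D * n ^ D                                         ∎
    where
    open ℚ.≤-Reasoning
    x = ∣ S a N ∣
    n = fromℕ N
    τ = σ ^ r
    c = fromℕ C₀
    b = fromℕ B
    0≤n : 0ℚ ℚ.≤ n
    0≤n = fromℕ-nonneg N
    0≤c : 0ℚ ℚ.≤ c
    0≤c = fromℕ-nonneg C₀
    square : ∀ y → y ^ D ≡ (y * y) ^ E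
    square y = trans (cong (y ^_) D≡2E) (trans (sym (^-assocʳ y 2 E)) (cong (λ z → (y * z) ^ E) (ℚ.*-identityʳ y)))
    c≡ : c ≡ fromℕ 8 * (fromℕ k + 1ℚ)
    c≡ = trans (fromℕ-* 8 (k ℕ.+ 1)) (cong (fromℕ 8 *_) (fromℕ-+ k 1))
    x²≤ : x * x ℚ.≤ c * (n * n * τ)
    x²≤ = ℚ.≤-trans (ℚ.≤-reflexive (∣x∣²≡x² (S a N))) (ℚ.≤-trans (discrepancy-decay r N Bʳ≤N a a<m) (ℚ.≤-reflexive (cong (_* (n * n * τ)) (sym c≡))))
    regroup : ∀ a b c d → a * (b * c) * d ≡ a * b * (d * c)
    regroup = solve-∀ ℚ-ring
    regroup′ : ∀ a b c → a * b * c ≡ a * c * b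
    regroup′ = solve-∀ ℚ-ring
    τ^E≡ : τ ^ E ≡ (σ ^ E) ^ r
    τ^E≡ = trans (^-assocʳ σ r E) (trans (cong (σ ^_) (ℕ.*-comm r E)) (sym (^-assocʳ σ E r)))
    nτ^E≤B : n * τ ^ E ℚ.≤ b
    nτ^E≤B = begin
      n * τ ^ E                              ≤⟨ *-monoʳ (τ ^ E) (^-nonneg E (^-nonneg r 0≤σ)) (fromℕ-mono (ℕ.<⇒≤ N<Bʳ⁺¹)) ⟩
      fromℕ (B ^ℕ suc r) * τ ^ E             ≡⟨ cong₂ _*_ (fromℕ-^ B (suc r)) τ^E≡ ⟩
      b * b ^ r * (σ ^ E) ^ r                ≡⟨ trans (ℚ.*-assoc b (b ^ r) ((σ ^ E) ^ r)) (cong (b *_) (sym (^-distrib-* b (σ ^ E) r))) ⟩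
      b * (b * σ ^ E) ^ r                    ≤⟨ *-monoˡ b (fromℕ-nonneg B) (^-≤1 r (*-nonneg (fromℕ-nonneg B) (^-nonneg E 0≤σ)) Bσ^E≤1) ⟩
      b * 1ℚ                                 ≡⟨ ℚ.*-identityʳ b ⟩
      b                                      ∎
    1≤c : 1 ≤ C₀
    1≤c = ℕ.*-mono-≤ (s≤s (z≤n {7})) (ℕ.m≤n+m 1 k)
    1≤b : 1ℚ ℚ.≤ b
    1≤b = fromℕ-mono (ℕ.<⇒≤ 2≤B)
    ≤^ : ∀ {y} j → 1 ≤ j → 1ℚ ℚ.≤ y → y ℚ.≤ y ^ j
    ≤^ {y} (suc j) _ 1≤y = ℚ.≤-trans (ℚ.≤-reflexive (sym (ℚ.*-identityʳ y))) (*-monoˡ y (ℚ.≤-trans 0≤1 1≤y) (1≤^ j 1≤y))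
    -- Wasteful, but it makes the constant a D-th power.
    c^Eb≤ : c ^ E * b ℚ.≤ fromℕ C ^ D
    c^Eb≤ = begin
      c ^ E * b                              ≤⟨ *-mono (^-nonneg E (²-nonneg c)) (fromℕ-nonneg B) (^-mono E 0≤c c≤c²) (≤^ D 1≤D 1≤b) ⟩
      (c * c) ^ E * b ^ D                    ≡⟨ cong (_* b ^ D) (square c) ⟨
      c ^ D * b ^ D                          ≡⟨ ^-distrib-* c b D ⟨
      (c * b) ^ D                            ≡⟨ cong (_^ D) (fromℕ-* C₀ B) ⟨
      fromℕ C ^ D                            ∎
      where
      c≤c² : c ℚ.≤ c * c
      c≤c² = ℚ.≤-trans (ℚ.≤-reflexive (sym (ℚ.*-identityʳ c))) (*-monoˡ c 0≤c (fromℕ-mono 1≤c))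

-- Rational exponents and asymptotic equivalence

1-1÷suc : ∀ d → .(c : Coprime d (suc d)) → 1ℚ - (1 ÷ suc d) ≡ ℚ.mkℚ (ℤ.+ d) d c
1-1÷suc d c = begin
  1ℚ - ν                             ≡⟨ cong (_- ν) (fromℕ*1÷ {suc d} z<s) ⟨
  fromℕ (suc d) * ν - ν              ≡⟨ cong (λ x → x * ν - ν) (fromℕ-+ 1 d) ⟩
  (1ℚ + fromℕ d) * ν - ν             ≡⟨ cancel (fromℕ d) ν ⟩
  fromℕ d * ν                        ≡⟨ ÷-as-* d {suc d} z<s ⟨
  d ÷ suc d                          ≡⟨ ℚ.normalize-coprime c ⟩
  ℚ.mkℚ (ℤ.+ d) d c                  ∎
  where
  open ≡-Reasoning
  ν = 1 ÷ suc d
  cancel : ∀ d ν → (1ℚ + d) * ν - ν ≡ d * ν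
  cancel = solve-∀ ℚ-ring

-- The relation inspects numerator and denominator, so 1 - 1/D is first rewritten to the normal form
-- (D - 1)/D, which is in lowest terms; one factor N is then cancelled.
≤[]-intro : ∀ {x} C N D → 1 ≤ D → 1 ≤ N → x ^ D * fromℕ N ℚ.≤ fromℕ C ^ D * fromℕ N ^ D → x ≤[ C · N ^ 1ℚ - (1 ÷ D) ]
≤[]-intro {x} C N (suc d) _ 1≤N bound = subst (λ q → x ≤[ C · N ^ q ]) (sym (1-1÷suc d d⊥1+d))
  (*-cancelˡ (fromℕ N) (fromℕ-pos 1≤N) (subst₂ ℚ._≤_ (ℚ.*-comm (x ^ suc d) (fromℕ N)) (rotate (fromℕ C ^ suc d) (fromℕ N) (fromℕ N ^ d)) bound))
  where
  rotate : ∀ a b c → a * (b * c) ≡ b * (a * c)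
  rotate = solve-∀ ℚ-ring
  d⊥1+d : Coprime d (suc d)
  d⊥1+d {j} (j∣d , j∣1+d) = ∣1⇒≡1 (∣m+n∣m⇒∣n (subst (j ∣_) (ℕ.+-comm 1 d) j∣1+d) j∣d)

^-mono-< : ∀ {x y} n → 1 ≤ n → 0ℚ ℚ.≤ x → x ℚ.< y → x ^ n ℚ.< y ^ n
^-mono-< {x} {y} (suc zero)      _ 0≤x x<y = subst₂ ℚ._<_ (sym (ℚ.*-identityʳ x)) (sym (ℚ.*-identityʳ y)) x<y
^-mono-< {x} {y} (suc n@(suc _)) _ 0≤x x<y = ℚ.≤-<-trans (*-monoˡ x 0≤x (^-mono n 0≤x (ℚ.<⇒≤ x<y)))
  (ℚ.*-monoˡ-<-pos (y ^ n) {{ℚ.positive (ℚ.≤-<-trans (^-nonneg n 0≤x) (^-mono-< n z<s 0≤x x<y))}} x<y)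

-- If βN < |S N|, then β^D N^(D+1) < C^D N^D, which fails for N ≥ (C/β)^D. The contradiction spares
-- a D-th root.
power-saving⇒small : ∀ (S : ℕ → ℚ) C D → 1 ≤ D → (∀ N → 1 ≤ N → ∣ S N ∣ ^ D * fromℕ N ℚ.≤ fromℕ C ^ D * fromℕ N ^ D) →
                     ∀ β → 0ℚ ℚ.< β → ∃[ N₀ ] (∀ N → N₀ ≤ N → ∣ S N ∣ ℚ.≤ β * fromℕ N)
power-saving⇒small S C D 1≤D bound β 0<β = suc n₀ , λ N N₀≤N → ℚ.≮⇒≥ (λ βN<S → ℚ.<-irrefl refl (contra N N₀≤N βN<S))
  where
  open ℚ.≤-Reasoning
  instance
    β>0 : ℚ.Positive β
    β>0 = ℚ.positive 0<β
    β≢0 : ℚ.NonZero β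
    β≢0 = ℚ.pos⇒nonZero β
  β⁻¹ = ℚ.1/ β
  n₀ = proj₁ (≤fromℕ (fromℕ C ^ D * β⁻¹ ^ D))
  n₀-bound : fromℕ C ^ D * β⁻¹ ^ D ℚ.≤ fromℕ n₀
  n₀-bound = proj₂ (≤fromℕ (fromℕ C ^ D * β⁻¹ ^ D))
  0≤β : 0ℚ ℚ.≤ β
  0≤β = ℚ.<⇒≤ 0<β
  invert : (β * β⁻¹) ^ D ≡ 1ℚ
  invert = trans (cong (_^ D) (ℚ.*-inverseʳ β)) (1^n≡1 D)
  assoc : ∀ c a b n → c * (a * b) * n ≡ a * n * (c * b)
  assoc = solve-∀ ℚ-ring
  contra : ∀ N → suc n₀ ≤ N → β * fromℕ N ℚ.< ∣ S N ∣ → fromℕ C ^ D * fromℕ N ^ D ℚ.< fromℕ C ^ D * fromℕ N ^ D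
  contra N N₀≤N βN<S = begin-strict
    fromℕ C ^ D * n ^ D                            ≡⟨ cong (_* n ^ D) (trans (sym (ℚ.*-identityʳ (fromℕ C ^ D))) (cong (fromℕ C ^ D *_) (trans (sym invert) (^-distrib-* β β⁻¹ D)))) ⟩
    fromℕ C ^ D * (β ^ D * β⁻¹ ^ D) * n ^ D        ≡⟨ assoc (fromℕ C ^ D) (β ^ D) (β⁻¹ ^ D) (n ^ D) ⟩
    β ^ D * n ^ D * (fromℕ C ^ D * β⁻¹ ^ D)        ≤⟨ *-monoˡ (β ^ D * n ^ D) (*-nonneg (^-nonneg D 0≤β) (^-nonneg D (fromℕ-nonneg N))) (ℚ.≤-trans n₀-bound (fromℕ-mono (ℕ.<⇒≤ N₀≤N))) ⟩
    β ^ D * n ^ D * n                              ≡⟨ cong (_* n) (^-distrib-* β n D) ⟨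
    (β * n) ^ D * n                                <⟨ ℚ.*-monoˡ-<-pos n {{ℚ.positive (fromℕ-pos 1≤N)}} (^-mono-< D 1≤D (*-nonneg 0≤β (fromℕ-nonneg N)) βN<S) ⟩
    ∣ S N ∣ ^ D * n                                ≤⟨ bound N 1≤N ⟩
    fromℕ C ^ D * n ^ D                            ∎
    where
    n = fromℕ N
    1≤N : 1 ≤ N
    1≤N = ℕ.≤-trans z<s N₀≤N

1÷-pos : ∀ {n} → 1 ≤ n → 0ℚ ℚ.< 1 ÷ n
1÷-pos {suc n} _ = ℚ.positive⁻¹ (1 ÷ suc n) {{ℚ.normalize-pos 1 (suc n)}}

∏-const : ∀ c k → ∏ {k} (λ _ → c) ≡ c ^ℕ k
∏-const c zero    = refl
∏-const c (suc k) = cong (c ℕ.*_) (∏-const c k)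

theorem1 : (∀ (k : ℕ) → 1 ≤ k →
    ∀ (p : Fin k → ℕ) → (∀ i → Prime (p i)) → Injective _≡_ _≡_ p →
    ∀ (m : Fin k → ℕ) → (∀ i → 2 ≤ m i) → (∀ i → p i ∤ m i) →
    ∃[ C ] (∀ (a : Fin k → ℕ) → (∀ i → a i < m i) →
    ∀ (N : ℕ) → 1 ≤ N →
    ∣ fromℕ (count p m a N) - N ÷ ∏ m ∣ ≤[ C · N ^ 1ℚ - δ p m ]))
    ×
    (∀ (k : ℕ) → 1 ≤ k →
    ∀ (p : Fin k → ℕ) → (∀ i → Prime (p i)) → Injective _≡_ _≡_ p →
    (∀ i → 2 ∤ p i) →
    ∀ (ε : Fin k → Fin 2) →
    (λ N → fromℕ (count p (λ _ → 2) (λ i → toℕ (ε i)) N)) ∼ (λ N → N ÷ (2 ^ℕ k)))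
theorem1 = joint-distribution , parity-distribution
  where
  joint-distribution : ∀ (k : ℕ) → 1 ≤ k →
    ∀ (p : Fin k → ℕ) → (∀ i → Prime (p i)) → Injective _≡_ _≡_ p →
    ∀ (m : Fin k → ℕ) → (∀ i → 2 ≤ m i) → (∀ i → p i ∤ m i) →
    ∃[ C ] (∀ (a : Fin k → ℕ) → (∀ i → a i < m i) →
    ∀ (N : ℕ) → 1 ≤ N →
    ∣ fromℕ (count p m a N) - N ÷ ∏ m ∣ ≤[ C · N ^ 1ℚ - δ p m ])
  joint-distribution k 1≤k p pr p-injective m 2≤m _ =
    C , λ a a<m N 1≤N → ≤[]-intro C N D 1≤D 1≤N (power-saving a a<m N 1≤N)
    where open PowerSaving 1≤k p m pr p-injective 2≤m

  parity-distribution : ∀ (k : ℕ) → 1 ≤ k →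
    ∀ (p : Fin k → ℕ) → (∀ i → Prime (p i)) → Injective _≡_ _≡_ p →
    (∀ i → 2 ∤ p i) →
    ∀ (ε : Fin k → Fin 2) →
    (λ N → fromℕ (count p (λ _ → 2) (λ i → toℕ (ε i)) N)) ∼ (λ N → N ÷ (2 ^ℕ k))
  -- The relative error θ becomes the absolute error θμN with μ = 2^(-k).
  parity-distribution k 1≤k p pr p-injective _ ε θ 0<θ = proj₁ small , λ N N₀≤N →
    subst₂ ℚ._≤_ (cong (λ x → ∣ fromℕ (count p (λ _ → 2) a N) - N ÷ x ∣) (∏-const 2 k)) (main-term N) (proj₂ small N N₀≤N)
    where
    open PowerSaving 1≤k p (λ _ → 2) pr p-injective (λ _ → ℕ.≤-refl)
    a : Fin k → ℕ
    a i = toℕ (ε i)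
    1≤2^k : 1 ≤ 2 ^ℕ k
    1≤2^k = ℕ.>-nonZero⁻¹ (2 ^ℕ k) {{ℕ.m^n≢0 2 k}}
    μ : ℚ
    μ = 1 ÷ (2 ^ℕ k)
    0<μ : 0ℚ ℚ.< μ
    0<μ = 1÷-pos 1≤2^k
    0<θμ : 0ℚ ℚ.< θ * μ
    0<θμ = ℚ.positive⁻¹ (θ * μ) {{ℚ.pos*pos⇒pos θ {{ℚ.positive 0<θ}} μ {{ℚ.positive 0<μ}}}}
    small = power-saving⇒small (S a) C D 1≤D (power-saving a (λ i → toℕ<n (ε i))) (θ * μ) 0<θμ
    main-term : ∀ N → θ * μ * fromℕ N ≡ θ * ∣ N ÷ (2 ^ℕ k) ∣
    main-term N = trans (ℚ.*-assoc θ μ (fromℕ N)) (cong (θ *_) (trans (ℚ.*-comm μ (fromℕ N)) (trans (sym (ℚ.0≤p⇒∣p∣≡p (*-nonneg (fromℕ-nonneg N) (1÷-nonneg (2 ^ℕ k))))) (cong ∣_∣ (sym (÷-as-* N 1≤2^k))))))
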